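{- For every $\Delta\geq 2$ and every $\varepsilon>0$, there is a $(1+\varepsilon)$-approximation algorithm for $\Delta$-TVC on temporal graphs whose underlying graph is a path or a cycle, running in time $\mathcal{O}\big(n(T-\Delta+1)\cdot (T(n+1))^{\mathcal{O}(\varepsilon^{ -2})}\big)=\mathcal{O}\big((T(n+1))^{\mathcal{O}(\varepsilon^{ -2})}\big)$, where $n$ is the number of edges of the underlying graph and $T$ is the lifetime. In particular $\Delta$-TVC on such instances admits a PTAS.
   Context: A temporal graph is a pair $(G,\lambda)$ where $G=(V,E)$ is a finite static graph and $\lambda: E \to 2^{\mathbb{N}}$ assigns to every edge a finite set of positive integer time labels; $e$ is active at time $t$ if $t \in \lambda(e)$. The lifetime is $T=\max\{t : t\in\lambda(e), e\in E\}$. For $\Delta\in\mathbb{N}$ and $t \in [1, T-\Delta+1]$, the $\Delta$-time window is $W_t=[t,t+\Delta-1]$. A vertex appearance is a pair $(v,t)$ with $v\in V$, $t\in[T]$. For a set $S$ of vertex appearances, $S[W_i]=\{(v,t)\in S : t\in W_i\}$, and $E[W_i]=\{e\in E : \lambda(e)\cap W_i\neq\emptyset\}$. A set $S$ of vertex appearances is a sliding $\Delta$-time window temporal vertex cover ($\Delta$-TVC) of $(G,\lambda)$ if for every $i\in[1,T-\Delta+1]$ and every $e\in E[W_i]$ there is $(v,t)\in S[W_i]$ with $v$ an endpoint of $e$ and $t\in\lambda(e)$. The $\Delta$-TVC problem asks for a $\Delta$-TVC of minimum cardinality. -}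

module Defs where

open import Data.Fin.Base using (Fin; toℕ)
open import Data.Fin.Permutation using (Permutation′; _⟨$⟩ʳ_)
open import Data.Integer.Base as ℤ using ()
open import Data.List.Base using (List; []; _∷_; length; map; concat; tabulate)
open import Data.List.Extrema.Nat using (max)
open import Data.List.Membership.Propositional using (_∈_)
open import Data.List.Relation.Unary.All as All using (All; []; _∷_)
open import Data.List.Relation.Unary.Unique.Propositional using (Unique)
open import Data.Nat.Base using (ℕ; zero; suc; _+_; _*_; _∸_; _^_; _≤_; _<_)
open import Data.Product.Base using (Σ-syntax; ∃-syntax; _×_; _,_; proj₁; proj₂)
open import Data.Rational.Base as ℚ using (ℚ; 1ℚ; 1/_; ceiling)
open import Data.Rational.Properties using (pos⇒nonZero)
open import Data.Sum.Base using (_⊎_)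
open import Function.Bundles using (_⇔_)
open import Relation.Binary.PropositionalEquality using (_≡_; _≢_)

------------------------------------------------------------------------
-- Temporal graphs

record Graph : Set where
  field
    |V| |E| : ℕ
    ends    : Fin |E| → Fin |V| × Fin |V|

  Joins : Fin |E| → Fin |V| → Fin |V| → Set
  Joins e u v = ends e ≡ (u , v) ⊎ ends e ≡ (v , u)

  field
    loopless   : ∀ e → proj₁ (ends e) ≢ proj₂ (ends e)
    noParallel : ∀ e f u v → Joins e u v → Joins f u v → e ≡ f

  Adjacent : Fin |V| → Fin |V| → Set
  Adjacent u v = ∃[ e ] Joins e u v

  Endpoint : Fin |V| → Fin |E| → Set
  Endpoint v e = v ≡ proj₁ (ends e) ⊎ v ≡ proj₂ (ends e)

PathAdjacent : ∀ {k} → Fin k → Fin k → Set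
PathAdjacent i j = toℕ j ≡ suc (toℕ i) ⊎ toℕ i ≡ suc (toℕ j)

CycleAdjacent : ∀ {k} → Fin k → Fin k → Set
CycleAdjacent {k} i j =
  PathAdjacent i j
  ⊎ (toℕ i ≡ 0 × suc (toℕ j) ≡ k)
  ⊎ (toℕ j ≡ 0 × suc (toℕ i) ≡ k)

-- The vertices of G may be numbered arbitrarily: σ is an isomorphism onto
-- the standard path (cycle) on the same number of vertices.

IsPath : Graph → Set
IsPath G = 1 ≤ |V| × Σ[ σ ∈ Permutation′ |V| ]
    (∀ u v → Adjacent u v ⇔ PathAdjacent (σ ⟨$⟩ʳ u) (σ ⟨$⟩ʳ v))
  where open Graph G

IsCycle : Graph → Set
IsCycle G = 3 ≤ |V| × Σ[ σ ∈ Permutation′ |V| ]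
    (∀ u v → Adjacent u v ⇔ CycleAdjacent (σ ⟨$⟩ʳ u) (σ ⟨$⟩ʳ v))
  where open Graph G

record TemporalGraph : Set where
  field
    graph : Graph

  open Graph graph public

  -- Finite sets are represented by duplicate-free lists, in any order.
  field
    labels   : Fin |E| → List ℕ
    unique   : ∀ e → Unique (labels e)
    positive : ∀ e → All (1 ≤_) (labels e)

  -- The lifetime; 0 if there are no labels at all.
  T : ℕ
  T = max 0 (concat (tabulate labels))

PathOrCycle : TemporalGraph → Set
PathOrCycle G = IsPath graph ⊎ IsCycle graph
  where open TemporalGraph G

------------------------------------------------------------------------
-- Sliding window temporal vertex covers

-- t lies in the window W_i = [i, i + Δ - 1].
InWindow : (Δ i t : ℕ) → Set
InWindow Δ i t = i ≤ t × t < i + Δ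

module _ (G : TemporalGraph) where
  open TemporalGraph G

  record AppearanceSet : Set where
    field
      elements : List (Fin |V| × ℕ)
      unique   : Unique elements
      inRange  : All (λ (v , t) → 1 ≤ t × t ≤ T) elements

    card : ℕ
    card = length elements

  open AppearanceSet

  -- i ranges over [1, T - Δ + 1]; this is empty if T < Δ.
  IsTVC : ℕ → AppearanceSet → Set
  IsTVC Δ S =
    ∀ i → 1 ≤ i → i + Δ ≤ suc T →
    ∀ e → (∃[ t ] (t ∈ labels e × InWindow Δ i t)) →
    ∃[ v ] ∃[ t ] ((v , t) ∈ elements S × InWindow Δ i t
                   × Endpoint v e × t ∈ labels e)

  IsMinimumTVC : ℕ → AppearanceSet → Set
  IsMinimumTVC Δ S = IsTVC Δ S × (∀ S′ → IsTVC Δ S′ → card S ≤ card S′)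

------------------------------------------------------------------------
-- The model of computation: a typed call-by-value functional language whose
-- evaluator counts steps.
--
-- Every constructor of a term costs one step each time it is evaluated, and so
-- does every unfolding of a recursor.  With closures and pointers to shared
-- data, each step takes O(1) time on a RAM for a fixed program.  The only
-- arithmetic is successor, predecessor (by case analysis) and truncated
-- subtraction, so a number arising after s steps exceeds the numbers in the
-- input and the program by at most s: unit cost does not hide the
-- manipulation of huge numbers, as it could with unit-cost doubling.

infixr 7 _⇒_
infixr 8 _⊗_

data Ty : Set where
  nat  : Ty
  list : Ty → Ty
  _⊗_  : Ty → Ty → Ty
  _⇒_  : Ty → Ty → Ty

Ctx : Set
Ctx = List Ty

data Term (Γ : Ctx) : Ty → Set where
  var   : ∀ {σ} → σ ∈ Γ → Term Γ σ
  lam   : ∀ {σ τ} → Term (σ ∷ Γ) τ → Term Γ (σ ⇒ τ)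
  app   : ∀ {σ τ} → Term Γ (σ ⇒ τ) → Term Γ σ → Term Γ τ
  pair  : ∀ {σ τ} → Term Γ σ → Term Γ τ → Term Γ (σ ⊗ τ)
  fst   : ∀ {σ τ} → Term Γ (σ ⊗ τ) → Term Γ σ
  snd   : ∀ {σ τ} → Term Γ (σ ⊗ τ) → Term Γ τ
  lit   : ℕ → Term Γ nat
  succ  : Term Γ nat → Term Γ nat
  sub   : Term Γ nat → Term Γ nat → Term Γ nat
  caseℕ : ∀ {τ} → Term Γ nat → Term Γ τ → Term (nat ∷ Γ) τ → Term Γ τ
  recℕ  : ∀ {τ} → Term Γ nat → Term Γ τ → Term (τ ∷ nat ∷ Γ) τ → Term Γ τ
  nil   : ∀ {σ} → Term Γ (list σ)
  cons  : ∀ {σ} → Term Γ σ → Term Γ (list σ) → Term Γ (list σ)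
  caseL : ∀ {σ τ} → Term Γ (list σ) → Term Γ τ →
          Term (list σ ∷ σ ∷ Γ) τ → Term Γ τ
  recL  : ∀ {σ τ} → Term Γ (list σ) → Term Γ τ →
          Term (τ ∷ list σ ∷ σ ∷ Γ) τ → Term Γ τ

-- A value together with the number of steps taken to compute it.
Cost : Set → Set
Cost A = A × ℕ

return : ∀ {A} → A → Cost A
return x = x , 0

tick : ∀ {A} → Cost A → Cost A
tick (x , m) = x , suc m

infixl 1 _>>=_
_>>=_ : ∀ {A B} → Cost A → (A → Cost B) → Cost B
(x , m) >>= f = proj₁ (f x) , m + proj₂ (f x)

⟦_⟧ : Ty → Set
⟦ nat ⟧    = ℕ
⟦ list σ ⟧ = List ⟦ σ ⟧
⟦ σ ⊗ τ ⟧  = ⟦ σ ⟧ × ⟦ τ ⟧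
⟦ σ ⇒ τ ⟧  = ⟦ σ ⟧ → Cost ⟦ τ ⟧

Env : Ctx → Set
Env = All ⟦_⟧

branchℕ : ∀ {X : Set} → Cost X → (ℕ → Cost X) → ℕ → Cost X
branchℕ z s zero    = z
branchℕ z s (suc n) = s n

iterℕ : ∀ {X : Set} → Cost X → (ℕ → X → Cost X) → ℕ → Cost X
iterℕ z s zero    = z
iterℕ z s (suc n) = tick (iterℕ z s n >>= s n)

branchL : ∀ {A X : Set} → Cost X → (A → List A → Cost X) → List A → Cost X
branchL z s []       = z
branchL z s (x ∷ xs) = s x xs

iterL : ∀ {A X : Set} → Cost X → (A → List A → X → Cost X) → List A → Cost X
iterL z s []       = z
iterL z s (x ∷ xs) = tick (iterL z s xs >>= s x xs)

eval : ∀ {Γ τ} → Term Γ τ → Env Γ → Cost ⟦ τ ⟧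
eval (var x)       ρ = tick (return (All.lookup ρ x))
eval (lam b)       ρ = tick (return (λ x → eval b (x ∷ ρ)))
eval (app f a)     ρ = tick (eval f ρ >>= λ g → eval a ρ >>= g)
eval (pair a b)    ρ = tick (eval a ρ >>= λ x → eval b ρ >>= λ y → return (x , y))
eval (fst p)       ρ = tick (eval p ρ >>= λ x → return (proj₁ x))
eval (snd p)       ρ = tick (eval p ρ >>= λ x → return (proj₂ x))
eval (lit n)       ρ = tick (return n)
eval (succ a)      ρ = tick (eval a ρ >>= λ n → return (suc n))
eval (sub a b)     ρ = tick (eval a ρ >>= λ m → eval b ρ >>= λ n → return (m ∸ n))
eval (caseℕ a z s) ρ = tick (eval a ρ >>= branchℕ (eval z ρ) (λ n → eval s (n ∷ ρ)))
eval (recℕ a z s)  ρ = tick (eval a ρ >>= iterℕ (eval z ρ) (λ n r → eval s (r ∷ n ∷ ρ)))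
eval nil           ρ = tick (return [])
eval (cons a b)    ρ = tick (eval a ρ >>= λ x → eval b ρ >>= λ xs → return (x ∷ xs))
eval (caseL a z s) ρ =
  tick (eval a ρ >>= branchL (eval z ρ) (λ x xs → eval s (xs ∷ x ∷ ρ)))
eval (recL a z s)  ρ =
  tick (eval a ρ >>= iterL (eval z ρ) (λ x xs r → eval s (r ∷ xs ∷ x ∷ ρ)))

------------------------------------------------------------------------
-- Algorithms for Δ-TVC

-- Input: the number of vertices, and for each edge its two ends and its labels.
-- Output: a list of vertex appearances.
Input Output : Ty
Input  = nat ⊗ list ((nat ⊗ nat) ⊗ list nat)
Output = list (nat ⊗ nat)

Algorithm : Set
Algorithm = Term (Input ∷ []) Output

encode : TemporalGraph → ⟦ Input ⟧
encode G =
  |V| , tabulate (λ e → (toℕ (proj₁ (ends e)) , toℕ (proj₂ (ends e))) , labels e)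
  where open TemporalGraph G

encodeSet : ∀ {G} → AppearanceSet G → ⟦ Output ⟧
encodeSet S = map (λ (v , t) → toℕ v , t) (AppearanceSet.elements S)

output : Algorithm → TemporalGraph → ⟦ Output ⟧
output A G = proj₁ (eval A (encode G ∷ []))

runtime : Algorithm → TemporalGraph → ℕ
runtime A G = proj₂ (eval A (encode G ∷ []))

fromℕ : ℕ → ℚ
fromℕ n = ℤ.+ n ℚ./ 1

-- A is a (1 + ε)-approximation algorithm for Δ-TVC on paths and cycles.
Approximates : (Δ : ℕ) (ε : ℚ) → Algorithm → Set
Approximates Δ ε A =
  ∀ G → PathOrCycle G →
  Σ[ S ∈ AppearanceSet G ]
    ( output A G ≡ encodeSet S
    × IsTVC G Δ S
    × (∀ S* → IsMinimumTVC G Δ S* →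
         fromℕ (AppearanceSet.card S)
           ℚ.≤ (1ℚ ℚ.+ ε) ℚ.* fromℕ (AppearanceSet.card S*)) )

⌈_⁻²⌉ : (ε : ℚ) .{{_ : ℚ.Positive ε}} → ℕ
⌈ ε ⁻²⌉ = ℤ.∣ ceiling (ε⁻¹ ℚ.* ε⁻¹) ∣
  where
  ε⁻¹ : ℚ
  ε⁻¹ = (1/ ε) {{pos⇒nonZero ε}}

-- (T (n + 1)) ^ (c ⌈ε⁻²⌉), where n is the number of edges.
powerBound : (c : ℕ) (ε : ℚ) .{{_ : ℚ.Positive ε}} → TemporalGraph → ℕ
powerBound c ε G = (T * suc |E|) ^ (c * ⌈ ε ⁻²⌉)
  where open TemporalGraph G

-- The lifetime, not its bit length, counts towards the size of an instance, as
-- for a temporal graph given by its sequence of T snapshots.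
size : TemporalGraph → ℕ
size G = |V| + |E| + T
  where open TemporalGraph G

HasPTAS : ℕ → Set
HasPTAS Δ =
  ∀ (ε : ℚ) .{{_ : ℚ.Positive ε}} →
  Σ[ A ∈ Algorithm ]
    ( Approximates Δ ε A
    × ∃[ C ] ∃[ d ] (∀ G → PathOrCycle G → runtime A G ≤ C * size G ^ d) )

{-# OPTIONS --safe #-}
module Submission where

-- Cutting a path or a cycle at every L-th vertex leaves pieces of at most L edges.  An
-- optimal solution restricted to the pieces counts the appearances of cut vertices twice,
-- so for one of the L shifts it grows by a factor of at most 1 + 1/L.  A cycle is cut once
-- more at the start of the walk along it, which costs another |O|/L if a vertex with the
-- fewest appearances is chosen; a cycle of fewer than L edges need not be cut.  This shifting
-- argument makes planar separators superfluous.
--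
-- A piece is solved exactly by sweeping over the time.  Two partial solutions up to time t
-- can be continued in the same ways if every edge of the piece was covered last at the same
-- time in both, so it suffices to keep a shortest one for each of the (1 + T)^L patterns of
-- last covers.  With L = 2⌈ε⁻²⌉ every loop takes at most (T(n + 1))^(4⌈ε⁻²⌉) iterations.

-- The solution must be a term whose steps are counted, so the cost argument shapes the proof as
-- much as the ratio does. Since a constant factor in the exponent is free, costs are bounded
-- crudely: if no recursion exceeds `M` iterations, each level of nesting multiplies the cost by a
-- bounded power of `M`, and the nesting depth of the program is a number that depends on neither Δ
-- nor ε. What remains is to bound every list that arises, at every intermediate stage. This is why
-- the sweep decides one appearance at a time and merges equivalent entries after each decision,
-- instead of branching over sets of vertices.
--
-- Neither a good shift nor the lightest vertex of a cycle can be read off the input, as both refer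
-- to an unknown optimum. The program tries all starts and shifts and keeps the shortest result.
-- Each candidate is a cover whatever the start and the shift are, so the order of the edges along
-- the line matters for the ratio and not for validity.

open import Defs
open import Data.Bool.Base using (Bool; true; false; if_then_else_; _∧_; _∨_; not)
open import Data.Empty using (⊥)
open import Data.Fin.Base using (Fin; toℕ; fromℕ<)
open import Data.Fin.Permutation using (Permutation′; _⟨$⟩ʳ_; _⟨$⟩ˡ_; inverseʳ; inverseˡ)
open import Data.Fin.Properties using (toℕ-fromℕ<; toℕ<n; toℕ-injective; injective⇒≤)
open import Data.Integer.Base as ℤ using ()
open import Data.Integer.DivMod using ([n/d]*d≤n)
import Data.Integer.Properties as ℤ
open import Data.List.Base using (List; []; _∷_; _++_; length; map; concat; tabulate; filter;
  foldr; allFin; upTo; cartesianProductWith)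
open import Data.List.Extrema.Nat using (max; xs≤max; max≤v⁺)
open import Data.List.Membership.Propositional using (_∈_; find; lose)
open import Data.List.Membership.Propositional.Properties using (∈-++⁺ˡ; ∈-++⁺ʳ; ∈-++⁻; ∈-∃++;
  ∈-map⁺; ∈-map⁻; ∈-upTo⁺; ∈-filter⁺; ∈-filter⁻; ∈-cartesianProductWith⁺; ∈-tabulate⁺;
  ∈-tabulate⁻; ∈-allFin; ∈-concat⁺′; ∈-concat⁻′)
open import Data.List.Properties using (length-++; length-map; length-upTo; ++-identityʳ;
  ∷-injectiveˡ; ∷-injectiveʳ; map-tabulate; filter-accept; filter-reject; length-tabulate)
open import Data.List.Relation.Binary.Permutation.Propositional as ↭ using (_↭_; ↭-refl; ↭-sym;
  ↭-trans; ↭-prep; ↭-swap; ↭-reflexive)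
open import Data.List.Relation.Binary.Permutation.Propositional.Properties using (↭-length;
  shift; ∈-resp-↭; Any-resp-↭; ++⁺ˡ)
open import Data.List.Relation.Unary.All as All using (All; []; _∷_)
import Data.List.Relation.Unary.All.Properties as All
open import Data.List.Relation.Unary.AllPairs as AllPairs using (AllPairs; []; _∷_)
import Data.List.Relation.Unary.AllPairs.Properties as AllPairs
open import Data.List.Relation.Unary.Any as Any using (Any; here; there)
open import Data.List.Relation.Unary.Unique.Propositional using (Unique)
import Data.List.Relation.Unary.Unique.Propositional.Properties as Unique
open import Data.Nat.Base as ℕ using (ℕ; zero; suc; _+_; _*_; _∸_; _^_; _⊔_; _≤_; _<_; z≤n;
  s≤s)
open import Data.Nat.Properties
open import Data.Nat.Solver using (module +-*-Solver)
open import Data.Product.Base using (Σ-syntax; ∃-syntax; _×_; _,_; proj₁; proj₂)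
open import Data.Rational.Base as ℚ using (ℚ; Positive)
import Data.Rational.Properties as ℚ
open import Data.Rational.Unnormalised.Base as ℚᵘ using (mkℚᵘ)
import Data.Rational.Unnormalised.Properties as ℚᵘ
open import Data.Sum.Base using (_⊎_; inj₁; inj₂)
open import Data.Unit.Base using (⊤)
open import Function.Base using (_∘_; id)
open import Function.Bundles using (module Equivalence)
open import Relation.Binary.PropositionalEquality using (_≡_; _≢_; refl; sym; trans; cong;
  cong₂; subst)
open import Relation.Nullary using (¬_; Dec; does; yes; no; contradiction)
open import Relation.Nullary.Decidable using (_×-dec_; _⊎-dec_; _→-dec_; map′; dec-true;
  dec-false)
open +-*-Solver using (solve; _:=_; _:+_; _:*_; con)

-- The programming language

-- A first-order fragment of the object language, with conditionals and calls
-- of closed functions.  Its pure semantics does not count steps.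
data Tm (Γ : Ctx) : Ty → Set where
  var   : ∀ {σ} → σ ∈ Γ → Tm Γ σ
  pair  : ∀ {σ τ} → Tm Γ σ → Tm Γ τ → Tm Γ (σ ⊗ τ)
  fst   : ∀ {σ τ} → Tm Γ (σ ⊗ τ) → Tm Γ σ
  snd   : ∀ {σ τ} → Tm Γ (σ ⊗ τ) → Tm Γ τ
  lit   : ℕ → Tm Γ nat
  succ  : Tm Γ nat → Tm Γ nat
  sub   : Tm Γ nat → Tm Γ nat → Tm Γ nat
  ite   : ∀ {τ} → Tm Γ nat → Tm Γ τ → Tm Γ τ → Tm Γ τ
  caseℕ : ∀ {τ} → Tm Γ nat → Tm Γ τ → Tm (nat ∷ Γ) τ → Tm Γ τ
  recℕ  : ∀ {τ} → Tm Γ nat → Tm Γ τ → Tm (τ ∷ nat ∷ Γ) τ → Tm Γ τ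
  nil   : ∀ {σ} → Tm Γ (list σ)
  cons  : ∀ {σ} → Tm Γ σ → Tm Γ (list σ) → Tm Γ (list σ)
  caseL : ∀ {σ τ} → Tm Γ (list σ) → Tm Γ τ → Tm (list σ ∷ σ ∷ Γ) τ → Tm Γ τ
  recL  : ∀ {σ τ} → Tm Γ (list σ) → Tm Γ τ → Tm (τ ∷ list σ ∷ σ ∷ Γ) τ → Tm Γ τ
  call  : ∀ {Δ τ} → All (Tm Γ) Δ → Tm Δ τ → Tm Γ τ

elimℕ : ∀ {X : Set} → X → (ℕ → X) → ℕ → X
elimℕ z s zero    = z
elimℕ z s (suc n) = s n

elimL : ∀ {A X : Set} → X → (A → List A → X) → List A → X
elimL z s []       = z
elimL z s (x ∷ xs) = s x xs

paraℕ : ∀ {X : Set} → X → (ℕ → X → X) → ℕ → X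
paraℕ z s zero    = z
paraℕ z s (suc n) = s n (paraℕ z s n)

paraL : ∀ {A X : Set} → X → (A → List A → X → X) → List A → X
paraL z s []       = z
paraL z s (x ∷ xs) = s x xs (paraL z s xs)

run  : ∀ {Γ τ} → Tm Γ τ → Env Γ → ⟦ τ ⟧
runs : ∀ {Γ Δ} → All (Tm Γ) Δ → Env Γ → Env Δ
run (var x)       ρ = All.lookup ρ x
run (pair a b)    ρ = run a ρ , run b ρ
run (fst a)       ρ = proj₁ (run a ρ)
run (snd a)       ρ = proj₂ (run a ρ)
run (lit n)       ρ = n
run (succ a)      ρ = suc (run a ρ)
run (sub a b)     ρ = run a ρ ∸ run b ρ
run (ite c a b)   ρ = elimℕ (run b ρ) (λ _ → run a ρ) (run c ρ)
run (caseℕ a z s) ρ = elimℕ (run z ρ) (λ n → run s (n ∷ ρ)) (run a ρ)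
run (recℕ a z s)  ρ = paraℕ (run z ρ) (λ n r → run s (r ∷ n ∷ ρ)) (run a ρ)
run nil           ρ = []
run (cons a b)    ρ = run a ρ ∷ run b ρ
run (caseL a z s) ρ = elimL (run z ρ) (λ x xs → run s (xs ∷ x ∷ ρ)) (run a ρ)
run (recL a z s)  ρ = paraL (run z ρ) (λ x xs r → run s (r ∷ xs ∷ x ∷ ρ)) (run a ρ)
run (call ts f)   ρ = run f (runs ts ρ)
runs []       ρ = []
runs (t ∷ ts) ρ = run t ρ ∷ runs ts ρ

infix 4 _⊑_
_⊑_ : Ctx → Ctx → Set
Γ ⊑ Γ′ = ∀ {σ} → σ ∈ Γ → σ ∈ Γ′

lift : ∀ {Γ Γ′ σ} → Γ ⊑ Γ′ → σ ∷ Γ ⊑ σ ∷ Γ′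
lift r (here p)  = here p
lift r (there x) = there (r x)

compile : ∀ {Γ Γ′ τ} → Γ ⊑ Γ′ → Tm Γ τ → Term Γ′ τ
-- A call becomes a nest of β-redexes, so each argument is evaluated once however often the function
-- uses it. The arguments at the end of the list are bound outermost; hence `t` is compiled in a
-- context already extended by `Δ`.
bindAll : ∀ {Γ Γ′ Δ τ} → Γ ⊑ Γ′ → All (Tm Γ) Δ → Term (Δ ++ Γ′) τ → Term Γ′ τ
compile r (var x)       = var (r x)
compile r (pair a b)    = pair (compile r a) (compile r b)
compile r (fst a)       = fst (compile r a)
compile r (snd a)       = snd (compile r a)
compile r (lit n)       = lit n
compile r (succ a)      = succ (compile r a)
compile r (sub a b)     = sub (compile r a) (compile r b)
compile r (ite c a b)   = caseℕ (compile r c) (compile r b) (compile (there ∘ r) a)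
compile r (caseℕ a z s) = caseℕ (compile r a) (compile r z) (compile (lift r) s)
compile r (recℕ a z s)  = recℕ (compile r a) (compile r z) (compile (lift (lift r)) s)
compile r nil           = nil
compile r (cons a b)    = cons (compile r a) (compile r b)
compile r (caseL a z s) = caseL (compile r a) (compile r z) (compile (lift (lift r)) s)
compile r (recL a z s)  =
  recL (compile r a) (compile r z) (compile (lift (lift (lift r))) s)
compile r (call ts f)   = bindAll r ts (compile ∈-++⁺ˡ f)
bindAll r []                 b = b
bindAll r (_∷_ {xs = Δ} t ts) b = bindAll r ts (app (lam b) (compile (∈-++⁺ʳ Δ ∘ r) t))

-- Propositional equality of values suffices because `Tm` has no abstraction: no new closure ever
-- has to be compared, which would require function extensionality.
Agree : ∀ {Γ Γ′} → Γ ⊑ Γ′ → Env Γ → Env Γ′ → Set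
Agree {Γ} r ρ ρ′ = ∀ {σ} (x : σ ∈ Γ) → All.lookup ρ′ (r x) ≡ All.lookup ρ x

_◂_ : ∀ {Γ Γ′ σ} {r : Γ ⊑ Γ′} {ρ ρ′} {x x′ : ⟦ σ ⟧} →
      x′ ≡ x → Agree r ρ ρ′ → Agree (lift {σ = σ} r) (x ∷ ρ) (x′ ∷ ρ′)
(eq ◂ A) (here refl) = eq
(eq ◂ A) (there x)   = A x
infixr 5 _◂_

_+++_ : ∀ {Δ Γ} → Env Δ → Env Γ → Env (Δ ++ Γ)
[]       +++ ρ = ρ
(x ∷ δ) +++ ρ = x ∷ (δ +++ ρ)

lookup-++ʳ : ∀ {Δ Γ σ} (δ : Env Δ) (ρ : Env Γ) (x : σ ∈ Γ) →
             All.lookup (δ +++ ρ) (∈-++⁺ʳ Δ x) ≡ All.lookup ρ x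
lookup-++ʳ []      ρ x = refl
lookup-++ʳ (_ ∷ δ) ρ x = lookup-++ʳ δ ρ x

agree-++ˡ : ∀ {Δ Γ} (δ δ′ : Env Δ) (ρ : Env Γ) → δ′ ≡ δ → Agree ∈-++⁺ˡ δ (δ′ +++ ρ)
agree-++ˡ (x ∷ δ) _ ρ refl (here refl) = refl
agree-++ˡ (x ∷ δ) _ ρ refl (there y)   = agree-++ˡ δ δ ρ refl y

agree-++ʳ : ∀ {Δ Γ Γ′} (δ : Env Δ) {ρ ρ′} {r : Γ ⊑ Γ′} → Agree r ρ ρ′ →
            Agree (∈-++⁺ʳ Δ ∘ r) ρ (δ +++ ρ′)
agree-++ʳ δ {ρ′ = ρ′} {r} A x = trans (lookup-++ʳ δ ρ′ (r x)) (A x)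

branchℕ-val : ∀ {X : Set} {z z′ s s′} {m n} → proj₁ z ≡ z′ → (∀ k → proj₁ (s k) ≡ s′ k) →
              m ≡ n → proj₁ (branchℕ {X} z s m) ≡ elimℕ z′ s′ n
branchℕ-val {m = zero}  p q refl = p
branchℕ-val {m = suc k} p q refl = q k

branchL-val : ∀ {A X : Set} {z z′ s s′} {xs ys} → proj₁ z ≡ z′ →
              (∀ x xs → proj₁ (s x xs) ≡ s′ x xs) →
              xs ≡ ys → proj₁ (branchL {A} {X} z s xs) ≡ elimL z′ s′ ys
branchL-val {xs = []}     p q refl = p
branchL-val {xs = x ∷ xs} p q refl = q x xs

iterℕ-val : ∀ {X : Set} {z z′ s s′} {m n} → proj₁ z ≡ z′ →
            (∀ k {r r′} → r ≡ r′ → proj₁ (s k r) ≡ s′ k r′) →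
            m ≡ n → proj₁ (iterℕ {X} z s m) ≡ paraℕ z′ s′ n
iterℕ-val {m = zero}  p q refl = p
iterℕ-val {m = suc k} p q refl = q k (iterℕ-val {m = k} p q refl)

iterL-val : ∀ {A X : Set} {z z′ s s′} {xs ys} → proj₁ z ≡ z′ →
            (∀ x xs {r r′} → r ≡ r′ → proj₁ (s x xs r) ≡ s′ x xs r′) →
            xs ≡ ys → proj₁ (iterL {A} {X} z s xs) ≡ paraL z′ s′ ys
iterL-val {xs = []}     p q refl = p
iterL-val {xs = x ∷ xs} p q refl = q x xs (iterL-val {xs = xs} p q refl)

compile-val : ∀ {Γ Γ′ τ} (t : Tm Γ τ) {r : Γ ⊑ Γ′} {ρ ρ′} → Agree r ρ ρ′ →
              proj₁ (eval (compile r t) ρ′) ≡ run t ρ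
bindAll-eval : ∀ {Γ Γ′ Δ τ} (ts : All (Tm Γ) Δ) {r : Γ ⊑ Γ′} {ρ ρ′} → Agree r ρ ρ′ →
              (b : Term (Δ ++ Γ′) τ) →
              Σ[ δ ∈ Env Δ ] δ ≡ runs ts ρ ×
                proj₁ (eval (bindAll r ts b) ρ′) ≡ proj₁ (eval b (δ +++ ρ′))
compile-val (var x) A = A x
compile-val (pair a b) A = cong₂ _,_ (compile-val a A) (compile-val b A)
compile-val (fst a) A = cong proj₁ (compile-val a A)
compile-val (snd a) A = cong proj₂ (compile-val a A)
compile-val (lit n) A = refl
compile-val (succ a) A = cong suc (compile-val a A)
compile-val (sub a b) A = cong₂ _∸_ (compile-val a A) (compile-val b A)
compile-val (ite c a b) A =
  branchℕ-val (compile-val b A) (λ _ → compile-val a A) (compile-val c A)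
compile-val (caseℕ a z s) A =
  branchℕ-val (compile-val z A) (λ _ → compile-val s (refl ◂ A)) (compile-val a A)
compile-val (recℕ a z s) A =
  iterℕ-val (compile-val z A) (λ _ eq → compile-val s (eq ◂ refl ◂ A)) (compile-val a A)
compile-val nil A = refl
compile-val (cons a b) A = cong₂ _∷_ (compile-val a A) (compile-val b A)
compile-val (caseL a z s) A =
  branchL-val (compile-val z A) (λ _ _ → compile-val s (refl ◂ refl ◂ A)) (compile-val a A)
compile-val (recL a z s) A =
  iterL-val (compile-val z A) (λ _ _ eq → compile-val s (eq ◂ refl ◂ refl ◂ A))
            (compile-val a A)
compile-val (call ts f) {ρ′ = ρ′} A with bindAll-eval ts A (compile ∈-++⁺ˡ f)
... | δ , eq , v = trans v (compile-val f (agree-++ˡ _ δ ρ′ eq))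
bindAll-eval [] A b = [] , refl , refl
bindAll-eval (_∷_ {xs = Δ} t ts) {r} {ρ} A b
  with bindAll-eval ts A (app (lam b) (compile (∈-++⁺ʳ Δ ∘ r) t))
... | δ , refl , v = _ , cong (_∷ _) (compile-val t (agree-++ʳ δ {ρ = ρ} {r = r} A)) , v

-- The exponent of the cost bound. One factor `M` pays for adding up the costs of the parts of a
-- constructor, which are at most three; a recursion takes a second factor for its iterations.
depth  : ∀ {Γ τ} → Tm Γ τ → ℕ
depths : ∀ {Γ Δ} → All (Tm Γ) Δ → ℕ
depth (var x)       = 1
depth (pair a b)    = suc (depth a ⊔ depth b)
depth (fst a)       = suc (depth a)
depth (snd a)       = suc (depth a)
depth (lit n)       = 1
depth (succ a)      = suc (depth a)
depth (sub a b)     = suc (depth a ⊔ depth b)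
depth (ite c a b)   = suc (depth c ⊔ (depth a ⊔ depth b))
depth (caseℕ a z s) = suc (depth a ⊔ (depth z ⊔ depth s))
depth (recℕ a z s)  = 2 + (depth a ⊔ (depth z ⊔ depth s))
depth nil           = 1
depth (cons a b)    = suc (depth a ⊔ depth b)
depth (caseL a z s) = suc (depth a ⊔ (depth z ⊔ depth s))
depth (recL a z s)  = 2 + (depth a ⊔ (depth z ⊔ depth s))
depth (call ts f)   = suc (depths ts ⊔ depth f)
depths []       = 1
depths (t ∷ ts) = suc (depth t ⊔ depths ts)

data Tails {A : Set} (P : A → List A → Set) : List A → Set where
  []  : Tails P []
  _∷_ : ∀ {x xs} → P x xs → Tails P xs → Tails P (x ∷ xs)

-- When every recursion makes at most M iterations, a program takes at most
-- M ^ depth steps.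
module _ (M : ℕ) where
  OK  : ∀ {Γ τ} → Tm Γ τ → Env Γ → Set
  OKs : ∀ {Γ Δ} → All (Tm Γ) Δ → Env Γ → Set
  OK (var x)       ρ = ⊤
  OK (pair a b)    ρ = OK a ρ × OK b ρ
  OK (fst a)       ρ = OK a ρ
  OK (snd a)       ρ = OK a ρ
  OK (lit n)       ρ = ⊤
  OK (succ a)      ρ = OK a ρ
  OK (sub a b)     ρ = OK a ρ × OK b ρ
  OK (ite c a b)   ρ = OK c ρ × OK a ρ × OK b ρ
  OK (caseℕ a z s) ρ = OK a ρ × OK z ρ × (∀ n → OK s (n ∷ ρ))
  -- The condition on the step concerns only the results that the recursion really reaches. Asking
  -- it of all results would fail, since a table is small only by its invariants.
  OK (recℕ a z s)  ρ = OK a ρ × OK z ρ × run a ρ ≤ M ×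
    (∀ n → n < run a ρ → OK s (paraℕ (run z ρ) (λ n r → run s (r ∷ n ∷ ρ)) n ∷ n ∷ ρ))
  OK nil           ρ = ⊤
  OK (cons a b)    ρ = OK a ρ × OK b ρ
  OK (caseL a z s) ρ = OK a ρ × OK z ρ × (∀ x xs → run a ρ ≡ x ∷ xs → OK s (xs ∷ x ∷ ρ))
  OK (recL a z s)  ρ = OK a ρ × OK z ρ × length (run a ρ) ≤ M ×
    Tails (λ x xs → OK s (paraL (run z ρ) (λ x xs r → run s (r ∷ xs ∷ x ∷ ρ)) xs ∷ xs ∷ x ∷ ρ))
          (run a ρ)
  OK (call ts f)   ρ = OKs ts ρ × OK f (runs ts ρ)
  OKs []       ρ = ⊤
  OKs (t ∷ ts) ρ = OK t ρ × OKs ts ρ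

  pow-pos : 1 ≤ M → ∀ k → 1 ≤ M ^ k
  pow-pos 1≤M k = ≤-trans (≤-reflexive (sym (^-zeroˡ k))) (^-monoˡ-≤ k 1≤M)

  module _ (4≤M : 4 ≤ M) where
    private
      1≤M : 1 ≤ M
      1≤M = ≤-trans (s≤s z≤n) 4≤M

      instance
        M≢0 : ℕ.NonZero M
        M≢0 = ℕ.>-nonZero 1≤M

      mono : ∀ {x i j} → x ≤ M ^ i → i ≤ j → x ≤ M ^ j
      mono p q = ≤-trans p (^-monoʳ-≤ M q)

      one : ∀ k → 1 ≤ M ^ suc k
      one k = pow-pos 1≤M (suc k)

      sum₃ : ∀ {a b c} i j k → a ≤ M ^ i → b ≤ M ^ j → c ≤ M ^ k →
             suc (a + (b + c)) ≤ M ^ suc (i ⊔ (j ⊔ k))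
      sum₃ {a} {b} {c} i j k p q r = begin
        1 + (a + (b + c))  ≤⟨ +-mono-≤ (pow-pos 1≤M n) (+-mono-≤ (mono p (m≤m⊔n i _))
                              (+-mono-≤ (mono q (≤-trans (m≤m⊔n j k) (m≤n⊔m i _)))
                                        (mono r (≤-trans (m≤n⊔m j k) (m≤n⊔m i _))))) ⟩
        P + (P + (P + P))  ≡⟨ cong (λ z → P + (P + (P + z))) (sym (+-identityʳ P)) ⟩
        4 * P              ≤⟨ *-monoˡ-≤ P 4≤M ⟩
        M ^ suc n          ∎
        where
        open ≤-Reasoning
        n = i ⊔ (j ⊔ k)
        P = M ^ n

      sum₂ : ∀ {a b} i j → a ≤ M ^ i → b ≤ M ^ j → suc (a + b) ≤ M ^ suc (i ⊔ j)
      sum₂ {a} {b} i j p q = begin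
        suc (a + b)                ≡⟨ cong (λ z → suc (a + z)) (sym (+-identityʳ b)) ⟩
        suc (a + (b + 0))          ≤⟨ sum₃ i j j p q z≤n ⟩
        M ^ suc (i ⊔ (j ⊔ j))      ≡⟨ cong (λ z → M ^ suc (i ⊔ z)) (⊔-idem j) ⟩
        M ^ suc (i ⊔ j)            ∎
        where open ≤-Reasoning

      -- The `+ 0` is the cost of the final `return`.
      sum₂′ : ∀ {a b} i j → a ≤ M ^ i → b ≤ M ^ j → suc (a + (b + 0)) ≤ M ^ suc (i ⊔ j)
      sum₂′ {a} {b} i j p q = ≤-trans (≤-reflexive (cong (λ z → suc (a + z)) (+-identityʳ b))) (sum₂ i j p q)

      sum₁′ : ∀ {a} i → a ≤ M ^ i → suc (a + 0) ≤ M ^ suc i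
      sum₁′ i p = ≤-trans (sum₂ i i p z≤n) (≤-reflexive (cong (λ z → M ^ suc z) (⊔-idem i)))

      -- With every part at most `P`, the total is at most 4 P + 2 M P, hence at most 3 M P and at
      -- most M² P. This is the 2 in the depth of a recursion.
      loop : ∀ {a z l b} i j k → a ≤ M ^ i → z ≤ M ^ j → l ≤ M → b ≤ M ^ k →
             suc (a + (z + l * suc b)) ≤ M ^ (2 + (i ⊔ (j ⊔ k)))
      loop {a} {z} {l} {b} i j k p q l≤M r = begin
        1 + (a + (z + l * suc b))      ≤⟨ +-mono-≤ (pow-pos 1≤M n)
                                           (+-mono-≤ (mono p (m≤m⊔n i _))
                                           (+-mono-≤ (mono q (≤-trans (m≤m⊔n j k) (m≤n⊔m i _)))
                                             (*-mono-≤ l≤M (+-mono-≤ (pow-pos 1≤M n)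
                                               (mono r (≤-trans (m≤n⊔m j k) (m≤n⊔m i _))))))) ⟩
        P + (P + (P + M * (P + P)))    ≤⟨ +-monoʳ-≤ P (+-monoʳ-≤ P (m≤n+m _ P)) ⟩
        P + (P + (P + (P + M * (P + P)))) ≡⟨ solve 2 (λ P M → P :+ (P :+ (P :+ (P :+ M :* (P :+ P)))) :=
                                                  con 4 :* P :+ con 2 :* (M :* P)) refl P M ⟩
        4 * P + 2 * (M * P)            ≤⟨ +-monoˡ-≤ _ (*-monoˡ-≤ P 4≤M) ⟩
        M * P + 2 * (M * P)            ≤⟨ *-monoˡ-≤ (M * P) (≤-trans (n≤1+n 3) 4≤M) ⟩
        M * (M * P)                    ∎
        where
        open ≤-Reasoning
        n = i ⊔ (j ⊔ k)
        P = M ^ n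

      iterℕ-cost : ∀ {X : Set} {z : Cost X} {s : ℕ → X → Cost X} {b} n →
                   (∀ k → k < n → proj₂ (s k (proj₁ (iterℕ z s k))) ≤ b) →
                   proj₂ (iterℕ z s n) ≤ proj₂ z + n * suc b
      iterℕ-cost zero h = m≤m+n _ _
      iterℕ-cost {z = z} {s} {b} (suc n) h = begin
        suc (proj₂ (iterℕ z s n) + proj₂ (s n (proj₁ (iterℕ z s n))))
          ≤⟨ s≤s (+-mono-≤ (iterℕ-cost n (λ k k<n → h k (m<n⇒m<1+n k<n))) (h n ≤-refl)) ⟩
        suc (proj₂ z + n * suc b + b)
          ≡⟨ solve 3 (λ z n b → con 1 :+ (z :+ n :* (con 1 :+ b) :+ b) :=
                                z :+ (con 1 :+ n) :* (con 1 :+ b)) refl (proj₂ z) n b ⟩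
        proj₂ z + suc n * suc b ∎
        where
        open ≤-Reasoning

      iterL-cost : ∀ {A X : Set} {z : Cost X} {s : A → List A → X → Cost X} {b} xs →
                   Tails (λ x xs → proj₂ (s x xs (proj₁ (iterL z s xs))) ≤ b) xs →
                   proj₂ (iterL z s xs) ≤ proj₂ z + length xs * suc b
      iterL-cost [] h = m≤m+n _ _
      iterL-cost {z = z} {s} {b} (x ∷ xs) (p ∷ h) = begin
        suc (proj₂ (iterL z s xs) + proj₂ (s x xs (proj₁ (iterL z s xs))))
          ≤⟨ s≤s (+-mono-≤ (iterL-cost xs h) p) ⟩
        suc (proj₂ z + length xs * suc b + b)
          ≡⟨ solve 3 (λ z n b → con 1 :+ (z :+ n :* (con 1 :+ b) :+ b) :=
                                z :+ (con 1 :+ n) :* (con 1 :+ b)) refl (proj₂ z) (length xs) b ⟩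
        proj₂ z + length (x ∷ xs) * suc b ∎
        where
        open ≤-Reasoning

      branchℕ-cost : ∀ {X : Set} {z : Cost X} {s : ℕ → Cost X} n i j →
                     proj₂ z ≤ M ^ i → (∀ k → proj₂ (s k) ≤ M ^ j) →
                     proj₂ (branchℕ z s n) ≤ M ^ (i ⊔ j)
      branchℕ-cost zero    i j p q = mono p (m≤m⊔n i j)
      branchℕ-cost (suc n) i j p q = mono (q n) (m≤n⊔m i j)

      branchL-cost : ∀ {A X : Set} {z : Cost X} {s : A → List A → Cost X} {ys} xs i j → xs ≡ ys →
                     proj₂ z ≤ M ^ i → (∀ x xs → ys ≡ x ∷ xs → proj₂ (s x xs) ≤ M ^ j) →
                     proj₂ (branchL z s xs) ≤ M ^ (i ⊔ j)
      branchL-cost []       i j _  p q = mono p (m≤m⊔n i j)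
      branchL-cost (x ∷ xs) i j eq p q = mono (q x xs (sym eq)) (m≤n⊔m i j)

      tails-map : ∀ {A : Set} {P Q : A → List A → Set} {xs ys} → (∀ x xs → P x xs → Q x xs) →
                  xs ≡ ys → Tails P xs → Tails Q ys
      tails-map f refl []      = []
      tails-map f refl (p ∷ h) = f _ _ p ∷ tails-map f refl h

    compile-cost : ∀ {Γ Γ′ τ} (t : Tm Γ τ) {r : Γ ⊑ Γ′} {ρ ρ′} → Agree r ρ ρ′ → OK t ρ →
                   proj₂ (eval (compile r t) ρ′) ≤ M ^ depth t
    bindAll-cost : ∀ {Γ Γ′ Δ τ} (ts : All (Tm Γ) Δ) {r : Γ ⊑ Γ′} {ρ ρ′} → Agree r ρ ρ′ →
                   OKs ts ρ → (b : Term (Δ ++ Γ′) τ) (k : ℕ) →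
                   (∀ (δ : Env Δ) → δ ≡ runs ts ρ → proj₂ (eval b (δ +++ ρ′)) ≤ k) →
                   proj₂ (eval (bindAll r ts b) ρ′) ≤ M ^ depths ts + k
    compile-cost (var x) A _ = one 0
    compile-cost (pair a b) A (p , q) =
      sum₂′ (depth a) (depth b) (compile-cost a A p) (compile-cost b A q)
    compile-cost (fst a) A p = sum₁′ (depth a) (compile-cost a A p)
    compile-cost (snd a) A p = sum₁′ (depth a) (compile-cost a A p)
    compile-cost (lit n) A _ = one 0
    compile-cost (succ a) A p = sum₁′ (depth a) (compile-cost a A p)
    compile-cost (sub a b) A (p , q) =
      sum₂′ (depth a) (depth b) (compile-cost a A p) (compile-cost b A q)
    compile-cost (ite c a b) {r′} {ρ′ = ρ′} A (p , q , r) =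
      sum₂ (depth c) (depth a ⊔ depth b) (compile-cost c A p)
        (mono (branchℕ-cost (proj₁ (eval (compile r′ c) ρ′)) (depth b) (depth a)
                            (compile-cost b A r) (λ _ → compile-cost a A q))
              (≤-reflexive (⊔-comm (depth b) (depth a))))
    compile-cost (caseℕ a z s) {r′} {ρ′ = ρ′} A (p , q , r) =
      sum₂ (depth a) (depth z ⊔ depth s) (compile-cost a A p)
        (branchℕ-cost (proj₁ (eval (compile r′ a) ρ′)) (depth z) (depth s) (compile-cost z A q)
          (λ n → compile-cost s (refl ◂ A) (r n)))
    compile-cost (recℕ a z s) {r} {ρ} {ρ′} A (p , q , l , h) =
      ≤-trans (s≤s (+-monoʳ-≤ (proj₂ (eval (compile r a) ρ′)) (iterℕ-cost n′ λ k k<n →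
                -- The counted run reaches the same intermediate result as the pure one, so the
                -- condition `OK` at that result applies.
                compile-cost s
                  (iterℕ-val {m = k} (compile-val z A) (λ _ eq → compile-val s (eq ◂ refl ◂ A)) refl
                    ◂ refl ◂ A)
                  (h k (subst (k <_) a-val k<n)))))
              (loop (depth a) (depth z) (depth s) (compile-cost a A p) (compile-cost z A q)
                    (subst (_≤ M) (sym a-val) l) ≤-refl)
      where
      a-val = compile-val a A
      n′ = proj₁ (eval (compile r a) ρ′)
    compile-cost nil A _ = one 0
    compile-cost (cons a b) A (p , q) =
      sum₂′ (depth a) (depth b) (compile-cost a A p) (compile-cost b A q)
    compile-cost (caseL a z s) A (p , q , r) =
      sum₂ (depth a) (depth z ⊔ depth s) (compile-cost a A p)
        (branchL-cost _ (depth z) (depth s) (compile-val a A) (compile-cost z A q)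
          (λ x xs eq → compile-cost s (refl ◂ refl ◂ A) (r x xs eq)))
    compile-cost (recL a z s) {r} {ρ} {ρ′} A (p , q , l , h) =
      ≤-trans (s≤s (+-monoʳ-≤ (proj₂ (eval (compile r a) ρ′)) (iterL-cost xs′
                (tails-map (λ x xs ok → compile-cost s
                    (iterL-val {xs = xs} (compile-val z A)
                        (λ _ _ eq → compile-val s (eq ◂ refl ◂ refl ◂ A)) refl
                      ◂ refl ◂ refl ◂ A) ok)
                  (sym a-val) h))))
              (loop (depth a) (depth z) (depth s) (compile-cost a A p) (compile-cost z A q)
                    (subst (λ xs → length xs ≤ M) (sym a-val) l) ≤-refl)
      where
      a-val = compile-val a A
      xs′ = proj₁ (eval (compile r a) ρ′)
    compile-cost (call ts f) {ρ′ = ρ′} A (p , q) =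
      ≤-trans (bindAll-cost ts A p (compile ∈-++⁺ˡ f) (M ^ depth f)
                (λ δ eq → compile-cost f (agree-++ˡ _ δ ρ′ eq) q))
              (≤-trans (n≤1+n _) (sum₂ (depths ts) (depth f) ≤-refl ≤-refl))
    bindAll-cost [] A _ b k h = ≤-trans (h [] refl) (m≤n+m _ _)
    bindAll-cost (_∷_ {xs = Δ} t ts) {r} {ρ} {ρ′} A (p , q) b k h =
      -- The 2 counts the application and the abstraction that bind `t`.
      ≤-trans (bindAll-cost ts A q (app (lam b) (compile (∈-++⁺ʳ Δ ∘ r) t)) (2 + (M ^ depth t + k))
                λ δ eq → s≤s (s≤s (+-mono-≤ (compile-cost t (agree-++ʳ δ {ρ = ρ} {r = r} A) p)
                  (h _ (cong₂ _∷_ (compile-val t (agree-++ʳ δ {ρ = ρ} {r = r} A)) eq)))))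
              (begin
        D + (2 + (E + k))   ≡⟨ solve 3 (λ D E k → D :+ (con 2 :+ (E :+ k)) :=
                                   (con 1 :+ (con 1 :+ (E :+ D))) :+ k) refl D E k ⟩
        suc (1 + (E + D)) + k ≤⟨ +-monoˡ-≤ k (sum₃ 0 (depth t) (depths ts) (pow-pos 1≤M 0) ≤-refl ≤-refl) ⟩
        M ^ suc (depth t ⊔ depths ts) + k ∎)
      where
      open ≤-Reasoning
      D = M ^ depths ts
      E = M ^ depth t

-- Edges, appearances and elementary tests

Edge Appearance : Set
Edge       = (ℕ × ℕ) × List ℕ
Appearance = ℕ × ℕ

EdgeT AppT : Ty
EdgeT = (nat ⊗ nat) ⊗ list nat
AppT  = nat ⊗ nat

pattern #0 = var (here refl)
pattern #1 = var (there (here refl))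
pattern #2 = var (there (there (here refl)))
pattern #3 = var (there (there (there (here refl))))
pattern #4 = var (there (there (there (there (here refl)))))
pattern #5 = var (there (there (there (there (there (here refl))))))
pattern #6 = var (there (there (there (there (there (there (here refl)))))))
pattern #7 = var (there (there (there (there (there (there (there (here refl))))))))
pattern #8 = var (there (there (there (there (there (there (there (there (here refl)))))))))

𝟙 : Bool → ℕ
𝟙 true  = 1
𝟙 false = 0

ite-cong : ∀ {X : Set} {c b} {x x′ y y′ : X} → c ≡ 𝟙 b → x ≡ x′ → y ≡ y′ →
           elimℕ y (λ _ → x) c ≡ (if b then x′ else y′)
ite-cong {b = true}  refl p q = p
ite-cong {b = false} refl p q = q

∧-cong : ∀ {c d a b} → c ≡ 𝟙 a → d ≡ 𝟙 b → elimℕ 0 (λ _ → d) c ≡ 𝟙 (a ∧ b)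
∧-cong {a = true}  refl p = p
∧-cong {a = false} refl p = refl

∨-cong : ∀ {c d a b} → c ≡ 𝟙 a → d ≡ 𝟙 b → elimℕ d (λ _ → 1) c ≡ 𝟙 (a ∨ b)
∨-cong {a = true}  refl p = refl
∨-cong {a = false} refl p = p

⇒-cong : ∀ {c d a b} → c ≡ 𝟙 a → d ≡ 𝟙 b → elimℕ 1 (λ _ → d) c ≡ 𝟙 (not a ∨ b)
⇒-cong {a = true}  refl p = p
⇒-cong {a = false} refl p = refl

opaque
  -- 1 ∸ (m ∸ n) is 1 exactly if m ≤ n. Like all programs below, this one is opaque: its value is
  -- known from its `run` equation, and later its term is unfolded only to count iterations and
  -- depth.
  leT : Tm (nat ∷ nat ∷ []) nat
  leT = sub (lit 1) (sub #0 #1)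

  le-run : ∀ m n → run leT (m ∷ n ∷ []) ≡ 𝟙 (does (m ≤? n))
  le-run m n with m ≤? n
  ... | yes m≤n rewrite dec-true (m ≤? n) m≤n = cong (1 ∸_) (m≤n⇒m∸n≡0 m≤n)
  ... | no  m≰n rewrite dec-false (m ≤? n) m≰n = m≤n⇒m∸n≡0 (m<n⇒0<n∸m (≰⇒> m≰n))

opaque
  eqT : Tm (nat ∷ nat ∷ []) nat
  eqT = ite (call (#0 ∷ #1 ∷ []) leT) (call (#1 ∷ #0 ∷ []) leT) (lit 0)

  eq-run : ∀ m n → run eqT (m ∷ n ∷ []) ≡ 𝟙 (does (m ≟ n))
  eq-run m n = trans (∧-cong (le-run m n) (le-run n m)) (cong 𝟙 antisym)
    where
    antisym : does (m ≤? n) ∧ does (n ≤? m) ≡ does (m ≟ n)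
    antisym with m ≟ n
    ... | yes r rewrite dec-true (m ≤? n) (≤-reflexive r) | dec-true (n ≤? m) (≤-reflexive (sym r)) =
      sym (dec-true (m ≟ n) r)
    ... | no ¬r = trans (dec-false ((m ≤? n) ×-dec (n ≤? m)) (λ (p , q) → ¬r (≤-antisym p q)))
                        (sym (dec-false (m ≟ n) ¬r))

opaque
  maxT : Tm (nat ∷ nat ∷ []) nat
  maxT = ite (call (#0 ∷ #1 ∷ []) leT) #1 #0

  max-run : ∀ m n → run maxT (m ∷ n ∷ []) ≡ m ⊔ n
  max-run m n = trans (ite-cong (le-run m n) refl refl) choice
    where
    choice : (if does (m ≤? n) then n else m) ≡ m ⊔ n
    choice with m ≤? n
    ... | yes p rewrite dec-true (m ≤? n) p = sym (m≤n⇒m⊔n≡n p)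
    ... | no  p rewrite dec-false (m ≤? n) p = sym (m≥n⇒m⊔n≡m (≰⇒≥ p))

_∈ᴺ?_ : (x : ℕ) (xs : List ℕ) → Dec (x ∈ xs)
x ∈ᴺ? xs = Any.any? (x ≟_) xs

opaque
  memT : Tm (nat ∷ list nat ∷ []) nat
  memT = recL #1 (lit 0) (ite (call (#3 ∷ #2 ∷ []) eqT) (lit 1) #0)

  mem-run : ∀ x xs → run memT (x ∷ xs ∷ []) ≡ 𝟙 (does (x ∈ᴺ? xs))
  mem-run x []       = refl
  mem-run x (y ∷ xs) = ∨-cong (eq-run x y) (mem-run x xs)

Touches : ℕ → Edge → Set
Touches v ((u , w) , _) = v ≡ u ⊎ v ≡ w

touches? : ∀ v e → Dec (Touches v e)
touches? v ((u , w) , _) = (v ≟ u) ⊎-dec (v ≟ w)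

opaque
  touchT : Tm (nat ∷ EdgeT ∷ []) nat
  touchT = ite (call (#0 ∷ fst (fst #1) ∷ []) eqT) (lit 1) (call (#0 ∷ snd (fst #1) ∷ []) eqT)

  touch-run : ∀ v e → run touchT (v ∷ e ∷ []) ≡ 𝟙 (does (touches? v e))
  touch-run v ((u , w) , _) = ∨-cong (eq-run v u) (eq-run v w)

Covers : Edge → Appearance → Set
Covers e@(_ , ls) (v , t) = Touches v e × t ∈ ls

covers? : ∀ e a → Dec (Covers e a)
covers? e (v , t) = touches? v e ×-dec (t ∈ᴺ? proj₂ e)

opaque
  coverT : Tm (EdgeT ∷ AppT ∷ []) nat
  coverT = ite (call (fst #1 ∷ #0 ∷ []) touchT) (call (snd #1 ∷ snd #0 ∷ []) memT) (lit 0)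

  cover-run : ∀ e a → run coverT (e ∷ a ∷ []) ≡ 𝟙 (does (covers? e a))
  cover-run e (v , t) = ∧-cong (touch-run v e) (mem-run t (proj₂ e))

-- 0 if s does not cover e; labels are positive.
lastCover : Edge → List Appearance → ℕ
lastCover e []      = 0
lastCover e (a ∷ s) = if does (covers? e a) then proj₂ a ⊔ lastCover e s else lastCover e s

opaque
  lastCoverT : Tm (EdgeT ∷ list AppT ∷ []) nat
  lastCoverT =
    recL #1 (lit 0) (ite (call (#3 ∷ #2 ∷ []) coverT) (call (snd #2 ∷ #0 ∷ []) maxT) #0)

  lastCover-run : ∀ e s → run lastCoverT (e ∷ s ∷ []) ≡ lastCover e s
  lastCover-run e []      = refl
  lastCover-run e (a ∷ s) =
    ite-cong (cover-run e a) (trans (max-run (proj₂ a) (run lastCoverT (e ∷ s ∷ [])))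
                                     (cong (proj₂ a ⊔_) (lastCover-run e s)))
             (lastCover-run e s)

ActiveIn : ℕ → ℕ → Edge → Set
ActiveIn i t e = Any (λ x → i ≤ x × x ≤ t) (proj₂ e)

activeIn? : ∀ i t e → Dec (ActiveIn i t e)
activeIn? i t e = Any.any? (λ x → (i ≤? x) ×-dec (x ≤? t)) (proj₂ e)

opaque
  activeT : Tm (nat ∷ nat ∷ EdgeT ∷ []) nat
  activeT = recL (snd #2) (lit 0)
    (ite (ite (call (#3 ∷ #2 ∷ []) leT) (call (#2 ∷ #4 ∷ []) leT) (lit 0)) (lit 1) #0)

  active-run : ∀ i t e → run activeT (i ∷ t ∷ e ∷ []) ≡ 𝟙 (does (activeIn? i t e))
  active-run i t (uw , [])     = refl
  active-run i t (uw , x ∷ xs) =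
    ∨-cong (∧-cong (le-run i x) (le-run x t)) (active-run i t (uw , xs))

-- Decides the window from `i` to `t` at its end: at that moment no appearance of `s` is later than
-- `t`, so a last cover at `i` or later lies in the window. With `i` = 0 the condition holds
-- trivially.
Served : ℕ → ℕ → List Appearance → Edge → Set
Served i t s e = ActiveIn i t e → i ≤ lastCover e s

served? : ∀ i t s e → Dec (Served i t s e)
served? i t s e = activeIn? i t e →-dec (i ≤? lastCover e s)

opaque
  acceptT : Tm (nat ∷ nat ∷ list AppT ∷ list EdgeT ∷ []) nat
  acceptT = recL #3 (lit 1)
    (ite (ite (call (#3 ∷ #4 ∷ #2 ∷ []) activeT)
              (call (#3 ∷ call (#2 ∷ #5 ∷ []) lastCoverT ∷ []) leT)
              (lit 1))
         #0 (lit 0))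

  accept-run : ∀ i t s p → run acceptT (i ∷ t ∷ s ∷ p ∷ []) ≡ 𝟙 (does (All.all? (served? i t s) p))
  accept-run i t s []      = refl
  accept-run i t s (e ∷ p) =
    ∧-cong (⇒-cong (active-run i t e)
                   (trans (cong (λ l → run leT (i ∷ l ∷ [])) (lastCover-run e s)) (le-run i (lastCover e s))))
           (accept-run i t s p)

-- Partial solutions that the dynamic program for the edges p does not distinguish.
record Same (p : List Edge) (s s′ : List Appearance) : Set where
  constructor same
  field agree : All (λ e → lastCover e s ≡ lastCover e s′) p
open Same

same? : ∀ p s s′ → Dec (Same p s s′)
same? p s s′ = map′ same agree (All.all? (λ e → lastCover e s ≟ lastCover e s′) p)

opaque
  sameT : Tm (list EdgeT ∷ list AppT ∷ list AppT ∷ []) nat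
  sameT = recL #0 (lit 1)
    (ite (call (call (#2 ∷ #4 ∷ []) lastCoverT ∷ call (#2 ∷ #5 ∷ []) lastCoverT ∷ []) eqT)
         #0 (lit 0))

  same-run : ∀ p s s′ → run sameT (p ∷ s ∷ s′ ∷ []) ≡ 𝟙 (does (same? p s s′))
  same-run []      s s′ = refl
  same-run (e ∷ p) s s′ =
    ∧-cong (trans (cong₂ (λ k l → run eqT (k ∷ l ∷ [])) (lastCover-run e s) (lastCover-run e s′))
                  (eq-run (lastCover e s) (lastCover e s′)))
           (same-run p s s′)

opaque
  lengthT : Tm (list AppT ∷ []) nat
  lengthT = recL #0 (lit 0) (succ #0)

  length-run : ∀ s → run lengthT (s ∷ []) ≡ length s
  length-run []      = refl
  length-run (a ∷ s) = cong suc (length-run s)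

shorter : List Appearance → List Appearance → List Appearance
shorter s s′ = if does (length s ≤? length s′) then s else s′

opaque
  shorterT : Tm (list AppT ∷ list AppT ∷ []) (list AppT)
  shorterT =
    ite (call (call (#0 ∷ []) lengthT ∷ call (#1 ∷ []) lengthT ∷ []) leT) #0 #1

  shorter-run : ∀ s s′ → run shorterT (s ∷ s′ ∷ []) ≡ shorter s s′
  shorter-run s s′ =
    ite-cong (trans (cong₂ (λ k l → run leT (k ∷ l ∷ [])) (length-run s) (length-run s′))
                    (le-run (length s) (length s′))) refl refl

-- Tables of partial solutions

Table : Set
Table = List (List Appearance)

insert : List Edge → List Appearance → Table → Table
insert p s []       = s ∷ []
insert p s (s′ ∷ D) =
  if does (same? p s s′) then shorter s s′ ∷ D else s′ ∷ insert p s D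

opaque
  insertT : Tm (list EdgeT ∷ list AppT ∷ list (list AppT) ∷ []) (list (list AppT))
  insertT = recL #2 (cons #1 nil)
    (ite (call (#3 ∷ #4 ∷ #2 ∷ []) sameT) (cons (call (#4 ∷ #2 ∷ []) shorterT) #1) (cons #2 #0))

  insert-run : ∀ p s D → run insertT (p ∷ s ∷ D ∷ []) ≡ insert p s D
  insert-run p s []       = refl
  insert-run p s (s′ ∷ D) =
    ite-cong (same-run p s s′) (cong (_∷ D) (shorter-run s s′)) (cong (s′ ∷_) (insert-run p s D))

-- Each entry is continued without and with `a`. Merging equivalent results at once keeps the table
-- below the number of classes after every appearance, whereas choosing a set of vertices at each
-- time would create exponentially many branches.
branch : List Edge → Appearance → Table → Table
branch p a []      = []
branch p a (s ∷ D) = insert p (a ∷ s) (insert p s (branch p a D))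

opaque
  branchT : Tm (list EdgeT ∷ AppT ∷ list (list AppT) ∷ []) (list (list AppT))
  branchT = recL #2 nil
    (call (#3 ∷ cons #4 #2 ∷ call (#3 ∷ #2 ∷ #0 ∷ []) insertT ∷ []) insertT)

  branch-run : ∀ p a D → run branchT (p ∷ a ∷ D ∷ []) ≡ branch p a D
  branch-run p a []      = refl
  branch-run p a (s ∷ D)
    rewrite branch-run p a D | insert-run p s (branch p a D) = insert-run p (a ∷ s) (insert p s (branch p a D))

prune : List Edge → ℕ → ℕ → Table → Table
prune p i t []      = []
prune p i t (s ∷ D) =
  if does (All.all? (served? i t s) p) then s ∷ prune p i t D else prune p i t D

opaque
  pruneT : Tm (list EdgeT ∷ nat ∷ nat ∷ list (list AppT) ∷ []) (list (list AppT))
  pruneT = recL #3 nil (ite (call (#4 ∷ #5 ∷ #2 ∷ #3 ∷ []) acceptT) (cons #2 #0) #0)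

  prune-run : ∀ p i t D → run pruneT (p ∷ i ∷ t ∷ D ∷ []) ≡ prune p i t D
  prune-run p i t []      = refl
  prune-run p i t (s ∷ D) =
    ite-cong (accept-run i t s p) (cong (s ∷_) (prune-run p i t D)) (prune-run p i t D)

sweep : List Edge → ℕ → ℕ → Table → Table
sweep p t zero    D = D
sweep p t (suc v) D = branch p (v , t) (sweep p t v D)

opaque
  sweepT : Tm (list EdgeT ∷ nat ∷ nat ∷ list (list AppT) ∷ []) (list (list AppT))
  sweepT = recℕ #2 #3 (call (#2 ∷ pair #1 #3 ∷ #0 ∷ []) branchT)

  sweep-run : ∀ p t n D → run sweepT (p ∷ t ∷ n ∷ D ∷ []) ≡ sweep p t n D
  sweep-run p t n D = go n
    where
    go : ∀ v → paraℕ D (λ v r → run branchT (p ∷ (v , t) ∷ r ∷ [])) v ≡ sweep p t v D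
    go zero = refl
    go (suc v) rewrite go v = branch-run p (v , t) (sweep p t v D)

-- Optimal partial solutions up to time t; the window ending at time t starts at
-- suc t ∸ Δ, and is to be ignored if this is 0.
table : List Edge → ℕ → ℕ → ℕ → Table
table p n Δ zero    = [] ∷ []
table p n Δ (suc t) = prune p (2 + t ∸ Δ) (suc t) (sweep p (suc t) n (table p n Δ t))

opaque
  tableT : Tm (list EdgeT ∷ nat ∷ nat ∷ nat ∷ []) (list (list AppT))
  tableT = recℕ #3 (cons nil nil)
    (call (#2 ∷ sub (succ (succ #1)) #4 ∷ succ #1 ∷
           call (#2 ∷ succ #1 ∷ #3 ∷ #0 ∷ []) sweepT ∷ []) pruneT)

  table-run : ∀ p n Δ T → run tableT (p ∷ n ∷ Δ ∷ T ∷ []) ≡ table p n Δ T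
  table-run p n Δ zero    = refl
  table-run p n Δ (suc t)
    rewrite table-run p n Δ t | sweep-run p (suc t) n (table p n Δ t) =
      prune-run p (2 + t ∸ Δ) (suc t) (sweep p (suc t) n (table p n Δ t))

best : Table → List Appearance
best []      = []
best (s ∷ D) = foldr shorter s D

opaque
  bestT : Tm (list (list AppT) ∷ []) (list AppT)
  bestT = caseL #0 nil (recL #0 #1 (call (#2 ∷ #0 ∷ []) shorterT))

  best-run : ∀ D → run bestT (D ∷ []) ≡ best D
  best-run []      = refl
  best-run (s ∷ D) = go D
    where
    go : ∀ D → paraL s (λ x _ r → run shorterT (x ∷ r ∷ [])) D ≡ foldr shorter s D
    go []      = refl
    go (x ∷ D) rewrite go D = shorter-run x (foldr shorter s D)

-- The arguments (k, p, ps) of a chopped list are the number k of edges still to be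
-- put into its first piece p, and its remaining pieces ps.
Chopped : Set
Chopped = ℕ × List Edge × List (List Edge)

grow : ℕ → Edge → Chopped → Chopped
grow ℓ e (zero  , p , ps) = ℓ , (e ∷ []) , (p ∷ ps)
grow ℓ e (suc k , p , ps) = k , (e ∷ p) , ps

-- The recursion starts at the end of the list: the shift `r` is the room of the last piece, and
-- every other piece is opened with `ℓ` places left beside its first edge. Varying `r` from 0 to `ℓ`
-- moves the cuts through all residues modulo `suc ℓ`.
chop : ℕ → ℕ → List Edge → Chopped
chop ℓ r []       = r , [] , []
chop ℓ r (e ∷ es) = grow ℓ e (chop ℓ r es)

ChoppedT : Ty
ChoppedT = nat ⊗ (list EdgeT ⊗ list (list EdgeT))

opaque
  growT : Tm (nat ∷ EdgeT ∷ ChoppedT ∷ []) ChoppedT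
  growT = caseℕ (fst #2)
    (pair #0 (pair (cons #1 nil) (cons (fst (snd #2)) (snd (snd #2)))))
    (pair #0 (pair (cons #2 (fst (snd #3))) (snd (snd #3))))

  grow-run : ∀ ℓ e c → run growT (ℓ ∷ e ∷ c ∷ []) ≡ grow ℓ e c
  grow-run ℓ e (zero  , p , ps) = refl
  grow-run ℓ e (suc k , p , ps) = refl

opaque
  chopT : Tm (nat ∷ nat ∷ list EdgeT ∷ []) ChoppedT
  chopT = recL #2 (pair #1 (pair nil nil)) (call (#3 ∷ #2 ∷ #0 ∷ []) growT)

  chop-run : ∀ ℓ r es → run chopT (ℓ ∷ r ∷ es ∷ []) ≡ chop ℓ r es
  chop-run ℓ r []       = refl
  chop-run ℓ r (e ∷ es) rewrite chop-run ℓ r es = grow-run ℓ e (chop ℓ r es)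

pieces : ℕ → ℕ → List Edge → List (List Edge)
pieces ℓ r es = let (_ , p , ps) = chop ℓ r es in p ∷ ps

opaque
  piecesT : Tm (nat ∷ nat ∷ list EdgeT ∷ []) (list (list EdgeT))
  piecesT = cons (fst (snd (call (#0 ∷ #1 ∷ #2 ∷ []) chopT)))
                 (snd (snd (call (#0 ∷ #1 ∷ #2 ∷ []) chopT)))

  pieces-run : ∀ ℓ r es → run piecesT (ℓ ∷ r ∷ es ∷ []) ≡ pieces ℓ r es
  pieces-run ℓ r es rewrite chop-run ℓ r es = refl

-- Ordering the edges along the line

toFront : ℕ → List Edge → List Edge
toFront x []       = []
toFront x (e ∷ es) =
  if does (touches? x e) then e ∷ es
  else elimL (e ∷ []) (λ f fs → f ∷ e ∷ fs) (toFront x es)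

opaque
  toFrontT : Tm (nat ∷ list EdgeT ∷ []) (list EdgeT)
  toFrontT = recL #1 nil
    (ite (call (#3 ∷ #2 ∷ []) touchT) (cons #2 #1)
         (caseL #0 (cons #2 nil) (cons #1 (cons #4 #0))))

  toFront-run : ∀ x es → run toFrontT (x ∷ es ∷ []) ≡ toFront x es
  toFront-run x []       = refl
  toFront-run x (e ∷ es) =
    ite-cong (touch-run x e) refl (cong (elimL (e ∷ []) (λ f fs → f ∷ e ∷ fs)) (toFront-run x es))

other : ℕ → Edge → ℕ
other x ((u , w) , _) = if does (x ≟ u) then w else u

opaque
  otherT : Tm (nat ∷ EdgeT ∷ []) nat
  otherT = ite (call (#0 ∷ fst (fst #1) ∷ []) eqT) (snd (fst #1)) (fst (fst #1))

  other-run : ∀ x e → run otherT (x ∷ e ∷ []) ≡ other x e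
  other-run x ((u , w) , _) = ite-cong (eq-run x u) refl refl

-- A walk: the current vertex, the edges traversed (latest first), the other edges.
Walk : Set
Walk = ℕ × List Edge × List Edge

-- If no edge is left at `x`, `toFront` brings up some other edge and the walk continues there. So
-- all edges are used from any start, and `walk` always returns a permutation.
step : Walk → Walk
step (x , done , rest) =
  elimL (x , done , rest) (λ e es → other x e , (e ∷ done) , es) (toFront x rest)

WalkT : Ty
WalkT = nat ⊗ (list EdgeT ⊗ list EdgeT)

opaque
  stepT : Tm (WalkT ∷ []) WalkT
  stepT = caseL (call (fst #0 ∷ snd (snd #0) ∷ []) toFrontT) #0
    (pair (call (fst #2 ∷ #1 ∷ []) otherT) (pair (cons #1 (fst (snd #2))) #0))

  step-run : ∀ w → run stepT (w ∷ []) ≡ step w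
  step-run (x , done , rest) rewrite toFront-run x rest with toFront x rest
  ... | []     = refl
  ... | e ∷ es = cong (_, _) (other-run x e)

steps : ℕ → Walk → Walk
steps zero    w = w
steps (suc k) w = step (steps k w)

walk : ℕ → List Edge → List Edge
walk x es = proj₁ (proj₂ (steps (length es) (x , [] , es)))

opaque
  walkT : Tm (nat ∷ list EdgeT ∷ []) (list EdgeT)
  walkT = fst (snd (recL #1 (pair #0 (pair nil #1)) (call (#0 ∷ []) stepT)))

  walk-run : ∀ x es → run walkT (x ∷ es ∷ []) ≡ walk x es
  walk-run x es = cong {A = Walk} (λ w → proj₁ (proj₂ w)) (go es)
    where
    go : ∀ (fs : List Edge) → paraL (x , [] , es) (λ _ _ w → run stepT (w ∷ [])) fs ≡
                steps (length fs) (x , [] , es)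
    go []       = refl
    go (f ∷ fs) rewrite go fs = step-run (steps (length fs) (x , [] , es))

-- Union of solutions and the search for the best candidate

_≟ᴬ_ : (a b : Appearance) → Dec (a ≡ b)
(v , t) ≟ᴬ (w , u) = map′ (λ (p , q) → cong₂ _,_ p q) (λ p → cong proj₁ p , cong proj₂ p)
                          ((v ≟ w) ×-dec (t ≟ u))

_∈ᴬ?_ : (a : Appearance) (s : List Appearance) → Dec (a ∈ s)
a ∈ᴬ? s = Any.any? (a ≟ᴬ_) s

opaque
  memAppT : Tm (AppT ∷ list AppT ∷ []) nat
  memAppT = recL #1 (lit 0)
    (ite (ite (call (fst #3 ∷ fst #2 ∷ []) eqT) (call (snd #3 ∷ snd #2 ∷ []) eqT) (lit 0)) (lit 1) #0)

  memApp-run : ∀ a s → run memAppT (a ∷ s ∷ []) ≡ 𝟙 (does (a ∈ᴬ? s))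
  memApp-run a []      = refl
  memApp-run a (b ∷ s) =
    ∨-cong (∧-cong (eq-run (proj₁ a) (proj₁ b)) (eq-run (proj₂ a) (proj₂ b))) (memApp-run a s)

add : Appearance → List Appearance → List Appearance
add a s = if does (a ∈ᴬ? s) then s else a ∷ s

merge : List Appearance → List Appearance → List Appearance
merge s s′ = foldr add s′ s

opaque
  mergeT : Tm (list AppT ∷ list AppT ∷ []) (list AppT)
  mergeT = recL #0 #1 (ite (call (#2 ∷ #0 ∷ []) memAppT) #0 (cons #2 #0))

  merge-run : ∀ s s′ → run mergeT (s ∷ s′ ∷ []) ≡ merge s s′
  merge-run []      s′ = refl
  merge-run (a ∷ s) s′ rewrite merge-run s s′ = ite-cong (memApp-run a (merge s s′)) refl refl

solve-pieces : ℕ → ℕ → ℕ → List (List Edge) → List Appearance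
solve-pieces n Δ T = foldr (λ p s → merge (best (table p n Δ T)) s) []

opaque
  solveT : Tm (nat ∷ nat ∷ nat ∷ list (list EdgeT) ∷ []) (list AppT)
  solveT = recL #3 nil
    (call (call (call (#2 ∷ #3 ∷ #4 ∷ #5 ∷ []) tableT ∷ []) bestT ∷ #0 ∷ []) mergeT)

  solve-run : ∀ n Δ T ps → run solveT (n ∷ Δ ∷ T ∷ ps ∷ []) ≡ solve-pieces n Δ T ps
  solve-run n Δ T []       = refl
  solve-run n Δ T (p ∷ ps)
    rewrite solve-run n Δ T ps | table-run p n Δ T | best-run (table p n Δ T) =
      merge-run (best (table p n Δ T)) (solve-pieces n Δ T ps)

candidate : ℕ → List Edge → ℕ → ℕ → ℕ → ℕ → ℕ → List Appearance
candidate ℓ es n Δ T x r = solve-pieces n Δ T (pieces ℓ r (walk x es))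

opaque
  candidateT : Tm (nat ∷ list EdgeT ∷ nat ∷ nat ∷ nat ∷ nat ∷ nat ∷ []) (list AppT)
  candidateT =
    call (#2 ∷ #3 ∷ #4 ∷ call (#0 ∷ #6 ∷ call (#5 ∷ #1 ∷ []) walkT ∷ []) piecesT ∷ []) solveT

  candidate-run : ∀ ℓ es n Δ T x r →
    run candidateT (ℓ ∷ es ∷ n ∷ Δ ∷ T ∷ x ∷ r ∷ []) ≡ candidate ℓ es n Δ T x r
  candidate-run ℓ es n Δ T x r
    rewrite walk-run x es | pieces-run ℓ r (walk x es) = solve-run n Δ T (pieces ℓ r (walk x es))

-- The value f 0 0 serves as default when there is no vertex to start from.
shortest : (ℕ → ℕ → List Appearance) → ℕ → ℕ → List Appearance
shortest f zero    k = f 0 0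
shortest f (suc x) k = paraℕ (shortest f x k) (λ r s → shorter (f x r) s) k

search : ℕ → List Edge → ℕ → ℕ → ℕ → List Appearance
search ℓ es n Δ T = shortest (candidate ℓ es n Δ T) n (suc ℓ)

opaque
  searchT : Tm (nat ∷ list EdgeT ∷ nat ∷ nat ∷ nat ∷ []) (list AppT)
  searchT = recℕ #2 (call (#0 ∷ #1 ∷ #2 ∷ #3 ∷ #4 ∷ lit 0 ∷ lit 0 ∷ []) candidateT)
    (recℕ (succ #2) #0
      (call (call (#4 ∷ #5 ∷ #6 ∷ #7 ∷ #8 ∷ #3 ∷ #1 ∷ []) candidateT ∷ #0 ∷ []) shorterT))

  search-run : ∀ ℓ es n Δ T → run searchT (ℓ ∷ es ∷ n ∷ Δ ∷ T ∷ []) ≡ search ℓ es n Δ T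
  search-run ℓ es n Δ T = outer n
    where
    f f′ : ℕ → ℕ → List Appearance
    f x r = run candidateT (ℓ ∷ es ∷ n ∷ Δ ∷ T ∷ x ∷ r ∷ [])
    f′ = candidate ℓ es n Δ T

    inner : ∀ x {s s′} → s ≡ s′ → ∀ k →
            paraℕ s (λ r s → run shorterT (f x r ∷ s ∷ [])) k ≡
            paraℕ s′ (λ r s → shorter (f′ x r) s) k
    inner x refl zero = refl
    inner x refl (suc r) =
      trans (cong₂ (λ s s′ → run shorterT (s ∷ s′ ∷ [])) (candidate-run ℓ es n Δ T x r)
                                                         (inner x refl r))
            (shorter-run (f′ x r) _)

    outer : ∀ m → paraℕ (f 0 0)
                    (λ x s → paraℕ s (λ r s → run shorterT (f x r ∷ s ∷ [])) (suc ℓ)) m ≡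
                  shortest f′ m (suc ℓ)
    outer zero    = candidate-run ℓ es n Δ T 0 0
    outer (suc x) = inner x (outer x) (suc ℓ)

lifetime : List Edge → ℕ
lifetime = foldr (λ e m → foldr _⊔_ m (proj₂ e)) 0

opaque
  lifetimeT : Tm (list EdgeT ∷ []) nat
  lifetimeT = recL #0 (lit 0) (recL (snd #2) #0 (call (#2 ∷ #0 ∷ []) maxT))

  lifetime-run : ∀ es → run lifetimeT (es ∷ []) ≡ lifetime es
  lifetime-run []       = refl
  lifetime-run (e ∷ es) rewrite lifetime-run es = go (proj₂ e)
    where
    go : ∀ ls → paraL (lifetime es) (λ x _ m → run maxT (x ∷ m ∷ [])) ls ≡
                foldr _⊔_ (lifetime es) ls
    go []       = refl
    go (x ∷ ls) rewrite go ls = max-run x (foldr _⊔_ (lifetime es) ls)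

program : ℕ → ℕ → List Edge → ℕ → List Appearance
program Δ ℓ es n = search ℓ es n Δ (lifetime es)

opaque
  programT : ℕ → ℕ → Tm (Input ∷ []) Output
  programT Δ ℓ =
    call (lit ℓ ∷ snd #0 ∷ fst #0 ∷ lit Δ ∷ call (snd #0 ∷ []) lifetimeT ∷ []) searchT

  program-run : ∀ Δ ℓ n es → run (programT Δ ℓ) ((n , es) ∷ []) ≡ program Δ ℓ es n
  program-run Δ ℓ n es rewrite lifetime-run es = search-run ℓ es n Δ (lifetime es)

-- The dynamic program

unique-⊆-length : ∀ {A : Set} {xs ys : List A} → Unique xs →
                  (∀ {x} → x ∈ xs → x ∈ ys) → length xs ≤ length ys
unique-⊆-length []        inc = z≤n
unique-⊆-length {xs = x ∷ xs} (x∉ ∷ u) inc with ∈-∃++ (inc (here refl))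
... | ys₁ , ys₂ , refl = ≤-trans (s≤s (unique-⊆-length u inc′)) (≤-reflexive (sym eq))
  where
  inc′ : ∀ {y} → y ∈ xs → y ∈ ys₁ ++ ys₂
  inc′ {y} y∈ with ∈-++⁻ ys₁ (inc (there y∈))
  ... | inj₁ p           = ∈-++⁺ˡ p
  ... | inj₂ (there p)   = ∈-++⁺ʳ ys₁ p
  ... | inj₂ (here refl) = contradiction refl (All.lookup x∉ y∈)
  eq : length (ys₁ ++ x ∷ ys₂) ≡ suc (length (ys₁ ++ ys₂))
  eq = trans (length-++ ys₁) (trans (+-suc (length ys₁) _) (cong suc (sym (length-++ ys₁))))

if-elim : ∀ {A : Set} {X : Set} (P : X → Set) (d : Dec A) {x y : X} →
          (A → P x) → (¬ A → P y) → P (if does d then x else y)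
if-elim P (yes a) f g = f a
if-elim P (no ¬a) f g = g ¬a

shorter-≤ˡ : ∀ s s′ → length (shorter s s′) ≤ length s
shorter-≤ˡ s s′ = if-elim (λ z → length z ≤ length s) (length s ≤? length s′)
                          (λ _ → ≤-refl) (λ p → ≰⇒≥ p)

shorter-≤ʳ : ∀ s s′ → length (shorter s s′) ≤ length s′
shorter-≤ʳ s s′ = if-elim (λ z → length z ≤ length s′) (length s ≤? length s′) id (λ _ → ≤-refl)

shorter-all : ∀ {P : List Appearance → Set} s s′ → P s → P s′ → P (shorter s s′)
shorter-all {P} s s′ p q = if-elim P (length s ≤? length s′) (λ _ → p) (λ _ → q)

lastCover-cong : ∀ e a s s′ → lastCover e s ≡ lastCover e s′ →
                 lastCover e (a ∷ s) ≡ lastCover e (a ∷ s′)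
lastCover-cong e a s s′ eq =
  cong (λ l → if does (covers? e a) then proj₂ a ⊔ l else l) eq

lastCover-≥ : ∀ e {a s} → a ∈ s → Covers e a → proj₂ a ≤ lastCover e s
lastCover-≥ e {a} {b ∷ s} (here refl) c =
  if-elim (proj₂ a ≤_) (covers? e a) (λ _ → m≤m⊔n _ _) (λ ¬c → contradiction c ¬c)
lastCover-≥ e {a} {b ∷ s} (there a∈) c =
  if-elim (proj₂ a ≤_) (covers? e b)
    (λ _ → ≤-trans (lastCover-≥ e a∈ c) (m≤n⊔m (proj₂ b) _)) (λ _ → lastCover-≥ e a∈ c)

lastCover-witness : ∀ e s → 1 ≤ lastCover e s →
                    ∃[ a ] (a ∈ s × Covers e a × proj₂ a ≡ lastCover e s)
lastCover-witness e (b ∷ s) =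
  if-elim (λ l → 1 ≤ l → ∃[ a ] (a ∈ b ∷ s × Covers e a × proj₂ a ≡ l)) (covers? e b)
    covered (λ _ → later)
  where
  later : 1 ≤ lastCover e s → ∃[ a ] (a ∈ b ∷ s × Covers e a × proj₂ a ≡ lastCover e s)
  later 1≤ with lastCover-witness e s 1≤
  ... | a , a∈ , c , eq = a , there a∈ , c , eq

  covered : Covers e b → 1 ≤ proj₂ b ⊔ lastCover e s →
            ∃[ a ] (a ∈ b ∷ s × Covers e a × proj₂ a ≡ proj₂ b ⊔ lastCover e s)
  covered c 1≤ with ⊔-sel (proj₂ b) (lastCover e s)
  ... | inj₁ eq = b , here refl , c , sym eq
  ... | inj₂ eq rewrite eq = later 1≤

lastCover-≤ : ∀ {t} e {s} → All (λ a → proj₂ a ≤ t) s → lastCover e s ≤ t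
lastCover-≤ e [] = z≤n
lastCover-≤ {t} e {a ∷ s} (p ∷ ps) =
  if-elim (_≤ t) (covers? e a) (λ _ → ⊔-lub p (lastCover-≤ e ps)) (λ _ → lastCover-≤ e ps)

module _ (p : List Edge) where

  same-sym : ∀ {s s′} → Same p s s′ → Same p s′ s
  same-sym (same q) = same (All.map sym q)

  same-trans : ∀ {s s′ s″} → Same p s s′ → Same p s′ s″ → Same p s s″
  same-trans (same q) (same r) = same (All.zipWith (λ (a , b) → trans a b) (q , r))

  same-refl : ∀ {s} → Same p s s
  same-refl = same (All.universal (λ _ → refl) p)

  same-∷ : ∀ a {s s′} → Same p s s′ → Same p (a ∷ s) (a ∷ s′)
  same-∷ a {s} {s′} (same q) = same (All.map (λ {e} → lastCover-cong e a s s′) q)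

  insert-all : ∀ {P : List Appearance → Set} {s D} → P s → All P D → All P (insert p s D)
  insert-all ps [] = ps ∷ []
  insert-all {P} {s} {s′ ∷ D} ps (qs ∷ qD) =
    if-elim (All P) (same? p s s′) (λ _ → shorter-all s s′ ps qs ∷ qD)
            (λ _ → qs ∷ insert-all ps qD)

  branch-all : ∀ {P Q : List Appearance → Set} {a D} → (∀ {s} → P s → Q s) →
               (∀ {s} → P s → Q (a ∷ s)) → All P D → All Q (branch p a D)
  branch-all f g []       = []
  branch-all f g (q ∷ qs) = insert-all (g q) (insert-all (f q) (branch-all f g qs))

  prune-all : ∀ {P : List Appearance → Set} {i t D} → All P D →
              All (λ s → P s × All (Served i t s) p) (prune p i t D)
  prune-all [] = []
  prune-all {P} {i} {t} {s ∷ D} (q ∷ qs) =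
    if-elim (All (λ s → P s × All (Served i t s) p)) (All.all? (served? i t s) p)
            (λ ok → (q , ok) ∷ prune-all qs) (λ _ → prune-all qs)

  Dominated : List Appearance → Table → Set
  Dominated s D = Any (λ s′ → Same p s′ s × length s′ ≤ length s) D

  insert-new : ∀ s D → Dominated s (insert p s D)
  insert-new s []       = here (same-refl , ≤-refl)
  insert-new s (s′ ∷ D) = if-elim (Dominated s) (same? p s s′)
    (λ eq → here (shorter-all {λ z → Same p z s} s s′ same-refl (same-sym eq)
                  , shorter-≤ˡ s s′))
    (λ _ → there (insert-new s D))

  -- An entry can only be replaced by one of its class that is no longer, which dominates whatever
  -- the old entry dominated.
  insert-old : ∀ {s} s″ {D} → Dominated s D → Dominated s (insert p s″ D)
  insert-old {s} s″ {s′ ∷ D} (here (eq , le)) = if-elim (Dominated s) (same? p s″ s′)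
    (λ eq′ → here (shorter-all {λ z → Same p z s} s″ s′ (same-trans eq′ eq) eq
                  , ≤-trans (shorter-≤ʳ s″ s′) le))
    (λ _ → here (eq , le))
  insert-old {s} s″ {s′ ∷ D} (there d) = if-elim (Dominated s) (same? p s″ s′)
    (λ _ → there d) (λ _ → there (insert-old s″ d))

  dominated-trans : ∀ {s s′ D} → Same p s s′ → length s ≤ length s′ →
                    Dominated s D → Dominated s′ D
  dominated-trans eq le = Any.map (λ (eq′ , le′) → same-trans eq′ eq , ≤-trans le′ le)

  branch-skip : ∀ {s} a {D} → Dominated s D → Dominated s (branch p a D)
  branch-skip a {s ∷ D} (here (eq , le)) =
    insert-old (a ∷ s) (dominated-trans eq le (insert-new s (branch p a D)))
  branch-skip a {s ∷ D} (there d) = insert-old (a ∷ s) (insert-old s (branch-skip a d))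

  branch-take : ∀ {s} a {D} → Dominated s D → Dominated (a ∷ s) (branch p a D)
  branch-take a {s ∷ D} (here (eq , le)) =
    dominated-trans (same-∷ a eq) (s≤s le) (insert-new (a ∷ s) (insert p s (branch p a D)))
  branch-take a {s ∷ D} (there d) = insert-old (a ∷ s) (insert-old s (branch-take a d))

  served-cong : ∀ {i t s s′} → Same p s s′ → All (Served i t s) p → All (Served i t s′) p
  served-cong {i} (same eq) sv = All.zipWith (λ (l , f) act → subst (i ≤_) l (f act)) (eq , sv)

  -- Being served depends on the last covers only, so an entry that dominates `s` survives if `s`
  -- would.
  prune-dominated : ∀ {i t s D} → All (Served i t s) p → Dominated s D →
                    Dominated s (prune p i t D)
  prune-dominated {i} {t} {s} {s′ ∷ D} sv (here (eq , le)) =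
    if-elim (Dominated s) (All.all? (served? i t s′) p) (λ _ → here (eq , le))
            (λ ¬sv → contradiction (served-cong (same-sym eq) sv) ¬sv)
  prune-dominated {i} {t} {s} {s′ ∷ D} sv (there d) =
    if-elim (Dominated s) (All.all? (served? i t s′) p) (λ _ → there (prune-dominated sv d))
            (λ _ → prune-dominated sv d)

  Distinct : Table → Set
  Distinct = AllPairs (λ s s′ → ¬ Same p s s′)

  insert-distinct : ∀ s {D} → Distinct D → Distinct (insert p s D)
  insert-distinct s [] = [] ∷ []
  insert-distinct s {s′ ∷ D} (d ∷ ds) = if-elim Distinct (same? p s s′)
    (λ eq → shorter-all {λ z → All (λ y → ¬ Same p z y) D} s s′
              (All.map (λ ¬eq eq′ → ¬eq (same-trans (same-sym eq) eq′)) d) d ∷ ds)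
    (λ ¬eq → insert-all (¬eq ∘ same-sym) d ∷ insert-distinct s ds)

  branch-distinct : ∀ a {D} → Distinct D → Distinct (branch p a D)
  branch-distinct a []                = []
  branch-distinct a {s ∷ D} (_ ∷ ds) =
    insert-distinct (a ∷ s) (insert-distinct s (branch-distinct a ds))

  prune-distinct : ∀ i t {D} → Distinct D → Distinct (prune p i t D)
  prune-distinct i t [] = []
  prune-distinct i t {s ∷ D} (d ∷ ds) = if-elim Distinct (All.all? (served? i t s) p)
    (λ _ → All.map proj₁ (prune-all d) ∷ prune-distinct i t ds) (λ _ → prune-distinct i t ds)

  vectors : ℕ → ℕ → List (List ℕ)
  vectors b zero    = [] ∷ []
  vectors b (suc k) = cartesianProductWith _∷_ (upTo (suc b)) (vectors b k)

  length-vectors : ∀ b k → length (vectors b k) ≡ suc b ^ k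
  length-vectors b zero    = refl
  length-vectors b (suc k) =
    trans (length-product (upTo (suc b)))
          (cong₂ _*_ (length-upTo (suc b)) (length-vectors b k))
    where
    length-product : ∀ xs → length (cartesianProductWith {A = ℕ} {C = List ℕ} _∷_ xs (vectors b k)) ≡
                            length xs * length (vectors b k)
    length-product []       = refl
    length-product (x ∷ xs) =
      trans (length-++ (map (x ∷_) (vectors b k)))
            (cong₂ _+_ (length-map (x ∷_) (vectors b k)) (length-product xs))

  ∈-vectors : ∀ b {xs} → All (_≤ b) xs → xs ∈ vectors b (length xs)
  ∈-vectors b []       = here refl
  ∈-vectors b (x ∷ xs) = ∈-cartesianProductWith⁺ _∷_ (∈-upTo⁺ (s≤s x)) (∈-vectors b xs)

  key : List Appearance → List ℕ
  key s = map (λ e → lastCover e s) p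

  -- Entries of distinct classes have distinct keys, and a key is a vector over 0, ..., `b` with one
  -- coordinate per edge of `p`.
  distinct-length : ∀ b {D} → Distinct D → All (All (λ a → proj₂ a ≤ b)) D →
                    length D ≤ suc b ^ length p
  distinct-length b {D} d h = begin
    length D                         ≡⟨ length-map key D ⟨
    length (map key D)               ≤⟨ unique-⊆-length
                                          (AllPairs.map⁺ (AllPairs.map (λ {s} {s′} ¬eq eq → ¬eq (same (unkey {s} {s′} p eq))) d))
                                          key∈ ⟩
    length (vectors b (length p))    ≡⟨ length-vectors b (length p) ⟩
    suc b ^ length p                 ∎
    where
    open ≤-Reasoning
    unkey : ∀ {s s′} q → map (λ e → lastCover e s) q ≡ map (λ e → lastCover e s′) q →
            All (λ e → lastCover e s ≡ lastCover e s′) q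
    unkey []      eq = []
    unkey {s} {s′} (e ∷ q) eq = ∷-injectiveˡ eq ∷ unkey {s} {s′} q (∷-injectiveʳ eq)

    key∈ : ∀ {k} → k ∈ map key D → k ∈ vectors b (length p)
    key∈ k∈ with ∈-map⁻ key k∈
    ... | s , s∈ , refl = subst (λ l → key s ∈ vectors b l) (length-map _ p)
      (∈-vectors b (All.map⁺ (All.universal (λ e → lastCover-≤ e (All.lookup h s∈)) p)))

-- Windows, and solutions given by characteristic functions

Grid : ℕ → ℕ → Appearance → Set
Grid n t (v , u) = v < n × 1 ≤ u × u ≤ t

-- Windows are indexed by their last time `t`, when the sweep decides them. The premise
-- `1 ≤ suc t ∸ Δ` discards those that would begin before time 1.
WindowOK : ℕ → ℕ → List Appearance → Edge → Set
WindowOK Δ t s e = 1 ≤ suc t ∸ Δ → ActiveIn (suc t ∸ Δ) t e →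
  ∃[ a ] (a ∈ s × Covers e a × suc t ∸ Δ ≤ proj₂ a × proj₂ a ≤ t)

windowOK-∷ : ∀ {Δ t s a e} → WindowOK Δ t s e → WindowOK Δ t (a ∷ s) e
windowOK-∷ ok 1≤ act = let (b , b∈ , rest) = ok 1≤ act in b , there b∈ , rest

selectAt : (ℕ → ℕ → Bool) → ℕ → ℕ → List Appearance → List Appearance
selectAt o t zero    s = s
selectAt o t (suc v) s = if o v t then (v , t) ∷ selectAt o t v s else selectAt o t v s

-- Lists the solution with characteristic function `o` in the order in which `table` decides the
-- appearances, so that the two can be compared step by step.
select : (ℕ → ℕ → Bool) → ℕ → ℕ → List Appearance
select o n zero    = []
select o n (suc t) = selectAt o (suc t) n (select o n t)

module _ (o : ℕ → ℕ → Bool) where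

  selectAt-old : ∀ t v {s a} → a ∈ s → a ∈ selectAt o t v s
  selectAt-old t zero    a∈ = a∈
  selectAt-old t (suc v) a∈ with o v t
  ... | true  = there (selectAt-old t v a∈)
  ... | false = selectAt-old t v a∈

  selectAt-new : ∀ t v {s w} → w < v → o w t ≡ true → (w , t) ∈ selectAt o t v s
  selectAt-new t (suc v) {s} {w} (s≤s w≤v) ow with w ≟ v
  ... | yes refl rewrite ow = here refl
  ... | no w≢v with o v t
  ...   | true  = there (selectAt-new t v (≤∧≢⇒< w≤v w≢v) ow)
  ...   | false = selectAt-new t v (≤∧≢⇒< w≤v w≢v) ow

  select-complete : ∀ {n} t {a} → Grid n t a → o (proj₁ a) (proj₂ a) ≡ true → a ∈ select o n t
  select-complete zero (_ , 1≤u , u≤0) _ = contradiction (≤-trans 1≤u u≤0) λ()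
  select-complete {n} (suc t) {v , u} (v<n , 1≤u , u≤) ov with u ≟ suc t
  ... | yes refl = selectAt-new (suc t) n v<n ov
  ... | no u≢    = selectAt-old (suc t) n
                     (select-complete t (v<n , 1≤u , ≤-pred (≤∧≢⇒< u≤ u≢)) ov)

  selectAt-all : ∀ {P : Appearance → Set} t v {s} → All P s →
                 (∀ w → w < v → o w t ≡ true → P (w , t)) → All P (selectAt o t v s)
  selectAt-all t zero ps f = ps
  selectAt-all t (suc v) ps f with o v t in eq
  ... | true  = f v ≤-refl eq ∷ selectAt-all t v ps (λ w w<v → f w (m<n⇒m<1+n w<v))
  ... | false = selectAt-all t v ps (λ w w<v → f w (m<n⇒m<1+n w<v))

  select-sound : ∀ n t → All (λ a → Grid n t a × o (proj₁ a) (proj₂ a) ≡ true) (select o n t)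
  select-sound n zero    = []
  select-sound n (suc t) = selectAt-all (suc t) n
    (All.map (λ ((v< , 1≤ , ≤t) , ov) → (v< , 1≤ , m≤n⇒m≤1+n ≤t) , ov) (select-sound n t))
    (λ w w<n ow → (w<n , s≤s z≤n , ≤-refl) , ow)

  select-unique : ∀ n t → Unique (select o n t)
  select-unique n zero    = []
  select-unique n (suc t) = go n
    where
    go : ∀ v → Unique (selectAt o (suc t) v (select o n t))
    go zero = select-unique n t
    go (suc v) with o v (suc t)
    ... | false = go v
    ... | true  = selectAt-all {P = (v , suc t) ≢_} (suc t) v
                    (All.map (λ ((_ , _ , ≤t) , _) eq → <⇒≱ (s≤s ≤t) (≤-reflexive (cong proj₂ eq)))
                             (select-sound n t))
                    (λ w w<v _ eq → <-irrefl (sym (cong proj₁ eq)) w<v) ∷ go v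

module _ (p : List Edge) (n Δ : ℕ) where

  -- While the sweep adds appearances of time `t`, the windows are settled only up to the preceding
  -- time `t₀`. The bound `m` counts the decisions taken so far.
  Partial : ℕ → ℕ → ℕ → List Appearance → Set
  Partial t₀ t m s =
    All (Grid n t) s × length s ≤ m × (∀ u → 1 ≤ u → u ≤ t₀ → All (WindowOK Δ u s) p)

  sweep-partial : ∀ {t D} v → v ≤ n → All (Partial t t (t * n)) D →
                  All (Partial t (suc t) (v + t * n)) (sweep p (suc t) v D)
  sweep-partial zero _ ps =
    All.map (λ (g , l , w) → All.map (λ (a , b , c) → a , b , m≤n⇒m≤1+n c) g , l , w) ps
  sweep-partial (suc v) v<n ps = branch-all p
    (λ (g , l , w) → g , m≤n⇒m≤1+n l , w)
    (λ (g , l , w) → (v<n , s≤s z≤n , ≤-refl) ∷ g , s≤s l ,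
                     λ u 1≤u u≤ → All.map (λ {e} → windowOK-∷ {Δ} {e = e}) (w u 1≤u u≤))
    (sweep-partial v (<⇒≤ v<n) ps)

  table-partial : ∀ t → All (Partial t t (t * n)) (table p n Δ t)
  table-partial zero    = ([] , z≤n , λ u 1≤u u≤0 → contradiction (≤-trans 1≤u u≤0) λ()) ∷ []
  table-partial (suc t) =
    All.map finish (prune-all p (sweep-partial n ≤-refl (table-partial t)))
    where
    finish : ∀ {s} → Partial t (suc t) (n + t * n) s × All (Served (2 + t ∸ Δ) (suc t) s) p →
             Partial (suc t) (suc t) (n + t * n) s
    finish {s} ((g , l , w) , sv) = g , l , windows
      where
      windows : ∀ u → 1 ≤ u → u ≤ suc t → All (WindowOK Δ u s) p
      windows u 1≤u u≤ with u ≟ suc t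
      ... | no u≢    = w u 1≤u (≤-pred (≤∧≢⇒< u≤ u≢))
      ... | yes refl = All.map (λ {e} → last e) sv
        where
        last : ∀ e → Served (2 + t ∸ Δ) (suc t) s e → WindowOK Δ (suc t) s e
        last e f 1≤i act with lastCover-witness e s (≤-trans 1≤i (f act))
        ... | a , a∈ , c , eq = a , a∈ , c , subst (2 + t ∸ Δ ≤_) (sym eq) (f act) ,
                                proj₂ (proj₂ (All.lookup g a∈))

  sweep-distinct : ∀ t v {D} → Distinct p D → Distinct p (sweep p t v D)
  sweep-distinct t zero    d = d
  sweep-distinct t (suc v) d = branch-distinct p (v , t) (sweep-distinct t v d)

  table-distinct : ∀ t → Distinct p (table p n Δ t)
  table-distinct zero    = [] ∷ []
  table-distinct (suc t) = prune-distinct p _ _ (sweep-distinct (suc t) n (table-distinct t))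

  FeasibleAt : (ℕ → ℕ → Bool) → ℕ → Edge → Set
  FeasibleAt o t e = 1 ≤ 2 + t ∸ Δ → ActiveIn (2 + t ∸ Δ) (suc t) e →
    ∃[ a ] (Grid n (suc t) a × o (proj₁ a) (proj₂ a) ≡ true × Covers e a × 2 + t ∸ Δ ≤ proj₂ a)

  Feasible : (ℕ → ℕ → Bool) → ℕ → Set
  Feasible o T = ∀ t → t < T → All (FeasibleAt o t) p

  sweep-dominated : ∀ o t v {s D} → Dominated p s D →
                    Dominated p (selectAt o t v s) (sweep p t v D)
  sweep-dominated o t zero    d = d
  sweep-dominated o t (suc v) d with o v t
  ... | true  = branch-take p (v , t) (sweep-dominated o t v d)
  ... | false = branch-skip p (v , t) (sweep-dominated o t v d)

  table-dominated : ∀ o T → Feasible o T → ∀ t → t ≤ T →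
                    Dominated p (select o n t) (table p n Δ t)
  table-dominated o T feas zero    _   = here (same-refl p , z≤n)
  table-dominated o T feas (suc t) t<T =
    prune-dominated p (All.map (λ {e} → serve e) (feas t t<T))
      (sweep-dominated o (suc t) n (table-dominated o T feas t (<⇒≤ t<T)))
    where
    serve : ∀ e → FeasibleAt o t e → Served (2 + t ∸ Δ) (suc t) (select o n (suc t)) e
    serve e f act with 1 ≤? 2 + t ∸ Δ
    -- The window would begin before time 1; its start 0 is below every last cover.
    ... | no i≡0 = ≤-trans (≤-reflexive (n<1⇒n≡0 (≰⇒> i≡0))) z≤n
    ... | yes 1≤ with f 1≤ act
    ...   | a , g , oa , c , i≤ = ≤-trans i≤ (lastCover-≥ e (select-complete o (suc t) g oa) c)

best-all : ∀ {P : List Appearance → Set} D → P [] → All P D → P (best D)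
best-all []      p[] []       = p[]
best-all {P} (s ∷ D) p[] (ps ∷ pD) = go D pD
  where
  go : ∀ D → All P D → P (foldr shorter s D)
  go []      []       = ps
  go (x ∷ D) (q ∷ qs) = shorter-all {P} x _ q (go D qs)

best-nonempty : ∀ {P : List Appearance → Set} {s} D → s ∈ D → All P D → P (best D)
best-nonempty {P} (s ∷ D) _ (ps ∷ pD) = go D pD
  where
  go : ∀ D → All P D → P (foldr shorter s D)
  go []      []       = ps
  go (x ∷ D) (q ∷ qs) = shorter-all {P} x _ q (go D qs)

best-≤ : ∀ {s} D → s ∈ D → length (best D) ≤ length s
best-≤ (s ∷ D) (here refl) = go D
  where
  go : ∀ D → length (foldr shorter s D) ≤ length s
  go []      = ≤-refl
  go (x ∷ D) = ≤-trans (shorter-≤ʳ x _) (go D)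
best-≤ {s} (x ∷ D) (there s∈) = go D s∈
  where
  go : ∀ D → s ∈ D → length (foldr shorter x D) ≤ length s
  go (y ∷ D) (here refl) = shorter-≤ˡ y _
  go (y ∷ D) (there s∈)  = ≤-trans (shorter-≤ʳ y _) (go D s∈)

best-dominated : ∀ p {s} D → Dominated p s D → length (best D) ≤ length s
best-dominated p D d = let (s′ , s′∈ , _ , le) = find d in ≤-trans (best-≤ D s′∈) le

-- Chopping and averaging over the shifts

Σ< : ℕ → (ℕ → ℕ) → ℕ
Σ< zero    f = 0
Σ< (suc n) f = f n + Σ< n f

Σ<-mono : ∀ n {f g : ℕ → ℕ} → (∀ r → r < n → f r ≤ g r) → Σ< n f ≤ Σ< n g
Σ<-mono zero    h = z≤n
Σ<-mono (suc n) h = +-mono-≤ (h n ≤-refl) (Σ<-mono n (λ r r<n → h r (m<n⇒m<1+n r<n)))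

Σ<-+ : ∀ n (f g : ℕ → ℕ) → Σ< n (λ r → f r + g r) ≡ Σ< n f + Σ< n g
Σ<-+ zero    f g = refl
Σ<-+ (suc n) f g = trans (cong (f n + g n +_) (Σ<-+ n f g))
  (solve 4 (λ a b c d → a :+ b :+ (c :+ d) := a :+ c :+ (b :+ d)) refl (f n) (g n) (Σ< n f) (Σ< n g))

Σ<-const : ∀ n c → Σ< n (λ _ → c) ≡ n * c
Σ<-const zero    c = refl
Σ<-const (suc n) c = cong (c +_) (Σ<-const n c)

Σ∈ : ∀ {A : Set} → (A → ℕ) → List A → ℕ
Σ∈ f []       = 0
Σ∈ f (x ∷ xs) = f x + Σ∈ f xs

Σ∈-mono : ∀ {A : Set} {f g : A → ℕ} xs → (∀ x → x ∈ xs → f x ≤ g x) → Σ∈ f xs ≤ Σ∈ g xs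
Σ∈-mono []       h = z≤n
Σ∈-mono (x ∷ xs) h = +-mono-≤ (h x (here refl)) (Σ∈-mono xs (λ y y∈ → h y (there y∈)))

Σ∈-+ : ∀ {A : Set} (f g : A → ℕ) xs → Σ∈ (λ x → f x + g x) xs ≡ Σ∈ f xs + Σ∈ g xs
Σ∈-+ f g []       = refl
Σ∈-+ f g (x ∷ xs) = trans (cong (f x + g x +_) (Σ∈-+ f g xs))
  (solve 4 (λ a b c d → a :+ b :+ (c :+ d) := a :+ c :+ (b :+ d)) refl (f x) (g x) (Σ∈ f xs) (Σ∈ g xs))

Σ∈-const : ∀ {A : Set} c (xs : List A) → Σ∈ (λ _ → c) xs ≡ length xs * c
Σ∈-const c []       = refl
Σ∈-const c (x ∷ xs) = cong (c +_) (Σ∈-const c xs)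

Σ∈-zero : ∀ {A : Set} (xs : List A) → Σ∈ (λ _ → 0) xs ≡ 0
Σ∈-zero xs = trans (Σ∈-const 0 xs) (*-zeroʳ (length xs))

Σ∈-* : ∀ {A : Set} c (f : A → ℕ) xs → Σ∈ (λ x → c * f x) xs ≡ c * Σ∈ f xs
Σ∈-* c f []       = sym (*-zeroʳ c)
Σ∈-* c f (x ∷ xs) = trans (cong (c * f x +_) (Σ∈-* c f xs)) (sym (*-distribˡ-+ c (f x) _))

Σ∈-swap : ∀ {A B : Set} (f : A → B → ℕ) xs ys →
          Σ∈ (λ x → Σ∈ (f x) ys) xs ≡ Σ∈ (λ y → Σ∈ (λ x → f x y) xs) ys
Σ∈-swap f []       ys = sym (Σ∈-zero ys)
Σ∈-swap f (x ∷ xs) ys =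
  trans (cong (Σ∈ (f x) ys +_) (Σ∈-swap f xs ys)) (sym (Σ∈-+ (f x) _ ys))

Σ<-Σ∈-swap : ∀ {B : Set} (f : ℕ → B → ℕ) n ys →
             Σ< n (λ r → Σ∈ (f r) ys) ≡ Σ∈ (λ y → Σ< n (λ r → f r y)) ys
Σ<-Σ∈-swap f zero    ys = sym (Σ∈-zero ys)
Σ<-Σ∈-swap f (suc n) ys =
  trans (cong (Σ∈ (f n) ys +_) (Σ<-Σ∈-swap f n ys)) (sym (Σ∈-+ (f n) _ ys))

𝟙-mono : ∀ {A B : Set} (a? : Dec A) (b? : Dec B) → (A → B) → 𝟙 (does a?) ≤ 𝟙 (does b?)
𝟙-mono (no _)  b?      f = z≤n
𝟙-mono (yes a) (yes b) f = ≤-refl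
𝟙-mono (yes a) (no ¬b) f = contradiction (f a) ¬b

𝟙-yes : ∀ {A : Set} (a? : Dec A) → A → 𝟙 (does a?) ≡ 1
𝟙-yes a? a = cong 𝟙 (dec-true a? a)

𝟙-no : ∀ {A : Set} (a? : Dec A) → ¬ A → 𝟙 (does a?) ≡ 0
𝟙-no a? ¬a = cong 𝟙 (dec-false a? ¬a)

𝟙-≤1 : ∀ b → 𝟙 b ≤ 1
𝟙-≤1 true  = ≤-refl
𝟙-≤1 false = z≤n

Σ<-indicator : ∀ k n → Σ< n (λ r → 𝟙 (does (r ≟ k))) ≤ 1
Σ<-indicator k n = go n
  where
  below : ∀ n → n ≤ k → Σ< n (λ r → 𝟙 (does (r ≟ k))) ≡ 0
  below zero    _   = refl
  below (suc n) n<k = cong₂ _+_ (𝟙-no (n ≟ k) (λ eq → <-irrefl eq n<k)) (below n (<⇒≤ n<k))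
  go : ∀ n → Σ< n (λ r → 𝟙 (does (r ≟ k))) ≤ 1
  go zero = z≤n
  go (suc n) with n ≟ k
  ... | yes refl rewrite below n ≤-refl = ≤-trans (≤-reflexive (+-identityʳ _)) (𝟙-≤1 _)
  ... | no n≢k rewrite 𝟙-no (n ≟ k) n≢k = go n

-- Counting the pieces met by a vertex

degree : ℕ → List Edge → ℕ
degree v = Σ∈ (λ e → 𝟙 (does (touches? v e)))

hit : ℕ → List Edge → ℕ
hit v p = 𝟙 (does (Any.any? (touches? v) p))

-- When a solution is restricted to the pieces, each appearance of `v` is copied this often.
hits : ℕ → List (List Edge) → ℕ
hits v = Σ∈ (hit v)

hit-∷ : ∀ v e p → ¬ Touches v e → hit v (e ∷ p) ≡ hit v p
hit-∷ v e p ¬t rewrite dec-false (touches? v e) ¬t = refl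

hit-here : ∀ v e p → Touches v e → hit v (e ∷ p) ≡ 1
hit-here v e p t rewrite dec-true (touches? v e) t = refl

hit-≤ : ∀ v e p → hit v (e ∷ p) ≤ 𝟙 (does (touches? v e)) + hit v p
hit-≤ v e p with touches? v e
... | yes t rewrite hit-here v e p t | dec-true (touches? v e) t = s≤s z≤n
... | no ¬t rewrite hit-∷ v e p ¬t = m≤n+m _ _

module _ (ℓ : ℕ) where

  pieces′ : Chopped → List (List Edge)
  pieces′ (_ , p , ps) = p ∷ ps

  grow-hits-≤ : ∀ v e c → hits v (pieces′ (grow ℓ e c)) ≤ 𝟙 (does (touches? v e)) + hits v (pieces′ c)
  grow-hits-≤ v e (zero  , p , ps) =
    +-monoˡ-≤ (hit v p + hits v ps) (≤-trans (hit-≤ v e []) (≤-reflexive (+-identityʳ (𝟙 (does (touches? v e))))))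
  grow-hits-≤ v e (suc k , p , ps) =
    ≤-trans (+-monoˡ-≤ (hits v ps) (hit-≤ v e p))
            (≤-reflexive (+-assoc (𝟙 (does (touches? v e))) (hit v p) (hits v ps)))

  -- Every edge is put into exactly one piece, so a vertex meets no more pieces than edges.
  chop-hits-≤ : ∀ v r es → hits v (pieces ℓ r es) ≤ degree v es
  chop-hits-≤ v r []       = z≤n
  chop-hits-≤ v r (e ∷ es) =
    ≤-trans (grow-hits-≤ v e (chop ℓ r es)) (+-monoʳ-≤ _ (chop-hits-≤ v r es))

  grow-hits-skip : ∀ v e c → ¬ Touches v e → hits v (pieces′ (grow ℓ e c)) ≤ hits v (pieces′ c)
  grow-hits-skip v e c ¬t =
    subst (λ z → hits v (pieces′ (grow ℓ e c)) ≤ z + hits v (pieces′ c)) (𝟙-no (touches? v e) ¬t)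
          (grow-hits-≤ v e c)

  counter : ℕ → List Edge → ℕ
  counter r es = proj₁ (chop ℓ r es)

  counter-≤ : ∀ {r} es → r ≤ ℓ → counter r es ≤ ℓ
  counter-≤ []       r≤ = r≤
  counter-≤ {r} (e ∷ es) r≤ with chop ℓ r es | counter-≤ es r≤
  ... | zero  , _ , _ | _   = ≤-refl
  ... | suc k , _ , _ | k<ℓ = <⇒≤ k<ℓ

  -- Distinct shifts have distinct counters.
  counter-count : ∀ es k → k ≤ ℓ → Σ< (suc ℓ) (λ r → 𝟙 (does (counter r es ≟ k))) ≤ 1
  counter-count []       k _   = Σ<-indicator k (suc ℓ)
  counter-count (e ∷ es) k k≤ℓ with k ≟ ℓ
  -- A counter `ℓ` arises only when a piece is opened, thus from counter 0; any other `k` arises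
  -- only from `suc k`. Either way a single earlier value has to be counted.
  ... | yes refl = ≤-trans (Σ<-mono (suc ℓ) (λ r r< →
                             𝟙-mono (counter r (e ∷ es) ≟ ℓ) (counter r es ≟ 0) (wrapped r r<)))
                           (counter-count es 0 z≤n)
    where
    wrapped : ∀ r → r < suc ℓ → counter r (e ∷ es) ≡ ℓ → counter r es ≡ 0
    wrapped r (s≤s r≤) eq with chop ℓ r es | counter-≤ es r≤
    ... | zero  , _ , _ | _   = refl
    ... | suc j , _ , _ | j<ℓ = contradiction j<ℓ (<-irrefl eq)
  ... | no k≢ℓ = ≤-trans (Σ<-mono (suc ℓ) (λ r _ →
                             𝟙-mono (counter r (e ∷ es) ≟ k) (counter r es ≟ suc k) (stepped r)))
                         (counter-count es (suc k) (≤∧≢⇒< k≤ℓ k≢ℓ))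
    where
    stepped : ∀ r → counter r (e ∷ es) ≡ k → counter r es ≡ suc k
    stepped r eq with chop ℓ r es
    ... | zero  , _ , _ = contradiction (sym eq) k≢ℓ
    ... | suc j , _ , _ = cong suc eq

  -- The edges of es at v are at most two, and neighbours in es.
  data Local (v : ℕ) : List Edge → Set where
    none : ∀ {es} → degree v es ≡ 0 → Local v es
    one  : ∀ {e es} → Touches v e → degree v es ≡ 0 → Local v (e ∷ es)
    two  : ∀ {e f es} → Touches v e → Touches v f → degree v es ≡ 0 → Local v (e ∷ f ∷ es)
    skip : ∀ {e es} → ¬ Touches v e → Local v es → Local v (e ∷ es)

  -- The neighbouring edges `e` and `f` fall into one piece unless the piece of `f` is full, which
  -- is counter 0.
  chop-hits-two : ∀ v r e f es → Touches v e → Touches v f → degree v es ≡ 0 →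
                  hits v (pieces ℓ r (e ∷ f ∷ es)) ≤ 1 + 𝟙 (does (counter r (f ∷ es) ≟ 0))
  chop-hits-two v r e f es te tf d with chop ℓ r es | chop-hits-≤ v r es
  ... | c | h0 with grow ℓ f c in eq | grow-hits-≤ v f c
  ... | zero  , p , ps | h = begin
    hit v (e ∷ []) + (hit v p + hits v ps)  ≤⟨ +-mono-≤ (𝟙-≤1 (does (Any.any? (touches? v) (e ∷ [])))) (begin
      hit v p + hits v ps                            ≤⟨ h ⟩
      𝟙 (does (touches? v f)) + hits v (pieces′ c)   ≤⟨ +-mono-≤ (𝟙-≤1 (does (touches? v f))) (≤-trans h0 (≤-reflexive d)) ⟩
      1                                              ∎) ⟩
    2                                       ∎
    where open ≤-Reasoning
  ... | suc k , p , ps | h = begin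
    hit v (e ∷ p) + hits v ps   ≤⟨ +-mono-≤ (𝟙-≤1 (does (Any.any? (touches? v) (e ∷ p))))
                                            (later c eq (≤-trans h0 (≤-reflexive d))) ⟩
    1                           ∎
    where
    open ≤-Reasoning
    later : ∀ c → grow ℓ f c ≡ (suc k , p , ps) → hits v (pieces′ c) ≤ 0 → hits v ps ≤ 0
    later (zero  , p , ps) refl h = h
    later (suc _ , p , ps) refl h = ≤-trans (m≤n+m _ (hit v p)) h

  -- Every shift contributes at most 1, except that a shift with its cut at `v` contributes at most
  -- 2, and by `counter-count` at most one shift cuts there. Averaged over the `suc ℓ` shifts this
  -- is the factor 1 + 1/(ℓ + 1).
  local-hits : ∀ {v es} → Local v es → Σ< (suc ℓ) (λ r → hits v (pieces ℓ r es)) ≤ 2 + ℓ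
  local-hits {v} {es} (none d) = begin
    Σ< (suc ℓ) (λ r → hits v (pieces ℓ r es))  ≤⟨ Σ<-mono (suc ℓ) (λ r _ → ≤-trans (chop-hits-≤ v r es) (≤-reflexive d)) ⟩
    Σ< (suc ℓ) (λ _ → 0)                       ≡⟨ trans (Σ<-const (suc ℓ) 0) (*-zeroʳ (suc ℓ)) ⟩
    0                                          ≤⟨ z≤n ⟩
    2 + ℓ                                      ∎
    where open ≤-Reasoning
  local-hits {v} {e ∷ es} (one t d) = begin
    Σ< (suc ℓ) (λ r → hits v (pieces ℓ r (e ∷ es)))
      ≤⟨ Σ<-mono (suc ℓ) (λ r _ → ≤-trans (chop-hits-≤ v r (e ∷ es))
           (+-mono-≤ (𝟙-≤1 (does (touches? v e))) (≤-reflexive d))) ⟩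
    Σ< (suc ℓ) (λ _ → 1)  ≡⟨ trans (Σ<-const (suc ℓ) 1) (*-identityʳ (suc ℓ)) ⟩
    1 + ℓ                 ≤⟨ n≤1+n _ ⟩
    2 + ℓ                 ∎
    where open ≤-Reasoning
  local-hits {v} {e ∷ f ∷ es} (two te tf d) = begin
    Σ< (suc ℓ) (λ r → hits v (pieces ℓ r (e ∷ f ∷ es)))
      ≤⟨ Σ<-mono (suc ℓ) (λ r _ → chop-hits-two v r e f es te tf d) ⟩
    Σ< (suc ℓ) (λ r → 1 + 𝟙 (does (counter r (f ∷ es) ≟ 0)))
      ≡⟨ Σ<-+ (suc ℓ) (λ _ → 1) _ ⟩
    Σ< (suc ℓ) (λ _ → 1) + Σ< (suc ℓ) (λ r → 𝟙 (does (counter r (f ∷ es) ≟ 0)))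
      ≤⟨ +-mono-≤ (≤-reflexive (trans (Σ<-const (suc ℓ) 1) (*-identityʳ (suc ℓ))))
                  (counter-count (f ∷ es) 0 z≤n) ⟩
    suc ℓ + 1  ≡⟨ +-comm (suc ℓ) 1 ⟩
    2 + ℓ      ∎
    where open ≤-Reasoning
  local-hits {v} {e ∷ es} (skip ¬t l) =
    ≤-trans (Σ<-mono (suc ℓ) (λ r _ → grow-hits-skip v e (chop ℓ r es) ¬t)) (local-hits l)

  -- For the start of a cycle: its two edges are at opposite ends of the walk and may lie in
  -- different pieces for every shift. The excess `ℓ` over the bound of `local-hits` is charged to
  -- its appearances.
  double-hits : ∀ {v es} → degree v es ≤ 2 → Σ< (suc ℓ) (λ r → hits v (pieces ℓ r es)) ≤ 2 + ℓ + ℓ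
  double-hits {v} {es} d = begin
    Σ< (suc ℓ) (λ r → hits v (pieces ℓ r es))  ≤⟨ Σ<-mono (suc ℓ) (λ r _ → ≤-trans (chop-hits-≤ v r es) d) ⟩
    Σ< (suc ℓ) (λ _ → 2)                       ≡⟨ Σ<-const (suc ℓ) 2 ⟩
    suc ℓ * 2                                  ≡⟨ solve 1 (λ l → (con 1 :+ l) :* con 2 := con 2 :+ l :+ l) refl ℓ ⟩
    2 + ℓ + ℓ                                  ∎
    where open ≤-Reasoning

  chop-all : ∀ k es → chop ℓ (k + length es) es ≡ (k , es , [])
  chop-all k []       = cong (_, [] , []) (+-identityʳ k)
  chop-all k (e ∷ es) rewrite +-suc k (length es) | chop-all (suc k) es = refl

  grow-∈ : ∀ {e f} c → ∃[ p ] (p ∈ pieces′ c × e ∈ p) → ∃[ p ] (p ∈ pieces′ (grow ℓ f c) × e ∈ p)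
  grow-∈ (zero  , p , ps) (q , q∈ , e∈)         = q , there q∈ , e∈
  grow-∈ (suc k , p , ps) (q , here refl , e∈)  = _ , here refl , there e∈
  grow-∈ (suc k , p , ps) (q , there q∈ , e∈)   = q , there q∈ , e∈

  chop-∈ : ∀ r {es e} → e ∈ es → ∃[ p ] (p ∈ pieces ℓ r es × e ∈ p)
  chop-∈ r {f ∷ es} (there e∈)  = grow-∈ (chop ℓ r es) (chop-∈ r e∈)
  chop-∈ r {f ∷ es} (here refl) with chop ℓ r es
  ... | zero  , p , ps = f ∷ [] , here refl , here refl
  ... | suc k , p , ps = f ∷ p , here refl , here refl

  chop-length : ∀ r es → r ≤ ℓ → All (λ p → length p ≤ suc ℓ) (pieces ℓ r es)
  chop-length r es r≤ = go es
    where
    -- The first piece still has room for the number of edges given by the counter.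
    room : ∀ es → proj₁ (chop ℓ r es) + length (proj₁ (proj₂ (chop ℓ r es))) ≤ suc ℓ ×
                  All (λ p → length p ≤ suc ℓ) (proj₂ (proj₂ (chop ℓ r es)))
    room [] = ≤-trans (≤-reflexive (+-identityʳ r)) (m≤n⇒m≤1+n r≤) , []
    room (e ∷ es) with chop ℓ r es | room es
    ... | zero  , p , ps | l , ls = ≤-reflexive (+-comm ℓ 1) , l ∷ ls
    ... | suc k , p , ps | l , ls = ≤-trans (≤-reflexive (+-suc k _)) l , ls
    go : ∀ es → All (λ p → length p ≤ suc ℓ) (pieces ℓ r es)
    go es with chop ℓ r es | room es
    ... | k , p , ps | l , ls = ≤-trans (m≤n+m _ k) l ∷ ls

  chop-⊆ : ∀ r es → All (All (_∈ es)) (pieces ℓ r es)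
  chop-⊆ r []       = [] ∷ []
  chop-⊆ r (e ∷ es) with chop ℓ r es | chop-⊆ r es
  ... | zero  , p , ps | h      = (here refl ∷ []) ∷ All.map (All.map there) h
  ... | suc k , p , ps | h ∷ hs = (here refl ∷ All.map there h) ∷ All.map (All.map there) hs

  chop-count : ∀ r es → length (pieces ℓ r es) ≤ suc (length es)
  chop-count r []       = ≤-refl
  chop-count r (e ∷ es) with chop ℓ r es | chop-count r es
  ... | zero  , p , ps | h = s≤s h
  ... | suc k , p , ps | h = m≤n⇒m≤1+n h

-- The walk along a path or a cycle

toFront-↭ : ∀ x es → toFront x es ↭ es
toFront-↭ x []       = ↭-refl
toFront-↭ x (e ∷ es) = if-elim (_↭ e ∷ es) (touches? x e) (λ _ → ↭-refl) (λ _ → go (toFront x es) (toFront-↭ x es))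
  where
  go : ∀ fs → fs ↭ es → elimL (e ∷ []) (λ f fs → f ∷ e ∷ fs) fs ↭ e ∷ es
  go []       p = ↭-prep e p
  go (f ∷ fs) p = ↭-trans (↭-swap f e ↭-refl) (↭-prep e p)

toFront-head : ∀ x {es f fs} → toFront x es ≡ f ∷ fs → Any (Touches x) es → Touches x f
toFront-head x {e ∷ es} {f} {fs} eq any =
  if-elim (λ gs → gs ≡ f ∷ fs → Touches x f) (touches? x e)
    (λ { t refl → t })
    (λ ¬t → go ¬t any (toFront x es) refl)
    eq
  where
  go : ¬ Touches x e → Any (Touches x) (e ∷ es) → ∀ gs → toFront x es ≡ gs →
       elimL (e ∷ []) (λ f fs → f ∷ e ∷ fs) gs ≡ f ∷ fs → Touches x f
  go ¬t (here t)  _        _  _    = contradiction t ¬t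
  go ¬t (there a) (g ∷ gs) eq refl = toFront-head x eq a
  go ¬t (there a) []       eq _    =
    contradiction (Any-resp-↭ (subst (es ↭_) eq (↭-sym (toFront-↭ x es))) a) λ()

degree-↭ : ∀ v {es fs} → es ↭ fs → degree v es ≡ degree v fs
degree-↭ v ↭.refl            = refl
degree-↭ v (↭.prep e p)      = cong (𝟙 (does (touches? v e)) +_) (degree-↭ v p)
degree-↭ v (↭.swap {ys = es} e f p) =
  trans (cong (λ d → 𝟙 (does (touches? v e)) + (𝟙 (does (touches? v f)) + d)) (degree-↭ v p))
  (solve 3 (λ a b c → a :+ (b :+ c) := b :+ (a :+ c)) refl
    (𝟙 (does (touches? v e))) (𝟙 (does (touches? v f))) (degree v es))
degree-↭ v (↭.trans p q)     = trans (degree-↭ v p) (degree-↭ v q)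

degree-++ : ∀ v es fs → degree v (es ++ fs) ≡ degree v es + degree v fs
degree-++ v []       fs = refl
degree-++ v (e ∷ es) fs = trans (cong (𝟙 (does (touches? v e)) +_) (degree-++ v es fs))
                                (sym (+-assoc (𝟙 (does (touches? v e))) (degree v es) (degree v fs)))

degree-touch : ∀ v e es → Touches v e → degree v (e ∷ es) ≡ suc (degree v es)
degree-touch v e es t = cong (_+ degree v es) (𝟙-yes (touches? v e) t)

degree-skip : ∀ v e es → ¬ Touches v e → degree v (e ∷ es) ≡ degree v es
degree-skip v e es ¬t = cong (_+ degree v es) (𝟙-no (touches? v e) ¬t)

degree-∈ : ∀ {v e es} → e ∈ es → Touches v e → 1 ≤ degree v es
degree-∈ {v} {e} {f ∷ es} (here refl) t = subst (1 ≤_) (sym (degree-touch v e es t)) (s≤s z≤n)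
degree-∈ {v} {e} {f ∷ es} (there e∈)  t = ≤-trans (degree-∈ e∈ t) (m≤n+m _ _)

degree-1-local : ∀ ℓ v es → degree v es ≤ 1 → Local ℓ v es
degree-1-local ℓ v []       _ = none refl
degree-1-local ℓ v (e ∷ es) d with touches? v e
... | yes t = one t (n<1⇒n≡0 (≤-trans (≤-reflexive (sym (degree-touch v e es t))) d))
... | no ¬t = skip ¬t (degree-1-local ℓ v es (≤-trans (≤-reflexive (sym (degree-skip v e es ¬t))) d))

remaining : Walk → List Edge
remaining (_ , done , rest) = done ++ rest

step-↭ : ∀ w → remaining (step w) ↭ remaining w
step-↭ (x , done , rest) with toFront x rest | toFront-↭ x rest
... | []     | p = ↭-refl
... | e ∷ es | p = ↭-trans (↭-sym (shift e done es)) (++⁺ˡ done p)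

steps-↭ : ∀ k w → remaining (steps k w) ↭ remaining w
steps-↭ zero    w = ↭-refl
steps-↭ (suc k) w = ↭-trans (step-↭ (steps k w)) (steps-↭ k w)

step-length : ∀ x done rest → 1 ≤ length rest →
              length (proj₁ (proj₂ (step (x , done , rest)))) ≡ suc (length done)
step-length x done rest 1≤ with toFront x rest | ↭-length (toFront-↭ x rest)
... | []     | eq = contradiction (subst (1 ≤_) (sym eq) 1≤) λ()
... | e ∷ es | eq = refl

steps-length : ∀ x es k → k ≤ length es → length (proj₁ (proj₂ (steps k (x , [] , es)))) ≡ k
steps-length x es zero    _   = refl
steps-length x es (suc k) k<n with steps k (x , [] , es) | steps-length x es k (<⇒≤ k<n)
                                | steps-↭ k (x , [] , es)
... | y , done , rest | eq | p = trans (step-length y done rest (+-cancelˡ-≤ k _ _ (begin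
      k + 1                        ≡⟨ +-comm k 1 ⟩
      suc k                        ≤⟨ k<n ⟩
      length es                    ≡⟨ ↭-length p ⟨
      length (done ++ rest)        ≡⟨ length-++ done ⟩
      length done + length rest    ≡⟨ cong (_+ length rest) eq ⟩
      k + length rest              ∎))) (cong suc eq)
  where open ≤-Reasoning

steps-rest : ∀ x es → proj₂ (proj₂ (steps (length es) (x , [] , es))) ≡ []
steps-rest x es with steps (length es) (x , [] , es) | steps-length x es (length es) ≤-refl
                     | steps-↭ (length es) (x , [] , es)
... | y , done , []       | eq | p = refl
... | y , done , (e ∷ es′) | eq | p =
  contradiction (trans (sym (length-++ done)) (trans (↭-length p) (sym eq)))
                (λ eq′ → m+1+n≢m (length done) eq′)

walk-↭ : ∀ x es → walk x es ↭ es
walk-↭ x es with steps (length es) (x , [] , es) | steps-rest x es | steps-↭ (length es) (x , [] , es)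
... | y , done , .[] | refl | p = ↭-trans (↭-sym (++-identityʳ-↭ done)) p
  where
  ++-identityʳ-↭ : (fs : List Edge) → fs ++ [] ↭ fs
  ++-identityʳ-↭ fs = ↭-reflexive (++-identityʳ fs)

other-touches : ∀ x e → Touches x e → Touches (other x e) e
other-touches x e@((u , w) , _) t =
  if-elim (λ y → Touches y e) (x ≟ u) (λ _ → inj₂ refl) (λ _ → inj₁ refl)

other-≢ : ∀ x e → proj₁ (proj₁ e) ≢ proj₂ (proj₁ e) → x ≢ other x e
other-≢ x ((u , w) , _) u≢w =
  if-elim (λ y → x ≢ y) (x ≟ u) (λ { refl → u≢w }) id

other-only : ∀ x e v → Touches x e → Touches v e → v ≡ x ⊎ v ≡ other x e
other-only x ((u , w) , _) v = if-elim (λ y → x ≡ u ⊎ x ≡ w → v ≡ u ⊎ v ≡ w → v ≡ x ⊎ v ≡ y) (x ≟ u)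
  (λ { refl _ (inj₁ p) → inj₁ p ; refl _ (inj₂ p) → inj₂ p })
  (λ { x≢u (inj₁ p) _ → contradiction p x≢u ; _ (inj₂ refl) (inj₁ p) → inj₂ p
     ; _ (inj₂ refl) (inj₂ p) → inj₁ p })

-- In a connected graph of maximum degree 2 the walk from x₀ gets stuck only when all
-- edges are used, provided that x₀ is an end or there are no ends.
module _ (ℓ : ℕ) (es : List Edge) (x₀ : ℕ)
         (degree-≤2 : ∀ v → degree v es ≤ 2)
         (loopless : ∀ {e} → e ∈ es → proj₁ (proj₁ e) ≢ proj₂ (proj₁ e))
         (connected : ∀ (P : ℕ → Set) →
                      (∀ {e} → e ∈ es → ∀ {v w} → Touches v e → Touches w e → P v → P w) →
                      P x₀ → ∀ {e} → e ∈ es → ∀ {v} → Touches v e → P v)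
         (ends : degree x₀ es ≤ 1 ⊎ (∀ {e v} → e ∈ es → Touches v e → degree v es ≡ 2))
  where

  -- The walk has just entered `x` for the first time, by the latest edge.
  Reached : ℕ → List Edge → Set
  Reached x done = ∃[ e ] ∃[ fs ] (done ≡ e ∷ fs × Touches x e × degree x fs ≡ 0)

  -- The vertex `x₀` is exempt from `others` because the walk along a cycle returns to it, with its
  -- two edges at opposite ends of the list. Every other vertex except the current one is untouched
  -- or finished: its traversed edges are next to each other and none is to come.
  record Progress (w : Walk) : Set where
    private
      x = proj₁ w
      done = proj₁ (proj₂ w)
      rest = proj₂ (proj₂ w)
    field
      split   : done ++ rest ↭ es
      current : x ≡ x₀ ⊎ Reached x done
      start   : x ≡ x₀ × done ≡ [] ⊎ 1 ≤ degree x₀ done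
      others  : ∀ v → v ≢ x₀ → v ≢ x → degree v done ≡ 0 ⊎ Local ℓ v done × degree v rest ≡ 0

    degree-split : ∀ v → degree v done + degree v rest ≡ degree v es
    degree-split v = trans (sym (degree-++ v done rest)) (degree-↭ v split)

    rest-⊆ : ∀ {e} → e ∈ rest → e ∈ es
    rest-⊆ e∈ = ∈-resp-↭ split (∈-++⁺ʳ done e∈)

    done-⊆ : ∀ {e} → e ∈ done → e ∈ es
    done-⊆ e∈ = ∈-resp-↭ split (∈-++⁺ˡ e∈)

    Visited : ℕ → Set
    Visited v = v ≡ x₀ ⊎ 1 ≤ degree v done

    module _ (stuck : ¬ Any (Touches x) rest) where

      x-unused : degree x rest ≡ 0
      x-unused = go rest stuck
        where
        go : ∀ fs → ¬ Any (Touches x) fs → degree x fs ≡ 0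
        go []       _  = refl
        go (f ∷ fs) ¬a = trans (degree-skip x f fs (¬a ∘ here)) (go fs (¬a ∘ there))

      -- Suppose the walk is stuck at an entered vertex `x` while `x₀` has an edge left. As `x₀` has
      -- a traversed edge too, it is no end; and without ends `x` has degree 2, although its only
      -- edge is the one by which it was entered.
      start-unused : ∀ {e} → e ∈ rest → ¬ Touches x₀ e
      start-unused {e} e∈ t with current
      ... | inj₁ refl = stuck (lose e∈ t)
      ... | inj₂ (f , fs , refl , tf , d) = go start ends
        where
        go : x ≡ x₀ × done ≡ [] ⊎ 1 ≤ degree x₀ done →
             degree x₀ es ≤ 1 ⊎ (∀ {e v} → e ∈ es → Touches v e → degree v es ≡ 2) → ⊥
        go (inj₁ (refl , _)) _         = stuck (lose e∈ t)
        go (inj₂ 1≤) (inj₁ end)    =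
          <⇒≱ (≤-trans (+-mono-≤ 1≤ (degree-∈ e∈ t)) (≤-reflexive (degree-split x₀))) end
        go (inj₂ 1≤) (inj₂ no-end) = contradiction
          (trans (sym (no-end (done-⊆ (here refl)) tf)) (sym (degree-split x)))
          (λ eq → contradiction (trans eq (cong₂ _+_ (trans (degree-touch x f fs tf) (cong suc d)) x-unused)) λ())

      visited-unused : ∀ {e v} → e ∈ rest → Touches v e → ¬ Visited v
      visited-unused {e} {v} e∈ t vis with v ≟ x₀
      ... | yes refl = start-unused e∈ t
      ... | no v≢x₀ with v ≟ x | vis
      ...   | yes refl | _ = stuck (lose e∈ t)
      ...   | no v≢x | inj₁ eq = v≢x₀ eq
      ...   | no v≢x | inj₂ 1≤ with others v v≢x₀ v≢x
      ...     | inj₁ d = contradiction (subst (1 ≤_) d 1≤) λ()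
      ...     | inj₂ (_ , d) = contradiction (subst (1 ≤_) d (degree-∈ e∈ t)) λ()

      -- No remaining edge has a visited endpoint, so being visited is closed under edges; by
      -- connectedness it reaches the ends of `e`, a contradiction.
      stuck⇒done : ∀ {e} → ¬ e ∈ rest
      stuck⇒done {e} e∈ = visited-unused e∈ (inj₁ refl)
        (connected Visited closed (inj₁ refl) (rest-⊆ e∈) (inj₁ refl))
        where
        closed : ∀ {e} → e ∈ es → ∀ {v w} → Touches v e → Touches w e → Visited v → Visited w
        closed e∈ tv tw vis with ∈-++⁻ done (∈-resp-↭ (↭-sym split) e∈)
        ... | inj₁ e∈done = inj₂ (degree-∈ e∈done tw)
        ... | inj₂ e∈rest = contradiction vis (visited-unused e∈rest tv)

  open Progress

  step-progress : ∀ w → Progress w → Progress (step w)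
  step-progress w@(x , done , rest) P with toFront x rest in eq | toFront-↭ x rest
  ... | []     | _ = P
  ... | e ∷ fs | p = record
    { split   = ↭-trans (↭-sym (shift e done fs)) (↭-trans (++⁺ˡ done p) (split P))
    ; current = current′
    ; start   = inj₂ (start′ (start P))
    ; others  = others′
    }
    where
    e∈rest : e ∈ rest
    e∈rest = ∈-resp-↭ p (here refl)
    x∈e : Touches x e
    x∈e with Any.any? (touches? x) rest
    ... | yes a  = toFront-head x eq a
    -- Otherwise the walk would be stuck, and then no edge remains; but `e` does.
    ... | no ¬a  = contradiction e∈rest (stuck⇒done P ¬a)
    y = other x e
    x≢y : x ≢ y
    x≢y = other-≢ x e (loopless (rest-⊆ P e∈rest))
    degree-rest : ∀ v → degree v rest ≡ degree v (e ∷ fs)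
    degree-rest v = sym (degree-↭ v p)

    current′ : y ≡ x₀ ⊎ Reached y (e ∷ done)
    current′ with y ≟ x₀
    ... | yes y≡x₀ = inj₁ y≡x₀
    ... | no y≢x₀ with others P y y≢x₀ (x≢y ∘ sym)
    ...   | inj₁ d = inj₂ (e , done , refl , other-touches x e x∈e , d)
    ...   | inj₂ (_ , d) = contradiction (subst (1 ≤_) d (degree-∈ e∈rest (other-touches x e x∈e))) λ()

    start′ : x ≡ x₀ × done ≡ [] ⊎ 1 ≤ degree x₀ done → 1 ≤ degree x₀ (e ∷ done)
    start′ (inj₁ (refl , _)) = degree-∈ {es = e ∷ done} (here refl) x∈e
    start′ (inj₂ 1≤)         = ≤-trans 1≤ (m≤n+m _ (𝟙 (does (touches? x₀ e))))

    others′ : ∀ v → v ≢ x₀ → v ≢ y → degree v (e ∷ done) ≡ 0 ⊎ Local ℓ v (e ∷ done) × degree v fs ≡ 0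
    others′ v v≢x₀ v≢y with v ≟ x
    others′ v v≢x₀ v≢y | yes refl with current P
    ... | inj₁ eq = contradiction eq v≢x₀
    -- The edge `f` led to `x` and `e` leads on, so they are neighbours in the list; as the degree
    -- of `x` is at most 2, no edge at `x` remains.
    ... | inj₂ (f , gs , refl , tf , d) = inj₂ (two x∈e tf d , n≤0⇒n≡0 (ℕ.s≤s⁻¹ (ℕ.s≤s⁻¹ (begin
        2 + degree x fs                               ≡⟨ cong₂ _+_ (cong suc d) (degree-touch x e fs x∈e) ⟨
        suc (degree x gs) + degree x (e ∷ fs)         ≡⟨ cong₂ _+_ (degree-touch x f gs tf) (degree-rest x) ⟨
        degree x (f ∷ gs) + degree x rest             ≡⟨ degree-split P x ⟩
        degree x es                                   ≤⟨ degree-≤2 x ⟩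
        2                                             ∎))))
      where open ≤-Reasoning
    others′ v v≢x₀ v≢y | no v≢x with others P v v≢x₀ v≢x
    ... | inj₁ d = inj₁ (trans (degree-skip v e done v∉e) d)
      where
      v∉e : ¬ Touches v e
      v∉e t with other-only x e v x∈e t
      ... | inj₁ p = v≢x p
      ... | inj₂ p = v≢y p
    ... | inj₂ (l , d) = inj₂ (skip v∉e l , m+n≡0⇒n≡0 (𝟙 (does (touches? v e))) (trans (sym (degree-rest v)) d))
      where
      v∉e : ¬ Touches v e
      v∉e t with other-only x e v x∈e t
      ... | inj₁ p = v≢x p
      ... | inj₂ p = v≢y p

  steps-progress : ∀ k → Progress (steps k (x₀ , [] , es))
  steps-progress zero    = record
    { split = ↭-refl ; current = inj₁ refl ; start = inj₁ (refl , refl) ; others = λ _ _ _ → inj₁ refl }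
  steps-progress (suc k) = step-progress _ (steps-progress k)

  walk-local : ∀ v → v ≢ x₀ → Local ℓ v (walk x₀ es)
  walk-local v v≢x₀ with steps (length es) (x₀ , [] , es) | steps-progress (length es)
  ... | x , done , rest | P with v ≟ x
  ...   | no v≢x with others P v v≢x₀ v≢x
  ...     | inj₁ d       = none d
  ...     | inj₂ (l , _) = l
  walk-local v v≢x₀ | x , done , rest | P | yes refl with current P
  ...     | inj₁ eq = contradiction eq v≢x₀
  ...     | inj₂ (e , fs , refl , t , d) = one t d

-- Sizes of the intermediate results

tails-∈ : ∀ {A : Set} {P : A → List A → Set} xs → (∀ x ys → x ∈ xs → P x ys) → Tails P xs
tails-∈ []       f = []
tails-∈ (x ∷ xs) f = f x xs (here refl) ∷ tails-∈ xs (λ y ys y∈ → f y ys (there y∈))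

-- A recursion visits every tail of its list, so an invariant inherited by tails yields the
-- condition at each iteration.
tails-inv : ∀ {A : Set} {P : A → List A → Set} (Q : List A → Set) →
            (∀ x ys → Q (x ∷ ys) → P x ys × Q ys) → ∀ xs → Q xs → Tails P xs
tails-inv Q f []       q = []
tails-inv Q f (x ∷ xs) q = let p , q′ = f x xs q in p ∷ tails-inv Q f xs q′

merge-length : ∀ s s′ → length (merge s s′) ≤ length s + length s′
merge-length []      s′ = ≤-refl
merge-length (a ∷ s) s′ = if-elim (λ z → length z ≤ suc (length s + length s′)) (a ∈ᴬ? merge s s′)
  (λ _ → m≤n⇒m≤1+n (merge-length s s′)) (λ _ → s≤s (merge-length s s′))

solve-length-≤ : ∀ n Δ T (f : List Edge → ℕ) ps → All (λ p → length (best (table p n Δ T)) ≤ f p) ps →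
                 length (solve-pieces n Δ T ps) ≤ Σ∈ f ps
solve-length-≤ n Δ T f []       []       = z≤n
solve-length-≤ n Δ T f (p ∷ ps) (b ∷ bs) =
  ≤-trans (merge-length (best (table p n Δ T)) _) (+-mono-≤ b (solve-length-≤ n Δ T f ps bs))

steps-short : ∀ k x es → length (proj₂ (proj₂ (steps k (x , [] , es)))) ≤ length es
steps-short k x es with steps k (x , [] , es) | steps-↭ k (x , [] , es)
... | _ , done , rest | p = ≤-trans (m≤n+m _ (length done))
  (≤-reflexive (trans (sym (length-++ done)) (↭-length p)))

module _ (M : ℕ) where

  Small : Edge → Set
  Small e = length (proj₂ e) ≤ M

  Short : List Appearance → Set
  Short s = length s ≤ M

  opaque
    unfolding leT
    ok-le : ∀ m n → OK M leT (m ∷ n ∷ [])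
    ok-le m n = _

  opaque
    unfolding eqT
    ok-eq : ∀ m n → OK M eqT (m ∷ n ∷ [])
    ok-eq m n = (_ , ok-le m n) , (_ , ok-le n m) , _

  opaque
    unfolding maxT
    ok-max : ∀ m n → OK M maxT (m ∷ n ∷ [])
    ok-max m n = (_ , ok-le m n) , _

  opaque
    unfolding memT
    ok-mem : ∀ x xs → length xs ≤ M → OK M memT (x ∷ xs ∷ [])
    ok-mem x xs l = _ , _ , l , tails-∈ xs (λ y ys _ → (_ , ok-eq x y) , _)

  opaque
    unfolding touchT
    ok-touch : ∀ v e → OK M touchT (v ∷ e ∷ [])
    ok-touch v e = (_ , ok-eq v _) , _ , (_ , ok-eq v _)

  opaque
    unfolding coverT
    ok-cover : ∀ e a → Small e → OK M coverT (e ∷ a ∷ [])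
    ok-cover e a l = (_ , ok-touch _ e) , (_ , ok-mem _ _ l) , _

  opaque
    unfolding lastCoverT
    ok-lastCover : ∀ e s → Small e → Short s → OK M lastCoverT (e ∷ s ∷ [])
    ok-lastCover e s le ls = _ , _ , ls ,
      tails-∈ s (λ a _ _ → (_ , ok-cover e a le) , (_ , ok-max _ _) , _)

  opaque
    unfolding activeT
    ok-active : ∀ i t e → Small e → OK M activeT (i ∷ t ∷ e ∷ [])
    ok-active i t e l = _ , _ , l ,
      tails-∈ (proj₂ e) (λ x _ _ → ((_ , ok-le i x) , (_ , ok-le x t) , _) , _)

  SmallPiece : List Edge → Set
  SmallPiece p = length p ≤ M × All Small p

  opaque
    unfolding acceptT
    ok-accept : ∀ i t s p → SmallPiece p → Short s → OK M acceptT (i ∷ t ∷ s ∷ p ∷ [])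
    ok-accept i t s p (lp , sp) ls = _ , _ , lp , tails-∈ p (λ e _ e∈ →
      let se = All.lookup sp e∈ in
      ((_ , ok-active i t e se) , ((_ , (_ , ok-lastCover e s se ls) , _) , ok-le _ _) , _) , _)

  opaque
    unfolding sameT
    ok-same : ∀ p s s′ → SmallPiece p → Short s → Short s′ → OK M sameT (p ∷ s ∷ s′ ∷ [])
    ok-same p s s′ (lp , sp) ls ls′ = _ , _ , lp , tails-∈ p (λ e _ e∈ →
      let se = All.lookup sp e∈ in
      (((_ , ok-lastCover e s se ls) , (_ , ok-lastCover e s′ se ls′) , _) , ok-eq _ _) , _)

  opaque
    unfolding lengthT
    ok-length : ∀ s → Short s → OK M lengthT (s ∷ [])
    ok-length s l = _ , _ , l , tails-∈ s _

  opaque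
    unfolding shorterT
    ok-shorter : ∀ s s′ → Short s → Short s′ → OK M shorterT (s ∷ s′ ∷ [])
    ok-shorter s s′ l l′ = (((_ , ok-length s l) , (_ , ok-length s′ l′) , _) , ok-le _ _) , _

  opaque
    unfolding insertT
    ok-insert : ∀ p s D → SmallPiece p → Short s → All Short D → length D ≤ M →
                OK M insertT (p ∷ s ∷ D ∷ [])
    ok-insert p s D sp ls lD l = _ , _ , l , tails-∈ D (λ s′ _ s′∈ →
      let ls′ = All.lookup lD s′∈ in
      (_ , ok-same p s s′ sp ls ls′) , ((_ , ok-shorter s s′ ls ls′) , _) , _)

  Bounded : ℕ → ℕ → List Appearance → Set
  Bounded b m s = All (λ a → proj₂ a ≤ b) s × length s ≤ m

  opaque
    unfolding branchT
    -- The tables between two insertions consist of distinct classes as well, so `keys` bounds their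
    -- lengths too; `m < M` leaves room for the appearance that is added.
    ok-branch : ∀ p v t D b m → SmallPiece p → suc b ^ length p ≤ M → t ≤ b → m < M →
                Distinct p D → All (Bounded b m) D → OK M branchT (p ∷ (v , t) ∷ D ∷ [])
    ok-branch p v t D b m sp keys t≤b m<M dist bd = _ , _ , short-table dist bd ,
      tails-inv (λ D → Distinct p D × All (Bounded b m) D)
        (λ { s D (_ ∷ dist , (h , l) ∷ bd) →
             (let ok₁ , ok₂ = round s D h l dist bd (branch-run p (v , t) D)
              in (_ , _ , (_ , ok₁) , _) , ok₂) , dist , bd })
        D (dist , bd)
      where
      short-table : ∀ {D m} → Distinct p D → All (Bounded b m) D → length D ≤ M
      short-table dist bd = ≤-trans (distinct-length p b dist (All.map proj₁ bd)) keys

      grown : ∀ {D} → All (Bounded b m) D → All (Bounded b (suc m)) (branch p (v , t) D)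
      grown = branch-all p (λ (h , l) → h , m≤n⇒m≤1+n l) (λ (h , l) → t≤b ∷ h , s≤s l)

      short : ∀ {D} → All (Bounded b (suc m)) D → All Short D
      short = All.map (λ (_ , l) → ≤-trans l m<M)

      round : ∀ s D → All (λ a → proj₂ a ≤ b) s → length s ≤ m → Distinct p D → All (Bounded b m) D →
              ∀ {D′} → D′ ≡ branch p (v , t) D →
              OK M insertT (p ∷ s ∷ D′ ∷ []) ×
              OK M insertT (p ∷ ((v , t) ∷ s) ∷ run insertT (p ∷ s ∷ D′ ∷ []) ∷ [])
      round s D h l dist bd refl =
        ok-insert p s _ sp (≤-trans l (<⇒≤ m<M)) (short bd′) (short-table dist′ bd′) ,
        subst (λ D → OK M insertT (p ∷ ((v , t) ∷ s) ∷ D ∷ [])) (sym (insert-run p s (branch p (v , t) D)))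
          (ok-insert p ((v , t) ∷ s) _ sp (≤-trans (s≤s l) m<M) (short bd″)
                     (short-table (insert-distinct p s dist′) bd″))
        where
        dist′ : Distinct p (branch p (v , t) D)
        dist′ = branch-distinct p (v , t) dist
        bd′ : All (Bounded b (suc m)) (branch p (v , t) D)
        bd′ = grown bd
        bd″ : All (Bounded b (suc m)) (insert p s (branch p (v , t) D))
        bd″ = insert-all p {s = s} (h , m≤n⇒m≤1+n l) bd′

  opaque
    unfolding pruneT
    ok-prune : ∀ p i t D → SmallPiece p → All Short D → length D ≤ M →
               OK M pruneT (p ∷ i ∷ t ∷ D ∷ [])
    ok-prune p i t D sp lD l = _ , _ , l , tails-∈ D (λ s _ s∈ →
      (_ , ok-accept i t s p sp (All.lookup lD s∈)) , _)

  opaque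
    unfolding bestT
    ok-best : ∀ D → All Short D → length D ≤ M → OK M bestT (D ∷ [])
    ok-best []      _         l = _ , _ , λ _ _ ()
    ok-best (s ∷ D) (ls ∷ lD) l = _ , _ , λ { _ _ refl → _ , _ , ≤-trans (n≤1+n _) l ,
      tails-inv (All Short) (λ { x D (lx ∷ lD) → (_ , ok-shorter x _ lx (short D lD)) , lD }) D lD }
      where
      short : ∀ D → All Short D → Short (paraL s (λ x _ r → run shorterT (x ∷ r ∷ [])) D)
      short []      _         = ls
      short (x ∷ D) (lx ∷ lD) =
        subst Short (sym (shorter-run x _)) (shorter-all {Short} x _ lx (short D lD))

  module _ (p : List Edge) (n Δ T : ℕ) (sp : SmallPiece p) (keys : suc T ^ length p ≤ M)
           (n≤M : n ≤ M) (T≤M : T ≤ M) (grid≤M : T * n ≤ M) where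

    private
      bounded : ∀ {t₀ t m s} → t ≤ T → Partial p n Δ t₀ t m s → Bounded T m s
      bounded t≤T (g , l , _) = All.map (λ (_ , _ , u≤) → ≤-trans u≤ t≤T) g , l

      short-table : ∀ {t₀ t m D} → t ≤ T → Distinct p D → All (Partial p n Δ t₀ t m) D → length D ≤ M
      short-table t≤T dist ps =
        ≤-trans (distinct-length p T dist (All.map (proj₁ ∘ bounded t≤T) ps)) keys

    opaque
      unfolding sweepT
      ok-sweep : ∀ t → t < T → OK M sweepT (p ∷ suc t ∷ n ∷ table p n Δ t ∷ [])
      ok-sweep t t<T = _ , _ , n≤M , λ v v<n → _ , subst (λ D → OK M branchT (p ∷ (v , suc t) ∷ D ∷ []))
        (sym (sweep-run p (suc t) v (table p n Δ t)))
        (ok-branch p v (suc t) _ T (v + t * n) sp keys t<T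
          -- Before this decision `v + t * n` were taken; including it there are at most `T * n`.
          (≤-trans (≤-trans (+-monoˡ-≤ (t * n) v<n) (*-monoˡ-≤ n t<T)) grid≤M)
          (sweep-distinct p n Δ (suc t) v (table-distinct p n Δ t))
          (All.map (bounded t<T) (sweep-partial p n Δ v (<⇒≤ v<n) (table-partial p n Δ t))))

    opaque
      unfolding tableT
      ok-table : OK M tableT (p ∷ n ∷ Δ ∷ T ∷ [])
      ok-table = _ , _ , T≤M , λ t t<T →
        let sw , pr = round t t<T (table-run p n Δ t) in (_ , _ , _ , (_ , sw) , _) , pr
        where
        round : ∀ t → t < T → ∀ {D} → D ≡ table p n Δ t → OK M sweepT (p ∷ suc t ∷ n ∷ D ∷ []) ×
                OK M pruneT (p ∷ (2 + t ∸ Δ) ∷ suc t ∷ run sweepT (p ∷ suc t ∷ n ∷ D ∷ []) ∷ [])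
        round t t<T refl = ok-sweep t t<T ,
          subst (λ D → OK M pruneT (p ∷ (2 + t ∸ Δ) ∷ suc t ∷ D ∷ []))
                (sym (sweep-run p (suc t) n (table p n Δ t)))
                (ok-prune p _ (suc t) _ sp
                  (All.map (λ ps → ≤-trans (proj₂ (bounded t<T ps)) (≤-trans (*-monoˡ-≤ n t<T) grid≤M)) swept)
                  (short-table t<T (sweep-distinct p n Δ (suc t) n (table-distinct p n Δ t)) swept))
          where
          swept : All (Partial p n Δ t (suc t) (n + t * n)) (sweep p (suc t) n (table p n Δ t))
          swept = sweep-partial p n Δ n ≤-refl (table-partial p n Δ t)

    best-short : length (best (table p n Δ T)) ≤ T * n
    best-short = best-all {λ s → length s ≤ T * n} (table p n Δ T) z≤n
                          (All.map (proj₁ ∘ proj₂) (table-partial p n Δ T))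

    table-short : All Short (table p n Δ T)
    table-short = All.map (λ (_ , l , _) → ≤-trans l grid≤M) (table-partial p n Δ T)

    table-length : length (table p n Δ T) ≤ M
    table-length = short-table ≤-refl (table-distinct p n Δ T) (table-partial p n Δ T)

  opaque
    unfolding chopT growT
    ok-chop : ∀ ℓ r es → length es ≤ M → OK M chopT (ℓ ∷ r ∷ es ∷ [])
    ok-chop ℓ r es l = _ , _ , l , tails-∈ es _

  opaque
    unfolding piecesT
    ok-pieces : ∀ ℓ r es → length es ≤ M → OK M piecesT (ℓ ∷ r ∷ es ∷ [])
    ok-pieces ℓ r es l = (_ , ok-chop ℓ r es l) , (_ , ok-chop ℓ r es l)

  opaque
    unfolding toFrontT
    ok-toFront : ∀ x es → length es ≤ M → OK M toFrontT (x ∷ es ∷ [])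
    ok-toFront x es l = _ , _ , l , tails-∈ es (λ e _ _ → (_ , ok-touch x e) , _)

  opaque
    unfolding stepT otherT
    ok-step : ∀ x done rest → length rest ≤ M → OK M stepT ((x , done , rest) ∷ [])
    ok-step x done rest l = (_ , ok-toFront x rest l) , _ , λ e es _ → (_ , (_ , ok-eq x _) , _) , _

  opaque
    unfolding walkT
    ok-walk : ∀ x es → length es ≤ M → OK M walkT (x ∷ es ∷ [])
    ok-walk x es l = _ , _ , l , tails-∈ es (λ _ fs _ → _ , subst (λ w → OK M stepT (w ∷ [])) (sym (walks fs))
        (ok-step _ _ _ (≤-trans (steps-short (length fs) x es) l)))
      where
      init : Walk
      init = x , [] , es
      walks : ∀ (fs : List Edge) → paraL init (λ _ _ w → run stepT (w ∷ [])) fs ≡ steps (length fs) init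
      walks []       = refl
      walks (f ∷ fs) = trans (cong (λ w → run stepT (w ∷ [])) (walks fs)) (step-run (steps (length fs) init))

  opaque
    unfolding memAppT
    ok-memApp : ∀ a s → Short s → OK M memAppT (a ∷ s ∷ [])
    ok-memApp a s l = _ , _ , l , tails-∈ s (λ b _ _ → ((_ , ok-eq _ _) , (_ , ok-eq _ _) , _) , _)

  opaque
    unfolding mergeT
    ok-merge : ∀ s s′ → length s + length s′ ≤ M → OK M mergeT (s ∷ s′ ∷ [])
    ok-merge s s′ l = _ , _ , ≤-trans (m≤m+n (length s) (length s′)) l ,
      tails-inv (λ s → length s + length s′ ≤ M)
        (λ a s l → ((_ , subst (λ z → OK M memAppT (a ∷ z ∷ [])) (sym (merge-run s s′))
                           (ok-memApp a _ (≤-trans (merge-length s s′) (<⇒≤ l)))) , _) , <⇒≤ l)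
        s l

  module _ (n Δ T : ℕ) (n≤M : n ≤ M) (T≤M : T ≤ M) (grid≤M : T * n ≤ M) where

    GoodPiece : List Edge → Set
    GoodPiece p = SmallPiece p × suc T ^ length p ≤ M

    solve-short : ∀ ps → All GoodPiece ps → length (solve-pieces n Δ T ps) ≤ length ps * (T * n)
    solve-short ps gs = ≤-trans
      (solve-length-≤ n Δ T (λ _ → T * n) ps
        (All.map (λ {p} (sp , keys) → best-short p n Δ T sp keys n≤M T≤M grid≤M) gs))
      (≤-reflexive (Σ∈-const (T * n) ps))

    opaque
      unfolding solveT
      ok-solve : ∀ ps → All GoodPiece ps → length ps ≤ M → length ps * (T * n) ≤ M →
                 OK M solveT (n ∷ Δ ∷ T ∷ ps ∷ [])
      ok-solve ps gs l lT = _ , _ , l ,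
        tails-inv (λ ps → All GoodPiece ps × length ps * (T * n) ≤ M)
          (λ { p ps ((sp , keys) ∷ gs , lT) →
               (let a , b , c = round p ps sp keys gs lT (table-run p n Δ T) (solve-run n Δ T ps)
                in ((((_ , a) , _) , b) , _) , c) , gs , ≤-trans (m≤n+m _ (T * n)) lT })
          ps (gs , lT)
        where
        round : ∀ p ps → SmallPiece p → suc T ^ length p ≤ M → All GoodPiece ps →
                length (p ∷ ps) * (T * n) ≤ M →
                ∀ {D s} → D ≡ table p n Δ T → s ≡ solve-pieces n Δ T ps →
                OK M tableT (p ∷ n ∷ Δ ∷ T ∷ []) × OK M bestT (D ∷ []) ×
                OK M mergeT (run bestT (D ∷ []) ∷ s ∷ [])
        round p ps sp keys gs lT refl refl =
          ok-table p n Δ T sp keys n≤M T≤M grid≤M ,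
          ok-best _ (table-short p n Δ T sp keys n≤M T≤M grid≤M) (table-length p n Δ T sp keys n≤M T≤M grid≤M) ,
          subst (λ z → OK M mergeT (z ∷ solve-pieces n Δ T ps ∷ [])) (sym (best-run (table p n Δ T)))
            (ok-merge _ _ (≤-trans (+-mono-≤ (best-short p n Δ T sp keys n≤M T≤M grid≤M) (solve-short ps gs)) lT))

  -- The bounds on an instance under which no recursion exceeds M iterations.
  record Fits (ℓ n T : ℕ) (es : List Edge) : Set where
    field
      labels-≤ : All Small es
      edges-≤  : suc (length es) ≤ M
      n-≤      : n ≤ M
      T-≤      : T ≤ M
      ℓ-≤      : suc ℓ ≤ M
      keys-≤   : suc T ^ suc ℓ ≤ M
      output-≤ : suc (length es) * (T * n) ≤ M

  module _ (ℓ n Δ T : ℕ) (es : List Edge) (fits : Fits ℓ n T es) where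
    open Fits fits

    private
      grid≤M : T * n ≤ M
      grid≤M = ≤-trans (m≤m+n (T * n) _) output-≤

      ps : ℕ → ℕ → List (List Edge)
      ps x r = pieces ℓ r (walk x es)

      walk-length : ∀ x → length (walk x es) ≡ length es
      walk-length x = ↭-length (walk-↭ x es)

      ps-count : ∀ x r → length (ps x r) ≤ suc (length es)
      ps-count x r = ≤-trans (chop-count ℓ r (walk x es)) (≤-reflexive (cong suc (walk-length x)))

      ps-output : ∀ x r → length (ps x r) * (T * n) ≤ M
      ps-output x r = ≤-trans (*-monoˡ-≤ (T * n) (ps-count x r)) output-≤

      ps-good : ∀ x r → r ≤ ℓ → All (GoodPiece n Δ T n-≤ T-≤ grid≤M) (ps x r)
      ps-good x r r≤ = All.zipWith
        (λ (l , h) → (≤-trans l ℓ-≤ , All.map (λ e∈ → All.lookup labels-≤ (∈-resp-↭ (walk-↭ x es) e∈)) h) ,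
                     ≤-trans (^-monoʳ-≤ (suc T) l) keys-≤)
        (chop-length ℓ r (walk x es) r≤ , chop-⊆ ℓ r (walk x es))

    candidate-short : ∀ x r → r ≤ ℓ → Short (candidate ℓ es n Δ T x r)
    candidate-short x r r≤ =
      ≤-trans (solve-short n Δ T n-≤ T-≤ grid≤M (ps x r) (ps-good x r r≤)) (ps-output x r)

    opaque
      unfolding candidateT
      ok-candidate : ∀ x r → r ≤ ℓ → OK M candidateT (ℓ ∷ es ∷ n ∷ Δ ∷ T ∷ x ∷ r ∷ [])
      ok-candidate x r r≤ = (_ , _ , _ , pieces-ok , _) , solve-ok
        where
        pieces-ok : (⊤ × ⊤ × ((⊤ × ⊤ × ⊤) × OK M walkT (x ∷ es ∷ [])) × ⊤) ×
                    OK M piecesT (ℓ ∷ r ∷ run walkT (x ∷ es ∷ []) ∷ [])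
        pieces-ok = (_ , _ , (_ , ok-walk x es (≤-trans (n≤1+n _) edges-≤)) , _) ,
          subst (λ fs → OK M piecesT (ℓ ∷ r ∷ fs ∷ [])) (sym (walk-run x es))
            (ok-pieces ℓ r (walk x es) (≤-trans (≤-reflexive (walk-length x)) (≤-trans (n≤1+n _) edges-≤)))

        solve-ok : OK M solveT (n ∷ Δ ∷ T ∷ run piecesT (ℓ ∷ r ∷ run walkT (x ∷ es ∷ []) ∷ []) ∷ [])
        solve-ok = subst (λ qs → OK M solveT (n ∷ Δ ∷ T ∷ qs ∷ []))
          (sym (trans (cong (λ fs → run piecesT (ℓ ∷ r ∷ fs ∷ [])) (walk-run x es)) (pieces-run ℓ r (walk x es))))
          (ok-solve n Δ T n-≤ T-≤ grid≤M (ps x r) (ps-good x r r≤)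
                    (≤-trans (ps-count x r) edges-≤) (ps-output x r))

    opaque
      unfolding searchT
      ok-search : OK M searchT (ℓ ∷ es ∷ n ∷ Δ ∷ T ∷ [])
      ok-search = _ , (_ , ok-candidate 0 0 z≤n) , n-≤ , λ x _ → _ , _ , ℓ-≤ , λ r r< →
        ((_ , ok-candidate x r (≤-pred r<)) , _) ,
        ok-shorter _ _ (cand-short x r (≤-pred r<)) (inner x r (<⇒≤ r<) (outer x))
        where
        cand : ℕ → ℕ → List Appearance
        cand x r = run candidateT (ℓ ∷ es ∷ n ∷ Δ ∷ T ∷ x ∷ r ∷ [])

        cand-short : ∀ x r → r ≤ ℓ → Short (cand x r)
        cand-short x r r≤ = subst Short (sym (candidate-run ℓ es n Δ T x r)) (candidate-short x r r≤)

        inner : ∀ x k → k ≤ suc ℓ → ∀ {s} → Short s →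
                Short (paraℕ s (λ r s → run shorterT (cand x r ∷ s ∷ [])) k)
        inner x zero    _ l = l
        inner x (suc r) r< l = subst Short (sym (shorter-run (cand x r) _))
          (shorter-all {Short} (cand x r) _ (cand-short x r (≤-pred r<)) (inner x r (<⇒≤ r<) l))

        outer : ∀ m → Short (paraℕ (cand 0 0)
                  (λ x s → paraℕ s (λ r s → run shorterT (cand x r ∷ s ∷ [])) (suc ℓ)) m)
        outer zero    = cand-short 0 0 z≤n
        outer (suc x) = inner x (suc ℓ) ≤-refl (outer x)

    opaque
      unfolding lifetimeT
      ok-lifetime : OK M lifetimeT (es ∷ [])
      ok-lifetime = _ , _ , ≤-trans (n≤1+n _) edges-≤ , tails-∈ es (λ e _ e∈ →
        _ , _ , All.lookup labels-≤ e∈ , tails-∈ (proj₂ e) (λ _ _ _ → _ , ok-max _ _))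

  opaque
    unfolding programT
    ok-program : ∀ Δ ℓ n es → Fits ℓ n (lifetime es) es → OK M (programT Δ ℓ) ((n , es) ∷ [])
    ok-program Δ ℓ n es fits = (_ , _ , _ , _ , (_ , ok-lifetime ℓ n Δ _ es fits) , _) ,
      subst (λ T → OK M searchT (ℓ ∷ es ∷ n ∷ Δ ∷ T ∷ [])) (sym (lifetime-run es))
        (ok-search ℓ n Δ (lifetime es) es fits)

opaque
  unfolding programT lifetimeT searchT candidateT solveT mergeT memAppT walkT stepT otherT toFrontT
            piecesT chopT growT bestT tableT sweepT pruneT branchT insertT shorterT lengthT sameT
            acceptT activeT lastCoverT coverT touchT memT maxT eqT leT
  -- The numbers `Δ` and `ℓ` occur as literals, all of depth 1, so every instance of the program has
  -- the depth of the one with 0 and 0. Hence the constant in the exponent of the running time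
  -- depends on neither Δ nor ε.
  exponent : ℕ
  exponent = depth (programT 0 0)

  depth-program : ∀ Δ ℓ → depth (programT Δ ℓ) ≡ exponent
  depth-program Δ ℓ = refl

-- Paths and cycles

toEdge : (G : TemporalGraph) → Fin (TemporalGraph.|E| G) → Edge
toEdge G e = (toℕ (proj₁ (ends e)) , toℕ (proj₂ (ends e))) , labels e
  where open TemporalGraph G

edges : TemporalGraph → List Edge
edges G = tabulate (toEdge G)

-- G is a path or a cycle, and Next u v holds if v follows u in a fixed direction.
record Linear (G : TemporalGraph) : Set₁ where
  open TemporalGraph G
  field
    Next            : Fin |V| → Fin |V| → Set
    functional      : ∀ {u v w} → Next u v → Next u w → v ≡ w
    injective       : ∀ {u v w} → Next u w → Next v w → u ≡ v
    adjacent⇒next   : ∀ {u v} → Adjacent u v → Next u v ⊎ Next v u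
    σ               : Permutation′ |V|
    consecutive     : ∀ {u v} → toℕ (σ ⟨$⟩ʳ v) ≡ suc (toℕ (σ ⟨$⟩ʳ u)) → Adjacent u v

module _ {k : ℕ} (σ : Permutation′ k) where

  position : Fin k → ℕ
  position v = toℕ (σ ⟨$⟩ʳ v)

  vertexAt : ∀ {i} → i < k → Fin k
  vertexAt i<k = σ ⟨$⟩ˡ fromℕ< i<k

  position-vertexAt : ∀ {i} (i<k : i < k) → position (vertexAt i<k) ≡ i
  position-vertexAt i<k = trans (cong toℕ (inverseʳ σ)) (toℕ-fromℕ< i<k)

  position-injective : ∀ {u v} → position u ≡ position v → u ≡ v
  position-injective eq =
    trans (sym (inverseˡ σ)) (trans (cong (σ ⟨$⟩ˡ_) (toℕ-injective eq)) (inverseˡ σ))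

  position-< : ∀ v → position v < k
  position-< v = toℕ<n (σ ⟨$⟩ʳ v)

module _ (G : TemporalGraph) where
  open TemporalGraph G

  joins-sym : ∀ {e u v} → Joins e u v → Joins e v u
  joins-sym (inj₁ p) = inj₂ p
  joins-sym (inj₂ p) = inj₁ p

  joins-ends : ∀ e → Joins e (proj₁ (ends e)) (proj₂ (ends e))
  joins-ends e = inj₁ refl

  joins-touchesˡ : ∀ {e u v} → Joins e u v → Touches (toℕ u) (toEdge G e)
  joins-touchesˡ (inj₁ p) = inj₁ (cong (toℕ ∘ proj₁) (sym p))
  joins-touchesˡ (inj₂ p) = inj₂ (cong (toℕ ∘ proj₂) (sym p))

  joins-same : ∀ {e a b u v} → Joins e a b → Joins e u v → (a ≡ u × b ≡ v) ⊎ (a ≡ v × b ≡ u)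
  joins-same (inj₁ p) (inj₁ q) with refl ← trans (sym p) q = inj₁ (refl , refl)
  joins-same (inj₁ p) (inj₂ q) with refl ← trans (sym p) q = inj₂ (refl , refl)
  joins-same (inj₂ p) (inj₁ q) with refl ← trans (sym p) q = inj₂ (refl , refl)
  joins-same (inj₂ p) (inj₂ q) with refl ← trans (sym p) q = inj₁ (refl , refl)

  touches-joins : ∀ {v e} → Touches v (toEdge G e) → ∃[ u ] ∃[ w ] (toℕ u ≡ v × Joins e u w)
  touches-joins {e = e} (inj₁ eq) = _ , _ , sym eq , joins-ends e
  touches-joins {e = e} (inj₂ eq) = _ , _ , sym eq , joins-sym (joins-ends e)

  at? : ∀ v e → Dec (Touches v (toEdge G e))
  at? v e = touches? v (toEdge G e)

  edgesAt : ℕ → List (Fin |E|)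
  edgesAt v = filter (at? v) (allFin |E|)

  edgesAt-unique : ∀ v → Unique (edgesAt v)
  edgesAt-unique v = Unique.filter⁺ (at? v) (Unique.allFin⁺ |E|)

  ∈-edgesAt : ∀ {v e} → Touches v (toEdge G e) → e ∈ edgesAt v
  ∈-edgesAt {v} {e} t = ∈-filter⁺ (at? v) (∈-allFin e) t

  edgesAt-touches : ∀ {v e} → e ∈ edgesAt v → Touches v (toEdge G e)
  edgesAt-touches {v} e∈ = proj₂ (∈-filter⁻ (at? v) {xs = allFin |E|} e∈)

  degree-edgesAt : ∀ v → degree v (edges G) ≡ length (edgesAt v)
  degree-edgesAt v = trans (cong (degree v) (sym (map-tabulate id (toEdge G)))) (go (allFin |E|))
    where
    go : ∀ fs → degree v (map (toEdge G) fs) ≡ length (filter (at? v) fs)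
    go []       = refl
    go (f ∷ fs) with at? v f
    ... | yes t rewrite filter-accept (at? v) {x = f} {xs = fs} t =
      trans (degree-touch v (toEdge G f) (map (toEdge G) fs) t) (cong suc (go fs))
    ... | no ¬t rewrite filter-reject (at? v) {x = f} {xs = fs} ¬t =
      trans (degree-skip v (toEdge G f) (map (toEdge G) fs) ¬t) (go fs)

  edges-loopless : ∀ {e} → e ∈ edges G → proj₁ (proj₁ e) ≢ proj₂ (proj₁ e)
  edges-loopless e∈ with ∈-tabulate⁻ e∈
  ... | f , refl = λ eq → loopless f (toℕ-injective eq)

  module _ (L : Linear G) where
    open Linear L

    Forward Backward : ℕ → Fin |E| → Set
    Forward  v e = ∃[ u ] ∃[ w ] (toℕ u ≡ v × Joins e u w × Next u w)
    Backward v e = ∃[ u ] ∃[ w ] (toℕ u ≡ v × Joins e u w × Next w u)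

    oriented : ∀ {v e} → Touches v (toEdge G e) → Forward v e ⊎ Backward v e
    oriented t with touches-joins t
    ... | u , w , eq , j with adjacent⇒next (_ , j)
    ...   | inj₁ n = inj₁ (u , w , eq , j , n)
    ...   | inj₂ n = inj₂ (u , w , eq , j , n)

    forward-unique : ∀ {v e f} → Forward v e → Forward v f → e ≡ f
    forward-unique (u , w , eq , j , n) (u′ , w′ , eq′ , j′ , n′)
      with refl ← toℕ-injective (trans eq (sym eq′)) with refl ← functional n n′ = noParallel _ _ u w j j′

    backward-unique : ∀ {v e f} → Backward v e → Backward v f → e ≡ f
    backward-unique (u , w , eq , j , n) (u′ , w′ , eq′ , j′ , n′)
      with refl ← toℕ-injective (trans eq (sym eq′)) with refl ← injective n n′ = noParallel _ _ u w j j′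

    -- As `Next` is functional and injective, a vertex has at most one forward and one backward
    -- edge, and of three edges two would have the same direction.
    linear-degree : ∀ v → degree v (edges G) ≤ 2
    linear-degree v rewrite degree-edgesAt v = go (edgesAt v) (edgesAt-unique v) edgesAt-touches
      where
      go : ∀ fs → Unique fs → (∀ {e} → e ∈ fs → Touches v (toEdge G e)) → length fs ≤ 2
      go []              _ _ = z≤n
      go (_ ∷ [])        _ _ = s≤s z≤n
      go (_ ∷ _ ∷ [])    _ _ = ≤-refl
      go (a ∷ b ∷ c ∷ _) ((a≢b ∷ a≢c ∷ _) ∷ (b≢c ∷ _) ∷ _) at
        with oriented (at (here refl)) | oriented (at (there (here refl)))
           | oriented (at (there (there (here refl))))
      ... | inj₁ p | inj₁ q | _      = contradiction (forward-unique p q) a≢b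
      ... | inj₁ p | inj₂ _ | inj₁ r = contradiction (forward-unique p r) a≢c
      ... | inj₁ _ | inj₂ q | inj₂ r = contradiction (backward-unique q r) b≢c
      ... | inj₂ p | inj₂ q | _      = contradiction (backward-unique p q) a≢b
      ... | inj₂ p | inj₁ _ | inj₂ r = contradiction (backward-unique p r) a≢c
      ... | inj₂ _ | inj₁ q | inj₁ r = contradiction (forward-unique q r) b≢c

    end-degree : ∀ x → (∀ v → ¬ Next v x) → degree (toℕ x) (edges G) ≤ 1
    end-degree x end rewrite degree-edgesAt (toℕ x) = go (edgesAt (toℕ x)) (edgesAt-unique (toℕ x)) edgesAt-touches
      where
      forward : ∀ {e} → Touches (toℕ x) (toEdge G e) → Forward (toℕ x) e
      forward t with oriented t
      ... | inj₁ f = f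
      ... | inj₂ (u , w , eq , j , n) with refl ← toℕ-injective eq = contradiction n (end w)

      go : ∀ fs → Unique fs → (∀ {e} → e ∈ fs → Touches (toℕ x) (toEdge G e)) → length fs ≤ 1
      go []          _ _ = z≤n
      go (_ ∷ [])    _ _ = ≤-refl
      go (a ∷ b ∷ _) ((a≢b ∷ _) ∷ _) at =
        contradiction (forward-unique (forward (at (here refl))) (forward (at (there (here refl))))) a≢b

    inner-degree : ∀ {u v w} → u ≢ w → Adjacent u v → Adjacent v w →
                   degree (toℕ v) (edges G) ≡ 2
    inner-degree {u} {v} {w} u≢w (e , je) (f , jf) = ≤-antisym (linear-degree (toℕ v))
      (subst (2 ≤_) (sym (degree-edgesAt (toℕ v)))
        (unique-⊆-length {xs = e ∷ f ∷ []} ((e≢f ∷ []) ∷ [] ∷ [])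
          λ { (here refl)         → ∈-edgesAt {e = e} (joins-touchesˡ {e} (joins-sym je))
            ; (there (here refl)) → ∈-edgesAt {e = f} (joins-touchesˡ {f} jf) }))
      where
      e≢f : e ≢ f
      e≢f refl with joins-same je jf
      ... | inj₁ (p , q) = u≢w (trans p q)
      ... | inj₂ (p , _) = u≢w p

    -- An edge is determined by its tail with respect to `Next`. On a long cycle this compares `ℓ`
    -- with the number of vertices over which weights are averaged.
    edges-≤-vertices : |E| ≤ |V|
    edges-≤-vertices = injective⇒≤ {f = tail} tail-injective
      where
      pick : ∀ e → ∃[ a ] ∃[ b ] (Joins e a b × Next a b)
      pick e with adjacent⇒next (e , joins-ends e)
      ... | inj₁ n = _ , _ , joins-ends e , n
      ... | inj₂ n = _ , _ , joins-sym (joins-ends e) , n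
      tail : Fin |E| → Fin |V|
      tail e = proj₁ (pick e)
      tail-injective : ∀ {e f} → tail e ≡ tail f → e ≡ f
      tail-injective {e} {f} eq with pick e | pick f
      ... | a , b , j , n | a′ , b′ , j′ , n′ with refl ← eq with refl ← functional n n′ =
        noParallel e f a b j j′

    -- The edges between consecutive positions are distinct. The running time is stated in terms of
    -- the number of edges, so the number of vertices has to be bounded by it.
    vertices-≤-edges : ∀ k → k ≡ |V| → k ≤ suc |E|
    vertices-≤-edges zero    _  = z≤n
    vertices-≤-edges (suc k) eq = s≤s (injective⇒≤ {f = λ i → proj₁ (link i)} link-injective)
      where
      lower : ∀ (i : Fin k) → toℕ i < |V|
      lower i = subst (toℕ i <_) eq (m<n⇒m<1+n (toℕ<n i))
      upper : ∀ (i : Fin k) → suc (toℕ i) < |V|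
      upper i = subst (suc (toℕ i) <_) eq (s≤s (toℕ<n i))
      link : ∀ i → Adjacent (vertexAt σ (lower i)) (vertexAt σ (upper i))
      link i = consecutive (trans (position-vertexAt σ (upper i)) (cong suc (sym (position-vertexAt σ (lower i)))))
      positions : ∀ {a b} (p : a < |V|) (q : b < |V|) → vertexAt σ p ≡ vertexAt σ q → a ≡ b
      positions p q eq = trans (sym (position-vertexAt σ p)) (trans (cong (position σ) eq) (position-vertexAt σ q))
      link-injective : ∀ {i j} → proj₁ (link i) ≡ proj₁ (link j) → i ≡ j
      link-injective {i} {j} eq with link i | link j
      ... | e , je | f , jf with refl ← eq with joins-same je jf
      ...   | inj₁ (p , _) = toℕ-injective (positions (lower i) (lower j) p)
      ...   | inj₂ (p , q) = contradiction
                (trans (positions (lower i) (upper j) p) (cong suc (sym (positions (upper i) (lower j) q))))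
                (λ eq → m≢1+n+m (toℕ i) {1} eq)

    -- Connectedness as an induction principle: `P` spreads from `x` down to position 0 and from
    -- there up to any position.
    linear-connected : ∀ (x : Fin |V|) (P : ℕ → Set) →
      (∀ {e} → e ∈ edges G → ∀ {v w} → Touches v e → Touches w e → P v → P w) →
      P (toℕ x) → ∀ {e} → e ∈ edges G → ∀ {v} → Touches v e → P v
    linear-connected x P closed px e∈ t with ∈-tabulate⁻ e∈
    ... | f , refl with touches-joins t
    ...   | u , _ , refl , _ = subst (P ∘ toℕ) (position-injective σ (position-vertexAt σ (position-< σ u)))
              (up (position σ u) (position-< σ u))
      where
      along : ∀ {u v} → Adjacent u v → P (toℕ u) → P (toℕ v)
      along (e , j) = closed (∈-tabulate⁺ e) (joins-touchesˡ j) (joins-touchesˡ (joins-sym j))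
      link : ∀ {i} (p : i < |V|) (q : suc i < |V|) → Adjacent (vertexAt σ p) (vertexAt σ q)
      link p q = consecutive (trans (position-vertexAt σ q) (cong suc (sym (position-vertexAt σ p))))
      down : ∀ i (p : i < |V|) → P (toℕ (vertexAt σ p)) → ∀ (q : 0 < |V|) → P (toℕ (vertexAt σ q))
      down zero    p h q =
        subst (P ∘ toℕ) (position-injective σ (trans (position-vertexAt σ p) (sym (position-vertexAt σ q)))) h
      down (suc i) p h q = down i (<⇒≤ p) (along (adjacent-sym (link (<⇒≤ p) p)) h) q
        where
        adjacent-sym : ∀ {u v} → Adjacent u v → Adjacent v u
        adjacent-sym (e , j) = e , joins-sym j
      up : ∀ i (p : i < |V|) → P (toℕ (vertexAt σ p))
      up zero    p = down (position σ x) (position-< σ x)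
        (subst (P ∘ toℕ) (sym (position-injective σ (position-vertexAt σ (position-< σ x)))) px) p
      up (suc i) p = along (link (<⇒≤ p) p) (up i (<⇒≤ p))

  path-linear : IsPath graph → Σ[ L ∈ Linear G ] ∃[ x ] (∀ v → ¬ Linear.Next L v x)
  path-linear (1≤ , σ , adj) = record
    { Next          = λ u v → position σ v ≡ suc (position σ u)
    ; functional    = λ p q → position-injective σ (trans p (sym q))
    ; injective     = λ p q → position-injective σ (suc-injective (trans (sym p) q))
    ; adjacent⇒next = λ {u} {v} a → Equivalence.to (adj u v) a
    ; σ             = σ
    ; consecutive   = λ {u} {v} p → Equivalence.from (adj u v) (inj₁ p)
    } , vertexAt σ 1≤ , λ v p → contradiction (trans (sym (position-vertexAt σ 1≤)) p) λ()

  cycle-linear : IsCycle graph → Σ[ L ∈ Linear G ] (∀ (v : Fin |V|) → degree (toℕ v) (edges G) ≡ 2)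
  cycle-linear (3≤ , σ , adj) = L , λ v →
    let w , n = successor v ; u , m = predecessor v
    in inner-degree L (distinct {u} {v} {w} m n) (next⇒adjacent {u} {v} m) (next⇒adjacent {v} {w} n)
    where
    pos = position σ

    Next : Fin |V| → Fin |V| → Set
    Next u v = pos v ≡ suc (pos u) ⊎ (pos v ≡ 0 × suc (pos u) ≡ |V|)

    next⇒adjacent : ∀ {u v} → Next u v → Adjacent u v
    next⇒adjacent {u} {v} (inj₁ p) = Equivalence.from (adj u v) (inj₁ (inj₁ p))
    next⇒adjacent {u} {v} (inj₂ p) = Equivalence.from (adj u v) (inj₂ (inj₂ p))

    functional : ∀ {u v w} → Next u v → Next u w → v ≡ w
    functional (inj₁ p) (inj₁ q) = position-injective σ (trans p (sym q))
    functional {v = v} (inj₁ p) (inj₂ (_ , q)) = contradiction (position-< σ v) (<-irrefl (trans p q))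
    functional {w = w} (inj₂ (_ , p)) (inj₁ q) = contradiction (position-< σ w) (<-irrefl (trans q p))
    functional (inj₂ (p , _)) (inj₂ (q , _)) = position-injective σ (trans p (sym q))

    injective : ∀ {u v w} → Next u w → Next v w → u ≡ v
    injective (inj₁ p) (inj₁ q) = position-injective σ (suc-injective (trans (sym p) q))
    injective (inj₁ p) (inj₂ (q , _)) = contradiction (trans (sym q) p) λ()
    injective (inj₂ (p , _)) (inj₁ q) = contradiction (trans (sym p) q) λ()
    injective (inj₂ (_ , p)) (inj₂ (_ , q)) = position-injective σ (suc-injective (trans p (sym q)))

    adjacent⇒next : ∀ {u v} → Adjacent u v → Next u v ⊎ Next v u
    adjacent⇒next {u} {v} a with Equivalence.to (adj u v) a
    ... | inj₁ (inj₁ p) = inj₁ (inj₁ p)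
    ... | inj₁ (inj₂ p) = inj₂ (inj₁ p)
    ... | inj₂ (inj₁ p) = inj₂ (inj₂ p)
    ... | inj₂ (inj₂ p) = inj₁ (inj₂ p)

    L : Linear G
    L = record
      { Next = Next ; functional = functional ; injective = injective
      ; adjacent⇒next = adjacent⇒next ; σ = σ
      ; consecutive = λ {u} {v} p → next⇒adjacent {u} {v} (inj₁ p) }

    successor : ∀ v → ∃[ w ] Next v w
    successor v with suc (pos v) <? |V|
    ... | yes p = vertexAt σ p , inj₁ (position-vertexAt σ p)
    ... | no ¬p = vertexAt σ 0< , inj₂ (position-vertexAt σ 0< , ≤-antisym (position-< σ v) (≮⇒≥ ¬p))
      where 0< = ≤-trans (s≤s z≤n) 3≤

    predecessor : ∀ v → ∃[ u ] Next u v
    predecessor v with pos v in eq | position-< σ v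
    ... | suc i | p = vertexAt σ (<⇒≤ p) , inj₁ (cong suc (sym (position-vertexAt σ (<⇒≤ p))))
    ... | zero  | p = let u , eq′ = last |V| refl (≤-trans (s≤s z≤n) 3≤) in u , inj₂ (refl , eq′)
      where
      last : ∀ k → k ≡ |V| → 1 ≤ k → ∃[ u ] suc (pos u) ≡ |V|
      last (suc k) eq _ =
        vertexAt σ (≤-reflexive eq) , trans (cong suc (position-vertexAt σ (≤-reflexive eq))) eq

    -- Without wrapping around, the positions of `u` and `w` differ by 2. With wrapping, equal
    -- neighbours would mean |V| ≤ 2, which `3≤` excludes.
    distinct : ∀ {u v w} → Next u v → Next v w → u ≢ w
    distinct {u} (inj₁ p) (inj₁ q) refl = m≢1+n+m (pos u) {1} (trans q (cong suc p))
    distinct (inj₁ p) (inj₂ (q , r)) refl = <⇒≢ 3≤ (trans (cong suc (cong suc (sym q))) (trans (cong suc (sym p)) r))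
    distinct (inj₂ (p , r)) (inj₁ q) refl = <⇒≢ 3≤ (trans (cong (suc ∘ suc) (sym p)) (trans (cong suc (sym q)) r))
    distinct (inj₂ (p , _)) (inj₂ (_ , r)) refl = <⇒≢ (≤-trans (n≤1+n 2) 3≤) (trans (cong suc (sym p)) r)

-- Correctness of the program

merge-∈ˡ : ∀ {a} s s′ → a ∈ s → a ∈ merge s s′
merge-∈ˡ (a ∷ s) s′ (here refl) = if-elim (a ∈_) (a ∈ᴬ? merge s s′) id (λ _ → here refl)
merge-∈ˡ {b} (a ∷ s) s′ (there b∈) =
  if-elim (b ∈_) (a ∈ᴬ? merge s s′) (λ _ → merge-∈ˡ s s′ b∈) (λ _ → there (merge-∈ˡ s s′ b∈))

merge-∈ʳ : ∀ {a} s s′ → a ∈ s′ → a ∈ merge s s′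
merge-∈ʳ []      s′ a∈ = a∈
merge-∈ʳ {b} (a ∷ s) s′ b∈ =
  if-elim (b ∈_) (a ∈ᴬ? merge s s′) (λ _ → merge-∈ʳ s s′ b∈) (λ _ → there (merge-∈ʳ s s′ b∈))

merge-unique : ∀ s {s′} → Unique s′ → Unique (merge s s′)
merge-unique []      u = u
merge-unique (a ∷ s) {s′} u = if-elim Unique (a ∈ᴬ? merge s s′) (λ _ → merge-unique s u)
  (λ a∉ → All.¬Any⇒All¬ _ a∉ ∷ merge-unique s u)

merge-all : ∀ {P : Appearance → Set} s {s′} → All P s → All P s′ → All P (merge s s′)
merge-all []      []       qs = qs
merge-all {P} (a ∷ s) {s′} (p ∷ ps) qs = if-elim (All P) (a ∈ᴬ? merge s s′)
  (λ _ → merge-all s ps qs) (λ _ → p ∷ merge-all s ps qs)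

windowOK-⊆ : ∀ {Δ t s s′ e} → (∀ {a} → a ∈ s → a ∈ s′) → WindowOK Δ t s e → WindowOK Δ t s′ e
windowOK-⊆ inc ok 1≤ act = let (a , a∈ , rest) = ok 1≤ act in a , inc a∈ , rest

shortest-all : ∀ {P : List Appearance → Set} f m k → (∀ x r → r ≤ k → P (f x r)) →
               P (shortest f m (suc k))
shortest-all f zero    k h = h 0 0 z≤n
shortest-all {P} f (suc x) k h = go (suc k) ≤-refl
  where
  go : ∀ j → j ≤ suc k → P (paraℕ (shortest f x (suc k)) (λ r s → shorter (f x r) s) j)
  go zero    _  = shortest-all {P} f x k h
  go (suc r) r< = shorter-all {P} (f x r) _ (h x r (≤-pred r<)) (go r (<⇒≤ r<))

shortest-≤ : ∀ f m k {x r} → x < m → r < k → length (shortest f m k) ≤ length (f x r)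
shortest-≤ f (suc y) k {x} {r} (s≤s x≤y) r<k with x ≟ y
... | yes refl = go k r<k
  where
  go : ∀ j → r < j → length (paraℕ (shortest f y k) (λ r s → shorter (f y r) s) j) ≤ length (f y r)
  go (suc j) (s≤s r≤j) with r ≟ j
  ... | yes refl = shorter-≤ˡ (f y r) _
  ... | no r≢j   = ≤-trans (shorter-≤ʳ (f y j) _) (go j (≤∧≢⇒< r≤j r≢j))
... | no x≢y = go k
  where
  go : ∀ j → length (paraℕ (shortest f y k) (λ r s → shorter (f y r) s) j) ≤ length (f x r)
  go zero    = shortest-≤ f y k (≤∧≢⇒< x≤y x≢y) r<k
  go (suc j) = ≤-trans (shorter-≤ʳ (f y j) _) (go j)

below-average : ∀ f n → ∃[ v ] (v < suc n × suc n * f v ≤ Σ< (suc n) f)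
below-average f zero    = 0 , s≤s z≤n , ≤-refl
below-average f (suc n) with below-average f n
... | v , v< , le with f (suc n) ≤? f v
...   | yes p = suc n , ≤-refl , +-monoʳ-≤ (f (suc n)) (≤-trans (*-monoʳ-≤ (suc n) p) le)
...   | no ¬p = v , m<n⇒m<1+n v< , +-mono-≤ (≰⇒≥ ¬p) le

Σ∈-length : ∀ {A : Set} {P : A → Set} (P? : ∀ a → Dec (P a)) xs →
            length (filter P? xs) ≡ Σ∈ (λ a → 𝟙 (does (P? a))) xs
Σ∈-length P? [] = refl
Σ∈-length P? (x ∷ xs) with P? x
... | yes _ = cong suc (Σ∈-length P? xs)
... | no _  = Σ∈-length P? xs

-- Validity and length of the candidates

module _ (n Δ T : ℕ) where

  InRange : Edge → Set
  InRange e = proj₁ (proj₁ e) < n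

  -- An active edge can be covered at its first endpoint, so taking all appearances succeeds.
  -- Therefore the final table is not empty, and `best` does not fall back on its default `[]`.
  all-feasible : ∀ {p} → All InRange p → Feasible p n Δ (λ _ _ → true) T
  all-feasible {p} h t t<T = All.map (λ {e} → serve e) h
    where
    serve : ∀ e → InRange e → FeasibleAt p n Δ (λ _ _ → true) t e
    serve e u<n 1≤i act =
      let x , x∈ , i≤x , x≤ = find act
      in (_ , x) , (u<n , ≤-trans 1≤i i≤x , x≤) , refl , (inj₁ refl , x∈) , i≤x

  best-partial : ∀ {p} → All InRange p → Partial p n Δ T T (T * n) (best (table p n Δ T))
  best-partial {p} h =
    let _ , s∈ , _ = find (table-dominated p n Δ (λ _ _ → true) T (all-feasible h) T ≤-refl)
    in best-nonempty (table p n Δ T) s∈ (table-partial p n Δ T)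

  Valid : List Edge → List Appearance → Set
  Valid es s = Unique s × All (Grid n T) s × (∀ {e} → e ∈ es → ∀ u → 1 ≤ u → u ≤ T → WindowOK Δ u s e)

  solve-valid : ∀ ps → All (All InRange) ps →
    Unique (solve-pieces n Δ T ps) × All (Grid n T) (solve-pieces n Δ T ps) ×
    (∀ {p e} → p ∈ ps → e ∈ p → ∀ u → 1 ≤ u → u ≤ T → WindowOK Δ u (solve-pieces n Δ T ps) e)
  solve-valid []       []       = [] , [] , λ ()
  solve-valid (p ∷ ps) (h ∷ hs) with solve-valid ps hs | best-partial h
  ... | uq , gr , win | gr′ , _ , win′ = merge-unique b uq , merge-all b gr′ gr , λ
    { (here refl) e∈ u 1≤ u≤ → windowOK-⊆ {Δ} {u} (merge-∈ˡ b _) (All.lookup (win′ u 1≤ u≤) e∈)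
    ; (there p∈)  e∈ u 1≤ u≤ → windowOK-⊆ {Δ} {u} (merge-∈ʳ b _) (win p∈ e∈ u 1≤ u≤) }
    where b = best (table p n Δ T)

  candidate-valid : ∀ ℓ es → All InRange es → ∀ x r → Valid es (candidate ℓ es n Δ T x r)
  candidate-valid ℓ es h x r =
    let uq , gr , win = solve-valid (pieces ℓ r (walk x es))
          (All.map (All.map (λ e∈ → All.lookup h (∈-resp-↭ (walk-↭ x es) e∈))) (chop-⊆ ℓ r (walk x es)))
    in uq , gr , λ e∈ → let p , p∈ , e∈p = chop-∈ ℓ r (∈-resp-↭ (↭-sym (walk-↭ x es)) e∈) in win p∈ e∈p

  Respects : List Edge → List Appearance → Set
  Respects es O = ∀ {e} → e ∈ es → ∀ t → t < T → 1 ≤ 2 + t ∸ Δ → ActiveIn (2 + t ∸ Δ) (suc t) e →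
    ∃[ a ] (a ∈ O × Grid n (suc t) a × Covers e a × 2 + t ∸ Δ ≤ proj₂ a)

  -- The appearances in `O` of vertices of `p` still cover the edges of `p`, since an edge is
  -- covered at one of its endpoints. The table dominates this restriction, whose length is at most
  -- the sum.
  best-optimal : ∀ {es O} → Respects es O → ∀ {p} → All (_∈ es) p →
                 length (best (table p n Δ T)) ≤ Σ∈ (λ a → hit (proj₁ a) p) O
  best-optimal {es} {O} resp {p} p⊆ = begin
    length (best (table p n Δ T))      ≤⟨ best-dominated p (table p n Δ T)
                                            (table-dominated p n Δ o T feasible T ≤-refl) ⟩
    length (select o n T)              ≤⟨ unique-⊆-length (select-unique o n T) selected ⟩
    length (filter meets? O)              ≡⟨ Σ∈-length meets? O ⟩
    Σ∈ (λ a → hit (proj₁ a) p) O       ∎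
    where
    open ≤-Reasoning
    meets? : ∀ a → Dec (Any (Touches (proj₁ a)) p)
    meets? a = Any.any? (touches? (proj₁ a)) p
    chosen? : ∀ a → Dec (a ∈ O × Any (Touches (proj₁ a)) p)
    chosen? a = (a ∈ᴬ? O) ×-dec meets? a
    o : ℕ → ℕ → Bool
    o v t = does (chosen? (v , t))
    selected : ∀ {a} → a ∈ select o n T → a ∈ filter meets? O
    selected {a} a∈ with chosen? a | proj₂ (All.lookup (select-sound o n T) a∈)
    ... | yes (a∈O , t) | _ = ∈-filter⁺ meets? a∈O t
    ... | no ¬c | eq = contradiction (trans (sym eq) (dec-false (chosen? a) ¬c)) λ()
    feasible : Feasible p n Δ o T
    feasible t t<T = All.tabulate λ {e} e∈ 1≤i act →
      let a , a∈O , g , c , i≤ = resp (All.lookup p⊆ e∈) t t<T 1≤i act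
      in a , g , dec-true (chosen? a) (a∈O , lose e∈ (proj₁ c)) , c , i≤

  -- The bounds for the pieces are added and the two sums exchanged: an appearance counts once for
  -- every piece that its vertex meets.
  candidate-≤ : ∀ ℓ {es O} → Respects es O → ∀ x r →
                length (candidate ℓ es n Δ T x r) ≤ Σ∈ (λ a → hits (proj₁ a) (pieces ℓ r (walk x es))) O
  candidate-≤ ℓ {es} {O} resp x r = ≤-trans
    (solve-length-≤ n Δ T (λ p → Σ∈ (λ a → hit (proj₁ a) p) O) ps
      (All.map (λ h → best-optimal resp (All.map (∈-resp-↭ (walk-↭ x es)) h)) (chop-⊆ ℓ r (walk x es))))
    (≤-reflexive (Σ∈-swap (λ p a → hit (proj₁ a) p) ps O))
    where ps = pieces ℓ r (walk x es)

  -- The best of the suc ℓ candidates starting at x is at most their average.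
  search-≤ : ∀ ℓ {es O} → Respects es O → ∀ x → x < n → (c : ℕ → ℕ) →
             (∀ v → Σ< (suc ℓ) (λ r → hits v (pieces ℓ r (walk x es))) ≤ 2 + ℓ + c v) →
             suc ℓ * length (search ℓ es n Δ T) ≤ length O * (2 + ℓ) + Σ∈ (c ∘ proj₁) O
  search-≤ ℓ {es} {O} resp x x<n c h = begin
    suc ℓ * length (search ℓ es n Δ T)
      ≡⟨ Σ<-const (suc ℓ) _ ⟨
    Σ< (suc ℓ) (λ _ → length (search ℓ es n Δ T))
      ≤⟨ Σ<-mono (suc ℓ) (λ r r< → ≤-trans (shortest-≤ (candidate ℓ es n Δ T) n (suc ℓ) x<n r<)
                                           (candidate-≤ ℓ resp x r)) ⟩
    Σ< (suc ℓ) (λ r → Σ∈ (λ a → hits (proj₁ a) (pieces ℓ r (walk x es))) O)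
      ≡⟨ Σ<-Σ∈-swap (λ r a → hits (proj₁ a) (pieces ℓ r (walk x es))) (suc ℓ) O ⟩
    Σ∈ (λ a → Σ< (suc ℓ) (λ r → hits (proj₁ a) (pieces ℓ r (walk x es)))) O
      ≤⟨ Σ∈-mono O (λ a _ → h (proj₁ a)) ⟩
    Σ∈ (λ a → 2 + ℓ + c (proj₁ a)) O
      ≡⟨ Σ∈-+ (λ _ → 2 + ℓ) (c ∘ proj₁) O ⟩
    Σ∈ (λ _ → 2 + ℓ) O + Σ∈ (c ∘ proj₁) O
      ≡⟨ cong (_+ Σ∈ (c ∘ proj₁) O) (Σ∈-const (2 + ℓ) O) ⟩
    length O * (2 + ℓ) + Σ∈ (c ∘ proj₁) O ∎
    where open ≤-Reasoning

  -- With at most `ℓ` edges the shift `ℓ` leaves a single piece, which is solved exactly; the start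
  -- 0 is among those searched because `0 < n`.
  search-≤-single : ∀ ℓ {es O} → Respects es O → 0 < n → length es ≤ ℓ →
                    length (search ℓ es n Δ T) ≤ length O
  search-≤-single ℓ {es} {O} resp 0<n len = begin
    length (search ℓ es n Δ T)  ≤⟨ shortest-≤ (candidate ℓ es n Δ T) n (suc ℓ) 0<n ≤-refl ⟩
    length (candidate ℓ es n Δ T 0 ℓ)  ≤⟨ candidate-≤ ℓ resp 0 ℓ ⟩
    Σ∈ (λ a → hits (proj₁ a) (pieces ℓ ℓ (walk 0 es))) O
      ≤⟨ Σ∈-mono O (λ a _ → subst (λ ps → hits (proj₁ a) ps ≤ 1) (sym single)
                              (≤-trans (≤-reflexive (+-identityʳ _))
                                       (𝟙-≤1 (does (Any.any? (touches? (proj₁ a)) (walk 0 es)))))) ⟩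
    Σ∈ (λ _ → 1) O  ≡⟨ trans (Σ∈-const 1 O) (*-identityʳ (length O)) ⟩
    length O ∎
    where
    open ≤-Reasoning
    k = ℓ ∸ length (walk 0 es)
    single : pieces ℓ ℓ (walk 0 es) ≡ walk 0 es ∷ []
    single = cong (λ c → proj₁ (proj₂ c) ∷ proj₂ (proj₂ c))
      (trans (cong (λ r → chop ℓ r (walk 0 es))
                   (sym (m∸n+n≡m (≤-trans (≤-reflexive (↭-length (walk-↭ 0 es))) len))))
             (chop-all ℓ k (walk 0 es)))

≤-foldr-⊔ : ∀ {x} m xs → x ∈ xs → x ≤ foldr _⊔_ m xs
≤-foldr-⊔ m (y ∷ xs) (here refl) = m≤m⊔n y _
≤-foldr-⊔ m (y ∷ xs) (there x∈)  = ≤-trans (≤-foldr-⊔ m xs x∈) (m≤n⊔m y _)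

init-≤-foldr-⊔ : ∀ m xs → m ≤ foldr _⊔_ m xs
init-≤-foldr-⊔ m []       = ≤-refl
init-≤-foldr-⊔ m (y ∷ xs) = ≤-trans (init-≤-foldr-⊔ m xs) (m≤n⊔m y _)

foldr-⊔-≤ : ∀ {b m xs} → m ≤ b → All (_≤ b) xs → foldr _⊔_ m xs ≤ b
foldr-⊔-≤ m≤ []       = m≤
foldr-⊔-≤ m≤ (p ∷ ps) = ⊔-lub p (foldr-⊔-≤ m≤ ps)

label-≤-lifetime : ∀ es {e x} → e ∈ es → x ∈ proj₂ e → x ≤ lifetime es
label-≤-lifetime (e ∷ es) (here refl) x∈ = ≤-foldr-⊔ (lifetime es) (proj₂ e) x∈
label-≤-lifetime (e ∷ es) (there e∈)  x∈ =
  ≤-trans (label-≤-lifetime es e∈ x∈) (init-≤-foldr-⊔ (lifetime es) (proj₂ e))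

lifetime-≤ : ∀ {b} es → All (λ e → All (_≤ b) (proj₂ e)) es → lifetime es ≤ b
lifetime-≤ []       []       = z≤n
lifetime-≤ (e ∷ es) (h ∷ hs) = foldr-⊔-≤ (lifetime-≤ es hs) h

-- Translation between lists and temporal graphs

module _ (G : TemporalGraph) where
  open TemporalGraph G

  label-≤-T : ∀ {e x} → x ∈ labels e → x ≤ T
  label-≤-T {e} x∈ = All.lookup (xs≤max 0 (concat (tabulate labels)))
                                (∈-concat⁺′ x∈ (∈-tabulate⁺ {f = labels} e))

  lifetime-T : lifetime (edges G) ≡ T
  lifetime-T = ≤-antisym
    (lifetime-≤ (edges G) (All.tabulate⁺ λ e → All.tabulate (label-≤-T {e})))
    (max≤v⁺ z≤n (All.tabulate λ x∈ →
      let ls , x∈ls , ls∈ = ∈-concat⁻′ (tabulate labels) x∈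
          e , eq = ∈-tabulate⁻ ls∈
      in label-≤-lifetime (edges G) (∈-tabulate⁺ e) (subst (_ ∈_) eq x∈ls)))

  edges-inRange : ∀ Δ → All (InRange |V| Δ T) (edges G)
  edges-inRange Δ = All.tabulate⁺ λ e → toℕ<n (proj₁ (ends e))

  forget : Fin |V| × ℕ → Appearance
  forget (v , t) = toℕ v , t

  fromGrid : ∀ {s} → All (Grid |V| T) s → List (Fin |V| × ℕ)
  fromGrid []                             = []
  fromGrid (_∷_ {x = v , t} (v<n , _) gs) = (fromℕ< v<n , t) ∷ fromGrid gs

  forget-fromGrid : ∀ {s} (gs : All (Grid |V| T) s) → map forget (fromGrid gs) ≡ s
  forget-fromGrid []                                 = refl
  forget-fromGrid (_∷_ {x = v , t} (v<n , _) gs) =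
    cong₂ _∷_ (cong (_, t) (toℕ-fromℕ< v<n)) (forget-fromGrid gs)

  toSet : ∀ {s} → Unique s → All (Grid |V| T) s → AppearanceSet G
  toSet uq gs = record
    { elements = fromGrid gs
    ; unique   = Unique.map⁻ (subst Unique (sym (forget-fromGrid gs)) uq)
    ; inRange  = inRange gs
    }
    where
    inRange : ∀ {s} (gs : All (Grid |V| T) s) → All (λ (v , t) → 1 ≤ t × t ≤ T) (fromGrid gs)
    inRange []                = []
    inRange ((_ , p , q) ∷ gs) = (p , q) ∷ inRange gs

  module _ (Δ : ℕ) (1≤Δ : 1 ≤ Δ) where

    valid-IsTVC : ∀ {s} ((uq , gs , win) : Valid |V| Δ T (edges G) s) → IsTVC G Δ (toSet uq gs)
    valid-IsTVC {s} (uq , gs , win) i 1≤i i≤ e (x , x∈ , i≤x , x<) =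
      let a , a∈ , (touch , t∈) , i≤t , t≤u =
            win (∈-tabulate⁺ e) u 1≤u u≤T (subst (1 ≤_) start 1≤i)
                (lose x∈ (subst (_≤ x) start i≤x , ≤-pred (subst (x <_) end x<)))
          (v , t) , vt∈ , eq = ∈-map⁻ forget (subst (a ∈_) (sym (forget-fromGrid gs)) a∈)
      in v , t , vt∈ ,
         subst (InWindow Δ i) (cong proj₂ eq)
           (subst (_≤ proj₂ a) (sym start) i≤t , subst (proj₂ a <_) (sym end) (s≤s t≤u)) ,
         endpoint (subst (λ w → Touches w (toEdge G e)) (cong proj₁ eq) touch) ,
         subst (_∈ labels e) (cong proj₂ eq) t∈
      where
      u : ℕ
      -- The last time of the window from `i`, by which the sweep indexes it.
      u = ℕ.pred (i + Δ)
      end : i + Δ ≡ suc u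
      end = sym (suc-pred (i + Δ) {{ℕ.>-nonZero (≤-trans 1≤i (m≤m+n i Δ))}})
      start : i ≡ suc u ∸ Δ
      start = trans (sym (m+n∸n≡m i Δ)) (cong (_∸ Δ) end)
      u≤T : u ≤ T
      u≤T = ≤-pred (≤-trans (≤-reflexive (sym end)) i≤)
      1≤u : 1 ≤ u
      1≤u = ≤-pred (≤-trans (+-mono-≤ 1≤i 1≤Δ) (≤-reflexive end))
      endpoint : ∀ {v} → Touches (toℕ v) (toEdge G e) → Endpoint v e
      endpoint (inj₁ p) = inj₁ (toℕ-injective p)
      endpoint (inj₂ p) = inj₂ (toℕ-injective p)

    IsTVC-respects : ∀ (S : AppearanceSet G) → IsTVC G Δ S → Respects |V| Δ T (edges G) (encodeSet S)
    IsTVC-respects S tvc {e} e∈ t t<T 1≤i act with ∈-tabulate⁻ e∈ | find act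
    ... | f , refl | x , x∈ , i≤x , x≤ =
      let v , u , vu∈ , (i≤u , u<) , endpoint , u∈ = tvc (2 + t ∸ Δ) 1≤i
            (≤-trans (≤-reflexive end) (s≤s t<T)) f (x , x∈ , i≤x , ≤-trans (s≤s x≤) (≤-reflexive (sym end)))
          1≤u , _ = All.lookup (AppearanceSet.inRange S) vu∈
      in (toℕ v , u) , ∈-map⁺ forget vu∈ , (toℕ<n v , 1≤u , ≤-pred (≤-trans u< (≤-reflexive end))) ,
         (touches endpoint , u∈) , i≤u
      where
      end : 2 + t ∸ Δ + Δ ≡ 2 + t
      -- A positive start means that the subtraction was not truncated.
      end = m∸n+n≡m (<⇒≤ (m∸n≢0⇒n<m {2 + t} {Δ} λ eq → contradiction (subst (1 ≤_) eq 1≤i) λ()))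
      touches : ∀ {v} → Endpoint v f → Touches (toℕ v) (toEdge G f)
      touches (inj₁ p) = inj₁ (cong toℕ p)
      touches (inj₂ p) = inj₂ (cong toℕ p)

    length-encodeSet : ∀ S → length (encodeSet {G} S) ≡ AppearanceSet.card S
    length-encodeSet S = length-map _ (AppearanceSet.elements S)

    module _ (ℓ : ℕ) where

      linear-local : ∀ (L : Linear G) (x : Fin |V|) →
        degree (toℕ x) (edges G) ≤ 1 ⊎ (∀ {e v} → e ∈ edges G → Touches v e → degree v (edges G) ≡ 2) →
        ∀ v → v ≢ toℕ x → Local ℓ v (walk (toℕ x) (edges G))
      linear-local L x ends =
        walk-local ℓ (edges G) (toℕ x) (linear-degree G L) (edges-loopless G) (linear-connected G L x) ends

      search-approx : PathOrCycle G → ∀ {O} → Respects |V| Δ T (edges G) O →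
                      suc ℓ * length (search ℓ (edges G) |V| Δ T) ≤ (3 + ℓ) * length O
      search-approx (inj₁ path) {O} resp with path-linear G path
      ... | L , x , end = begin
        suc ℓ * length (search ℓ (edges G) |V| Δ T)
          ≤⟨ search-≤ |V| Δ T ℓ resp (toℕ x) (toℕ<n x) (λ _ → 0) bound ⟩
        length O * (2 + ℓ) + Σ∈ (λ _ → 0) O   ≡⟨ cong (length O * (2 + ℓ) +_) (Σ∈-zero O) ⟩
        length O * (2 + ℓ) + 0                ≡⟨ +-identityʳ _ ⟩
        -- Relaxed to the factor that cycles need.
        length O * (2 + ℓ)                    ≤⟨ *-monoʳ-≤ (length O) (n≤1+n (2 + ℓ)) ⟩
        length O * (3 + ℓ)                    ≡⟨ *-comm (length O) (3 + ℓ) ⟩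
        (3 + ℓ) * length O                    ∎
        where
        open ≤-Reasoning
        bound : ∀ v → Σ< (suc ℓ) (λ r → hits v (pieces ℓ r (walk (toℕ x) (edges G)))) ≤ 2 + ℓ + 0
        bound v = ≤-trans (local-hits ℓ (local v)) (≤-reflexive (sym (+-identityʳ (2 + ℓ))))
          where
          local : ∀ v → Local ℓ v (walk (toℕ x) (edges G))
          local v with v ≟ toℕ x
          ... | no v≢x   = linear-local L x (inj₁ (end-degree G L x end)) v v≢x
          ... | yes refl = degree-1-local ℓ v _
            (≤-trans (≤-reflexive (degree-↭ v (walk-↭ v (edges G)))) (end-degree G L x end))
      search-approx (inj₂ cycle@(3≤ , _)) {O} resp with cycle-linear G cycle | length (edges G) ≤? ℓ
      ... | L , deg | yes short = *-mono-≤ (m≤n+m (suc ℓ) 2)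
              (search-≤-single |V| Δ T ℓ resp (≤-trans (s≤s z≤n) 3≤) short)
      ... | L , deg | no long = begin
        suc ℓ * length (search ℓ (edges G) |V| Δ T)
          ≤⟨ search-≤ |V| Δ T ℓ resp x x<n extra bound ⟩
        length O * (2 + ℓ) + Σ∈ (extra ∘ proj₁) O
          ≡⟨ cong (length O * (2 + ℓ) +_) (Σ∈-* ℓ (λ a → 𝟙 (does (x ≟ proj₁ a))) O) ⟩
        length O * (2 + ℓ) + ℓ * weight x
          ≤⟨ +-monoʳ-≤ (length O * (2 + ℓ)) light ⟩
        length O * (2 + ℓ) + length O
          ≡⟨ solve 2 (λ o l → o :* (con 2 :+ l) :+ o := (con 3 :+ l) :* o) refl (length O) ℓ ⟩
        (3 + ℓ) * length O ∎
        where
        open ≤-Reasoning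
        weight : ℕ → ℕ
        weight v = Σ∈ (λ a → 𝟙 (does (v ≟ proj₁ a))) O

        total : Σ< |V| weight ≤ length O
        total = begin
          Σ< |V| weight  ≡⟨ Σ<-Σ∈-swap (λ v a → 𝟙 (does (v ≟ proj₁ a))) |V| O ⟩
          Σ∈ (λ a → Σ< |V| (λ v → 𝟙 (does (v ≟ proj₁ a)))) O
            ≤⟨ Σ∈-mono O (λ a _ → Σ<-indicator (proj₁ a) |V|) ⟩
          Σ∈ (λ _ → 1) O ≡⟨ trans (Σ∈-const 1 O) (*-identityʳ (length O)) ⟩
          length O ∎

        lightest : ∀ n → 1 ≤ n → ∃[ v ] (v < n × n * weight v ≤ Σ< n weight)
        lightest (suc n) _ = below-average weight n

        x : ℕ
        x = proj₁ (lightest |V| (≤-trans (s≤s z≤n) 3≤))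
        x<n : x < |V|
        x<n = proj₁ (proj₂ (lightest |V| (≤-trans (s≤s z≤n) 3≤)))
        extra : ℕ → ℕ
        extra v = ℓ * 𝟙 (does (x ≟ v))

        -- The weight of `x` is at most the average |O| / |V|, and ℓ < |E| ≤ |V| since the cycle is
        -- long.
        light : ℓ * weight x ≤ length O
        light = begin
          ℓ * weight x         ≤⟨ *-monoˡ-≤ (weight x) (<⇒≤ (≰⇒> long)) ⟩
          length (edges G) * weight x  ≡⟨ cong (_* weight x) (length-tabulate (toEdge G)) ⟩
          |E| * weight x       ≤⟨ *-monoˡ-≤ (weight x) (edges-≤-vertices G L) ⟩
          |V| * weight x       ≤⟨ proj₂ (proj₂ (lightest |V| (≤-trans (s≤s z≤n) 3≤))) ⟩
          Σ< |V| weight        ≤⟨ total ⟩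
          length O ∎

        no-ends : ∀ {e v} → e ∈ edges G → Touches v e → degree v (edges G) ≡ 2
        no-ends e∈ t with ∈-tabulate⁻ e∈
        ... | f , refl with touches-joins G {e = f} t
        ...   | u , _ , refl , _ = deg u

        bound : ∀ v → Σ< (suc ℓ) (λ r → hits v (pieces ℓ r (walk x (edges G)))) ≤ 2 + ℓ + extra v
        bound v with x ≟ v
        ... | yes refl rewrite dec-true (x ≟ x) refl | *-identityʳ ℓ = double-hits ℓ {x} {walk x (edges G)}
          (≤-trans (≤-reflexive (degree-↭ x (walk-↭ x (edges G)))) (linear-degree G L x))
        ... | no x≢v = ≤-trans (local-hits ℓ local) (m≤m+n (2 + ℓ) _)
          where
          local : Local ℓ v (walk x (edges G))
          local = subst (λ y → Local ℓ v (walk y (edges G))) (toℕ-fromℕ< x<n)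
            (linear-local L (fromℕ< x<n) (inj₂ no-ends) v (λ eq → x≢v (sym (trans eq (toℕ-fromℕ< x<n)))))

-- The approximation ratio

toℚᵘ-fromℕ : ∀ n → ℚ.toℚᵘ (fromℕ n) ℚᵘ.≃ mkℚᵘ (ℤ.+ n) 0
toℚᵘ-fromℕ n = ℚ.toℚᵘ-fromℚᵘ (mkℚᵘ (ℤ.+ n) 0)

fromℕ-mono : ∀ {m n} → m ≤ n → fromℕ m ℚ.≤ fromℕ n
fromℕ-mono {m} {n} m≤n = ℚ.toℚᵘ-cancel-≤
  (ℚᵘ.≤-trans (ℚᵘ.≤-reflexive (toℚᵘ-fromℕ m))
  (ℚᵘ.≤-trans (ℚᵘ.*≤* (ℤ.*-monoʳ-≤-nonNeg (ℤ.+ 1) (ℤ.+≤+ m≤n)))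
              (ℚᵘ.≤-reflexive (ℚᵘ.≃-sym (toℚᵘ-fromℕ n)))))

fromℕ-* : ∀ m n → fromℕ (m * n) ≡ fromℕ m ℚ.* fromℕ n
fromℕ-* m n = ℚ.toℚᵘ-injective (ℚᵘ.≃-trans (toℚᵘ-fromℕ (m * n))
  (ℚᵘ.≃-trans (ℚᵘ.*≡* (cong (ℤ._* ℤ.+ 1) (ℤ.pos-* m n)))
  (ℚᵘ.≃-sym (ℚᵘ.≃-trans (ℚ.toℚᵘ-homo-* (fromℕ m) (fromℕ n))
                        (ℚᵘ.*-cong (toℚᵘ-fromℕ m) (toℚᵘ-fromℕ n))))))

fromℕ-suc : ∀ n → fromℕ (suc n) ≡ ℚ.1ℚ ℚ.+ fromℕ n
fromℕ-suc n = ℚ.toℚᵘ-injective (ℚᵘ.≃-trans (toℚᵘ-fromℕ (suc n))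
  (ℚᵘ.≃-trans (ℚᵘ.*≡* (cong (λ z → (ℤ.+ 1 ℤ.+ z) ℤ.* ℤ.+ 1) (sym (ℤ.*-identityʳ (ℤ.+ n)))))
  (ℚᵘ.≃-sym (ℚᵘ.≃-trans (ℚ.toℚᵘ-homo-+ ℚ.1ℚ (fromℕ n))
                        (ℚᵘ.+-congʳ (mkℚᵘ (ℤ.+ 1) 0) (toℚᵘ-fromℕ n))))))

-- The ceiling is - ⌊- p⌋, so the bound is the negated inequality of integer division for a negative
-- numerator.
ceiling-pos : ∀ p .{{_ : Positive p}} → 1 ≤ ℤ.∣ ℚ.ceiling p ∣ × p ℚ.≤ fromℕ ℤ.∣ ℚ.ceiling p ∣
ceiling-pos p@(ℚ.mkℚ (ℤ.+ suc n) d-1 _) = go (ℤ.- q) bound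
  where
  q = ℤ.-[1+ n ] ℤ./ ℤ.+ suc d-1
  bound : ℤ.+ suc n ℤ.≤ (ℤ.- q) ℤ.* ℤ.+ suc d-1
  bound = subst (ℤ.+ suc n ℤ.≤_) (ℤ.neg-distribˡ-* q (ℤ.+ suc d-1))
                (ℤ.neg-mono-≤ ([n/d]*d≤n ℤ.-[1+ n ] (ℤ.+ suc d-1)))
  go : ∀ c → ℤ.+ suc n ℤ.≤ c ℤ.* ℤ.+ suc d-1 → 1 ≤ ℤ.∣ c ∣ × p ℚ.≤ fromℕ ℤ.∣ c ∣
  go (ℤ.+ zero)   le = contradiction le λ { (ℤ.+≤+ ()) }
  go ℤ.-[1+ k ]   le = contradiction le λ ()
  go (ℤ.+ suc k)  le = s≤s z≤n , ℚ.toℚᵘ-cancel-≤ (ℚᵘ.≤-trans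
    (ℚᵘ.*≤* (subst (ℤ._≤ ℤ.+ suc k ℤ.* ℤ.+ suc d-1) (sym (ℤ.*-identityʳ (ℤ.+ suc n))) le))
    (ℚᵘ.≤-reflexive (ℚᵘ.≃-sym (toℚᵘ-fromℕ (suc k)))))

module _ (ε : ℚ) .{{ε>0 : Positive ε}} where

  private
    ε⁻¹ : ℚ
    ε⁻¹ = (ℚ.1/ ε) {{ℚ.pos⇒nonZero ε}}

    instance
      ε⁻¹>0 : Positive ε⁻¹
      ε⁻¹>0 = ℚ.1/pos⇒pos ε

      ε⁻²>0 : Positive (ε⁻¹ ℚ.* ε⁻¹)
      ε⁻²>0 = ℚ.pos*pos⇒pos ε⁻¹ ε⁻¹

      ε≥0 : ℚ.NonNegative ε
      ε≥0 = ℚ.pos⇒nonNeg ε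

      ε⁻¹≥0 : ℚ.NonNegative ε⁻¹
      ε⁻¹≥0 = ℚ.pos⇒nonNeg ε⁻¹

  ⌈ε⁻²⌉-pos : 1 ≤ ⌈ ε ⁻²⌉
  ⌈ε⁻²⌉-pos = proj₁ (ceiling-pos (ε⁻¹ ℚ.* ε⁻¹))

  -- The ratio requires ⌈ε⁻²⌉ to be at least 1/ε. For ε ≥ 1 this holds because the ceiling of a
  -- positive number is at least 1, for ε ≤ 1 because ε⁻² ≥ ε⁻¹.
  1≤ε⌈ε⁻²⌉ : ℚ.1ℚ ℚ.≤ ε ℚ.* fromℕ ⌈ ε ⁻²⌉
  1≤ε⌈ε⁻²⌉ with ℚ.≤-total ℚ.1ℚ ε
  ... | inj₁ 1≤ε = begin
    ℚ.1ℚ                    ≤⟨ 1≤ε ⟩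
    ε                       ≡⟨ ℚ.*-identityʳ ε ⟨
    ε ℚ.* ℚ.1ℚ              ≤⟨ ℚ.*-monoˡ-≤-nonNeg ε (fromℕ-mono ⌈ε⁻²⌉-pos) ⟩
    ε ℚ.* fromℕ ⌈ ε ⁻²⌉     ∎
    where open ℚ.≤-Reasoning
  ... | inj₂ ε≤1 = begin
    ℚ.1ℚ                    ≡⟨ ℚ.*-inverseʳ ε {{ℚ.pos⇒nonZero ε}} ⟨
    ε ℚ.* ε⁻¹               ≤⟨ ℚ.*-monoʳ-≤-nonNeg ε⁻¹ ε≤1 ⟩
    ℚ.1ℚ ℚ.* ε⁻¹            ≡⟨ cong (ℚ._* ε⁻¹) (ℚ.*-inverseʳ ε {{ℚ.pos⇒nonZero ε}}) ⟨
    (ε ℚ.* ε⁻¹) ℚ.* ε⁻¹     ≡⟨ ℚ.*-assoc ε ε⁻¹ ε⁻¹ ⟩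
    ε ℚ.* (ε⁻¹ ℚ.* ε⁻¹)     ≤⟨ ℚ.*-monoˡ-≤-nonNeg ε (proj₂ (ceiling-pos (ε⁻¹ ℚ.* ε⁻¹))) ⟩
    ε ℚ.* fromℕ ⌈ ε ⁻²⌉     ∎
    where open ℚ.≤-Reasoning

  -- With m = ⌈ε⁻²⌉ the factor is (m + 1)/m = 1 + 1/m ≤ 1 + ε; everything is multiplied by m to
  -- avoid division.
  ratio : ∀ a b → ⌈ ε ⁻²⌉ * a ≤ suc ⌈ ε ⁻²⌉ * b → fromℕ a ℚ.≤ (ℚ.1ℚ ℚ.+ ε) ℚ.* fromℕ b
  ratio a b h = ℚ.*-cancelˡ-≤-pos M {{M>0}} (begin
    M ℚ.* A                              ≡⟨ fromℕ-* ⌈ ε ⁻²⌉ a ⟨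
    fromℕ (⌈ ε ⁻²⌉ * a)                  ≤⟨ fromℕ-mono h ⟩
    fromℕ (suc ⌈ ε ⁻²⌉ * b)              ≡⟨ fromℕ-* (suc ⌈ ε ⁻²⌉) b ⟩
    fromℕ (suc ⌈ ε ⁻²⌉) ℚ.* B            ≡⟨ cong (ℚ._* B) (fromℕ-suc ⌈ ε ⁻²⌉) ⟩
    (ℚ.1ℚ ℚ.+ M) ℚ.* B                   ≤⟨ ℚ.*-monoʳ-≤-nonNeg B {{B≥0}} (ℚ.+-monoˡ-≤ M 1≤ε⌈ε⁻²⌉) ⟩
    (ε ℚ.* M ℚ.+ M) ℚ.* B                ≡⟨ cong (ℚ._* B) (trans (ℚ.+-comm (ε ℚ.* M) M)
                                              (cong₂ ℚ._+_ (sym (ℚ.*-identityʳ M)) (ℚ.*-comm ε M))) ⟩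
    (M ℚ.* ℚ.1ℚ ℚ.+ M ℚ.* ε) ℚ.* B       ≡⟨ cong (ℚ._* B) (ℚ.*-distribˡ-+ M ℚ.1ℚ ε) ⟨
    (M ℚ.* (ℚ.1ℚ ℚ.+ ε)) ℚ.* B           ≡⟨ ℚ.*-assoc M (ℚ.1ℚ ℚ.+ ε) B ⟩
    M ℚ.* ((ℚ.1ℚ ℚ.+ ε) ℚ.* B)           ∎)
    where
    open ℚ.≤-Reasoning
    M A B : ℚ
    M = fromℕ ⌈ ε ⁻²⌉
    A = fromℕ a
    B = fromℕ b
    M>0 : Positive M
    M>0 = ℚ.normalize-pos ⌈ ε ⁻²⌉ 1 {{_}} {{ℕ.>-nonZero ⌈ε⁻²⌉-pos}}
    B≥0 : ℚ.NonNegative B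
    B≥0 = ℚ.normalize-nonNeg b 1

-- The theorem

n<2^n : ∀ n → n < 2 ^ n
n<2^n zero    = s≤s z≤n
n<2^n (suc n) = +-mono-≤ (≤-trans (s≤s z≤n) (n<2^n n)) (≤-trans (n<2^n n) (m≤m+n _ 0))

^-distribʳ-* : ∀ k m n → (m * n) ^ k ≡ m ^ k * n ^ k
^-distribʳ-* zero    m n = refl
^-distribʳ-* (suc k) m n = trans (cong (m * n *_) (^-distribʳ-* k m n))
  (solve 4 (λ m n x y → m :* n :* (x :* y) := m :* x :* (n :* y)) refl m n (m ^ k) (n ^ k))

identity : ∀ {Γ} (ρ : Env Γ) → Agree id ρ ρ
identity ρ x = refl

-- Twice ⌈ε⁻²⌉ edges per piece: one half of ε pays for the cuts, the other half for
-- the start of the walk along a cycle.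
shift-bound : ℕ → ℕ
shift-bound m = m + ℕ.pred m

suc-shift-bound : ∀ m → 1 ≤ m → suc (shift-bound m) ≡ 2 * m
suc-shift-bound (suc k) _ = solve 1 (λ k → con 1 :+ (con 1 :+ k :+ k) := con 2 :* (con 1 :+ k)) refl k

algorithm : (Δ m : ℕ) → Algorithm
algorithm Δ m = compile id (programT Δ (shift-bound m))

module _ (Δ m : ℕ) (1≤Δ : 1 ≤ Δ) (1≤m : 1 ≤ m) (G : TemporalGraph) where
  open TemporalGraph G

  private
    ℓ : ℕ
    ℓ = shift-bound m

  algorithm-output : output (algorithm Δ m) G ≡ search ℓ (edges G) |V| Δ T
  algorithm-output = trans (compile-val (programT Δ ℓ) (identity (encode G ∷ [])))
    (trans (program-run Δ ℓ |V| (edges G)) (cong (search ℓ (edges G) |V| Δ) (lifetime-T G)))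

  search-valid : Valid |V| Δ T (edges G) (search ℓ (edges G) |V| Δ T)
  search-valid = shortest-all {Valid |V| Δ T (edges G)} (candidate ℓ (edges G) |V| Δ T) |V| ℓ
    (λ x r _ → candidate-valid |V| Δ T ℓ (edges G) (edges-inRange G Δ) x r)

  solution : AppearanceSet G
  solution = let uq , gs , _ = search-valid in toSet G uq gs

  output-solution : output (algorithm Δ m) G ≡ encodeSet solution
  output-solution = trans algorithm-output (sym (forget-fromGrid G (proj₁ (proj₂ search-valid))))

  solution-IsTVC : IsTVC G Δ solution
  solution-IsTVC = valid-IsTVC G Δ 1≤Δ search-valid

  -- As `suc ℓ` is 2 m, the factor (3 + ℓ)/(1 + ℓ) of `search-approx` is (2 m + 2)/(2 m), and the 2
  -- cancels.
  solution-approx : PathOrCycle G → ∀ S → IsTVC G Δ S →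
                    m * AppearanceSet.card solution ≤ suc m * AppearanceSet.card S
  solution-approx line S tvc = *-cancelˡ-≤ 2 (begin
    2 * (m * AppearanceSet.card solution)
      ≡⟨ *-assoc 2 m _ ⟨
    2 * m * AppearanceSet.card solution
      ≡⟨ cong₂ _*_ (sym (suc-shift-bound m 1≤m)) card-solution ⟩
    suc ℓ * length (search ℓ (edges G) |V| Δ T)
      ≤⟨ search-approx G Δ 1≤Δ ℓ line (IsTVC-respects G Δ 1≤Δ S tvc) ⟩
    (2 + suc ℓ) * length (encodeSet S)
      ≡⟨ cong₂ (λ a b → (2 + a) * b) (suc-shift-bound m 1≤m) (length-encodeSet G Δ 1≤Δ S) ⟩
    (2 + 2 * m) * AppearanceSet.card S
      ≡⟨ solve 2 (λ m c → (con 2 :+ con 2 :* m) :* c := con 2 :* ((con 1 :+ m) :* c))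
               refl m (AppearanceSet.card S) ⟩
    2 * (suc m * AppearanceSet.card S) ∎)
    where
    open ≤-Reasoning
    card-solution : AppearanceSet.card solution ≡ length (search ℓ (edges G) |V| Δ T)
    card-solution = trans (sym (length-encodeSet G Δ 1≤Δ solution))
                          (cong length (forget-fromGrid G (proj₁ (proj₂ search-valid))))

  -- Label lists are scanned by recursions, so their lengths have to be bounded; labels are distinct
  -- and at most `T`.
  label-count : ∀ e → length (labels e) ≤ suc T
  label-count e = ≤-trans
    (unique-⊆-length (unique e) (λ x∈ → ∈-upTo⁺ (s≤s (label-≤-T G x∈))))
    (≤-reflexive (length-upTo (suc T)))

  -- With M = B ^ (4 m) the at most (1 + T) ^ (2 m) entries of a table are within M.
  runtime-≤ : ∀ B → 2 ≤ B → |V| ≤ B → suc |E| ≤ B → suc T ≤ B →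
              runtime (algorithm Δ m) G ≤ B ^ (4 * exponent * m)
  runtime-≤ B 2≤B V≤B E≤B T≤B = begin
    runtime (algorithm Δ m) G
      ≤⟨ compile-cost M 4≤M (programT Δ ℓ) (identity (encode G ∷ [])) (ok-program M Δ ℓ |V| (edges G) fits) ⟩
    M ^ depth (programT Δ ℓ)      ≡⟨ cong (M ^_) (depth-program Δ ℓ) ⟩
    M ^ exponent                  ≡⟨ ^-*-assoc B (4 * m) exponent ⟩
    B ^ (4 * m * exponent)        ≡⟨ cong (B ^_)
        (solve 2 (λ m e → con 4 :* m :* e := con 4 :* e :* m) refl m exponent) ⟩
    B ^ (4 * exponent * m)        ∎
    where
    open ≤-Reasoning
    M : ℕ
    M = B ^ (4 * m)
    instance
      B≢0 : ℕ.NonZero B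
      B≢0 = ℕ.>-nonZero (≤-trans (s≤s z≤n) 2≤B)

    powers : ∀ k → k ≤ 4 * m → B ^ k ≤ M
    powers k k≤ = ^-monoʳ-≤ B k≤

    4≤4m : 4 ≤ 4 * m
    4≤4m = *-monoʳ-≤ 4 1≤m

    B≤M : B ≤ M
    B≤M = ≤-trans (≤-reflexive (sym (*-identityʳ B))) (powers 1 (≤-trans (s≤s z≤n) 4≤4m))

    4≤M : 4 ≤ M
    4≤M = ≤-trans (^-monoˡ-≤ 2 2≤B) (powers 2 (≤-trans (s≤s (s≤s z≤n)) 4≤4m))

    2m≤4m : 2 * m ≤ 4 * m
    2m≤4m = *-monoˡ-≤ m (m≤n+m 2 2)

    fits : Fits M ℓ |V| (lifetime (edges G)) (edges G)
    fits rewrite lifetime-T G = record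
      { labels-≤ = All.tabulate⁺ λ e → ≤-trans (label-count e) (≤-trans T≤B B≤M)
      ; edges-≤  = ≤-trans (s≤s edge-count) (≤-trans E≤B B≤M)
      ; n-≤      = ≤-trans V≤B B≤M
      ; T-≤      = ≤-trans (n≤1+n T) (≤-trans T≤B B≤M)
      -- The length of a piece depends on ε alone and may exceed the size of the instance; the
      -- exponent absorbs it.
      ; ℓ-≤      = begin
          suc ℓ        ≡⟨ suc-shift-bound m 1≤m ⟩
          2 * m        ≤⟨ <⇒≤ (n<2^n (2 * m)) ⟩
          2 ^ (2 * m)  ≤⟨ ^-monoˡ-≤ (2 * m) 2≤B ⟩
          B ^ (2 * m)  ≤⟨ powers (2 * m) 2m≤4m ⟩
          M            ∎
      ; keys-≤   = begin
          suc T ^ suc ℓ    ≡⟨ cong (suc T ^_) (suc-shift-bound m 1≤m) ⟩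
          suc T ^ (2 * m)  ≤⟨ ^-monoˡ-≤ (2 * m) T≤B ⟩
          B ^ (2 * m)      ≤⟨ powers (2 * m) 2m≤4m ⟩
          M                ∎
      -- Three factors of `B` exceed `B ^ (2 * m)` when m = 1; the exponent 4 m of `M` has room for
      -- them.
      ; output-≤ = begin
          suc (length (edges G)) * (T * |V|)
            ≤⟨ *-mono-≤ (≤-trans (s≤s edge-count) E≤B) (*-mono-≤ (≤-trans (n≤1+n T) T≤B) V≤B) ⟩
          B * (B * B)        ≡⟨ cong (λ z → B * (B * z)) (sym (*-identityʳ B)) ⟩
          B ^ 3              ≤⟨ powers 3 (≤-trans (n≤1+n 3) 4≤4m) ⟩
          M                  ∎
      }
      where
      edge-count : length (edges G) ≤ |E|
      edge-count = ≤-reflexive (length-tabulate (toEdge G))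

linear : ∀ G → PathOrCycle G → Linear G
linear G (inj₁ path)  = proj₁ (path-linear G path)
linear G (inj₂ cycle) = proj₁ (cycle-linear G cycle)

has-vertex : ∀ G → PathOrCycle G → 1 ≤ TemporalGraph.|V| G
has-vertex G (inj₁ (1≤ , _)) = 1≤
has-vertex G (inj₂ (3≤ , _)) = ≤-trans (s≤s z≤n) 3≤

has-edge : ∀ G → 1 ≤ TemporalGraph.T G → 1 ≤ TemporalGraph.|E| G
has-edge G 1≤T = go |E| labels 1≤T
  where
  open TemporalGraph G
  go : ∀ k (ls : Fin k → List ℕ) → 1 ≤ max 0 (concat (tabulate ls)) → 1 ≤ k
  go zero    _ ()
  go (suc k) _ _ = s≤s z≤n

algorithm-approximates : ∀ Δ → 2 ≤ Δ → ∀ (ε : ℚ) .{{_ : Positive ε}} →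
                         Approximates Δ ε (algorithm Δ ⌈ ε ⁻²⌉)
algorithm-approximates Δ 2≤Δ ε G line =
  solution Δ m 1≤Δ 1≤m G , output-solution Δ m 1≤Δ 1≤m G , solution-IsTVC Δ m 1≤Δ 1≤m G ,
  λ S* (tvc , _) → ratio ε _ _ (solution-approx Δ m 1≤Δ 1≤m G line S* tvc)
  where
  m : ℕ
  m = ⌈ ε ⁻²⌉
  1≤m : 1 ≤ m
  1≤m = ⌈ε⁻²⌉-pos ε
  1≤Δ : 1 ≤ Δ
  1≤Δ = ≤-trans (n≤1+n 1) 2≤Δ

-- A positive lifetime forces an edge, so the base T (n + 1) is at least 2 and dominates |V| ≤ n + 1
-- as well as T + 1 ≤ 2 T.
algorithm-runtime : ∀ Δ → 2 ≤ Δ → ∀ (ε : ℚ) .{{_ : Positive ε}} → ∀ G → PathOrCycle G →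
                    1 ≤ TemporalGraph.T G →
                    runtime (algorithm Δ ⌈ ε ⁻²⌉) G ≤ powerBound (4 * exponent) ε G
algorithm-runtime Δ 2≤Δ ε G line 1≤T =
  runtime-≤ Δ ⌈ ε ⁻²⌉ (≤-trans (n≤1+n 1) 2≤Δ) (⌈ε⁻²⌉-pos ε) G (T * suc |E|)
    (*-mono-≤ 1≤T (s≤s 1≤E))
    (≤-trans (vertices-≤-edges G (linear G line) |V| refl) E≤)
    E≤
    (begin
      suc T          ≤⟨ +-monoˡ-≤ T 1≤T ⟩
      T + T          ≡⟨ solve 1 (λ t → t :+ t := t :* con 2) refl T ⟩
      T * 2          ≤⟨ *-monoʳ-≤ T (s≤s 1≤E) ⟩
      T * suc |E|    ∎)
  where
  open TemporalGraph G
  open ≤-Reasoning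
  1≤E : 1 ≤ |E|
  1≤E = has-edge G 1≤T
  E≤ : suc |E| ≤ T * suc |E|
  E≤ = ≤-trans (≤-reflexive (sym (*-identityˡ (suc |E|)))) (*-monoˡ-≤ (suc |E|) 1≤T)

-- With T = 0 the base T (n + 1) vanishes, so a bound for all instances takes the base 2 + `size G`,
-- which is at most 3 times `size G` because there is a vertex.
algorithm-polynomial : ∀ Δ → 2 ≤ Δ → ∀ m → 1 ≤ m → ∀ G → PathOrCycle G →
                       runtime (algorithm Δ m) G ≤ 3 ^ (4 * exponent * m) * size G ^ (4 * exponent * m)
algorithm-polynomial Δ 2≤Δ m 1≤m G line = begin
  runtime (algorithm Δ m) G
    ≤⟨ runtime-≤ Δ m (≤-trans (n≤1+n 1) 2≤Δ) 1≤m G (2 + size G) (m≤m+n 2 _)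
         (≤-trans V≤ (m≤n+m _ 2)) (≤-trans (s≤s E≤) (n≤1+n _)) (≤-trans (s≤s T≤) (n≤1+n _)) ⟩
  (2 + size G) ^ k
    ≤⟨ ^-monoˡ-≤ k (begin
         2 + size G               ≤⟨ +-monoˡ-≤ (size G) (*-monoʳ-≤ 2 1≤size) ⟩
         2 * size G + size G      ≡⟨ solve 1 (λ s → con 2 :* s :+ s := con 3 :* s) refl (size G) ⟩
         3 * size G               ∎) ⟩
  (3 * size G) ^ k         ≡⟨ ^-distribʳ-* k 3 (size G) ⟩
  3 ^ k * size G ^ k       ∎
  where
  open TemporalGraph G
  open ≤-Reasoning
  k : ℕ
  k = 4 * exponent * m
  V≤ : |V| ≤ size G
  V≤ = ≤-trans (m≤m+n |V| |E|) (m≤m+n (|V| + |E|) T)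
  E≤ : |E| ≤ size G
  E≤ = ≤-trans (m≤n+m |E| |V|) (m≤m+n (|V| + |E|) T)
  T≤ : T ≤ size G
  T≤ = m≤n+m T (|V| + |E|)
  1≤size : 1 ≤ size G
  1≤size = ≤-trans (has-vertex G line) V≤

theorem3p4 : (∃[ c ] ∃[ C ]
    (∀ (Δ : ℕ) → 2 ≤ Δ → ∀ (ε : ℚ) .{{_ : Positive ε}} →
    Σ[ A ∈ Algorithm ]
    ( Approximates Δ ε A
    × (∀ G → PathOrCycle G → Δ ≤ TemporalGraph.T G →
    runtime A G
    ≤ C * (TemporalGraph.|E| G * (suc (TemporalGraph.T G) ∸ Δ)
    * powerBound c ε G))
    × (∀ G → PathOrCycle G → 1 ≤ TemporalGraph.T G →
    runtime A G ≤ C * powerBound c ε G) )))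
    × (∀ (Δ : ℕ) → 2 ≤ Δ → HasPTAS Δ)
theorem3p4 =
  (4 * exponent , 1 , λ Δ 2≤Δ ε →
    algorithm Δ ⌈ ε ⁻²⌉ , algorithm-approximates Δ 2≤Δ ε ,
    -- For Δ ≤ T both n and T - Δ + 1 are at least 1, so the bound with these factors follows from
    -- the one without them.
    (λ G line Δ≤T →
      let 1≤T = ≤-trans (≤-trans (n≤1+n 1) 2≤Δ) Δ≤T in
      ≤-trans (algorithm-runtime Δ 2≤Δ ε G line 1≤T)
        (≤-trans (absorb (powerBound (4 * exponent) ε G)
                   (*-mono-≤ (has-edge G 1≤T) (m<n⇒0<n∸m (s≤s Δ≤T))))
                 (≤-reflexive (sym (*-identityˡ _))))) ,
    (λ G line 1≤T → ≤-trans (algorithm-runtime Δ 2≤Δ ε G line 1≤T)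
                            (≤-reflexive (sym (*-identityˡ _))))) ,
  λ Δ 2≤Δ ε → algorithm Δ ⌈ ε ⁻²⌉ , algorithm-approximates Δ 2≤Δ ε ,
    3 ^ (4 * exponent * ⌈ ε ⁻²⌉) , 4 * exponent * ⌈ ε ⁻²⌉ ,
    algorithm-polynomial Δ 2≤Δ ⌈ ε ⁻²⌉ (⌈ε⁻²⌉-pos ε)
  where
  absorb : ∀ {k} p → 1 ≤ k → p ≤ k * p
  absorb p 1≤k = ≤-trans (≤-reflexive (sym (*-identityˡ p))) (*-monoˡ-≤ p 1≤k)
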